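{- Let $P$ and $H^{(f_1)},\dots,H^{(f_k)}$ (for some $k\ge 0$) be packaged arrow presentations with pairwise disjoint edge sets, let $f_1,\dots,f_k$ be distinct edges of $P$, let $e^{(i)}$ be an edge of $H^{(f_i)}$, and let $\varphi_i$ be a coupling of $f_i$ and $e^{(i)}$ for $i=1,\dots,k$. Let \[P[k]=P\oplus_{\varphi_1}H^{(f_1)}\oplus_{\varphi_2}\cdots\oplus_{\varphi_k}H^{(f_k)}.\] Let $\mathbf{w}=\{(a_f,b_f,c_f,x_f,y_f): f\in E(P[k])\}$ be a family of indeterminate 5-tuples indexed by the edges of $P[k]$ (these are the edges of $P$ other than $f_1,\dots,f_k$ together with the edges of the $H^{(f_i)}$ other than the $e^{(i)}$). For each $i$, let $\phi^{(f_i)}_{(=,2)},\phi^{(f_i)}_{(\parallel,2)},\phi^{(f_i)}_{\times},\phi^{(f_i)}_{(=,1)},\phi^{(f_i)}_{(\parallel,1)}$ be the unique solution of \[\alpha\beta\gamma\begin{bmatrix}\alpha\beta&1&1&\alpha&1\\1&\alpha\gamma&1&1&\alpha\\1&1&\alpha&1&1\\\alpha&1&1&\alpha&1\\1&\alpha&1&1&\alpha\end{bmatrix}\begin{bmatrix}\phi^{(f_i)}_{(=,2)}\\\phi^{(f_i)}_{(\parallel,2)}\\\phi^{(f_i)}_{\times}\\\phi^{(f_i)}_{(=,1)}\\\phi^{(f_i)}_{(\parallel,1)}\end{bmatrix}=\begin{bmatrix}\mathbf{Q}(H^{(f_i)}\setminus e^{(i)};\mathbf{w},\alpha,\beta,\gamma)\\\mathbf{Q}(H^{(f_i)}/e^{(i)};\mathbf{w},\alpha,\beta,\gamma)\\\mathbf{Q}(H^{(f_i)}\dagger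 e^{(i)};\mathbf{w},\alpha,\beta,\gamma)\\\mathbf{Q}(H^{(f_i)}\setminus_m e^{(i)};\mathbf{w},\alpha,\beta,\gamma)\\\mathbf{Q}(H^{(f_i)}/_m e^{(i)};\mathbf{w},\alpha,\beta,\gamma)\end{bmatrix},\] where in each $\mathbf{Q}(H^{(f_i)}\,\cdot\, e^{(i)};\mathbf{w},\ldots)$ the edges are weighted by their tuples from $\mathbf{w}$. Let \[\mathbf{w}'=\{(\phi^{(f_i)}_{(=,2)},\phi^{(f_i)}_{(\parallel,2)},\phi^{(f_i)}_{\times},\phi^{(f_i)}_{(=,1)},\phi^{(f_i)}_{(\parallel,1)})\text{ assigned to } f_i: i=1,\dots,k\}\cup\{(a_f,b_f,c_f,x_f,y_f)\text{ assigned to } f: f\in E(P)\setminus\{f_1,\dots,f_k\}\}.\] Then $\mathbf{Q}(P[k];\mathbf{w},\alpha,\beta,\gamma)=\mathbf{Q}(P;\mathbf{w}',\alpha,\beta,\gamma)$.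
   Context: An arrow presentation $A$ consists of a finite set $V(A)$ of disjoint circles (the vertices), a finite set of pairwise disjoint arrows (directed arcs) lying on the circles, and a finite set $E(A)$ of labels (the edges), such that every arrow carries one label and every label is carried by exactly two arrows (which constitute that edge). An arrow running along a circle from point $p$ to point $q$ is written $\overrightarrow{pq}$. Two arrow presentations are equivalent if one is obtained from the other by a diffeomorphism of the circles sending arrows to arrows, reversing the directions of both arrows of some (possibly empty) set of edges, and a bijection of edge sets respecting labels; arrow presentations are considered up to equivalence. Boundary components: for every edge $e$ with arrows $\overrightarrow{p_1p_2},\overrightarrow{q_1q_2}$, remove both arrows together with the interiors of the arcs they lie on and add one curve joining $q_2$ to $p_1$ and another joining $p_2$ to $q_1$; the resulting closed curves are the boundary components, forming the set $B(A)$. For an edge $e$ with arrows $\overrightarrow{p_1p_2},\overrightarrow{q_1q_2}$: the deletion $A\setminus e$ removes the two arrows (not the arcs they lie on) and removes $e$ from the edge set; the contraction $A/e$ removes the two arrows together with the interiors of their arcs, identifies $p_1$ with $q_2$ and $p_2$ with $q_1$, and removes $e$; the Penrose-contraction $A\dagger e$ does the same but identifies $p_1$ with $q_1$ and $p_2$ with $q_2$. A packaged arrow presentation is a triple $P=(A,\mathcal V,\mathcal B)$ with $A$ an arrow presentation, $\mathcal V$ a partition of $V(A)$ and $\mathcal B$ a partition of $B(A)$; $[v]$ denotes the block containing $v$. Edges, vertices, etc. of $P$ are those of $A$. For an edge $e$ let $u,v$ be its incident vertices and $a,b$ its incident boundary components (possibly $u=v$, $a=b$). Vertices of $A$ and $A\setminus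 e$ are naturally identified; vertices of $A$ other than $u,v$ are identified with vertices of $A/e$ (resp. $A\dagger e$), and the remaining vertices of $A/e$ (resp. $A\dagger e$) form the set $T$ of vertices created. Boundary components of $A$ and $A/e$ are naturally identified; boundary components of $A$ other than $a,b$ are identified with boundary components of $A\setminus e$ (resp. $A\dagger e$), the remaining ones forming the set $S$ of boundary components created. Define $\mathcal V'=(\mathcal V-\{[u],[v]\})\cup\{[u]\cup[v]\}$, $\mathcal B'=(\mathcal B-\{[a],[b]\})\cup\{[a]\cup[b]\cup S-\{a,b\}\}$ (with $S$ from the deletion), $\mathcal V''=(\mathcal V-\{[u],[v]\})\cup\{[u]\cup[v]\cup T-\{u,v\}\}$ (with $T$ from the contraction), $\mathcal B''=(\mathcal B-\{[a],[b]\})\cup\{[a]\cup[b]\}$, and $\mathcal V''',\mathcal B'''$ as $\mathcal V'',\mathcal B'$ but with $T,S$ the sets created by the Penrose-contraction. Then: deletion $P\setminus e=(A\setminus e,\mathcal V,\mathcal B')$; merge-deletion $P\setminus_m e=(A\setminus e,\mathcal V',\mathcal B')$; contraction $P/e=(A/e,\mathcal V'',\mathcal B)$; merge-contraction $P/_m e=(A/e,\mathcal V'',\mathcal B'')$; Penrose-contraction $P\dagger e=(A\dagger e,\mathcal V''',\mathcal B''')$. A coupling of an edge $f$ of $P$ and an edge $e$ of $H$ is a bijection $\varphi$ from the two arrows constituting $f$ to the two arrows constituting $e$. 2-sum: let $P=(A,\mathcal V,\mathcal B)$, $H=(A',\mathcal V',\mathcal B')$, and suppose $\varphi$ sends $\overrightarrow{p_1p_2}$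 to $\overrightarrow{q_1q_2}$ and $\overrightarrow{p_3p_4}$ to $\overrightarrow{q_3q_4}$. The arrow presentation $A\oplus_\varphi A'$ is obtained from the disjoint union by deleting these four arrows together with the interiors of the arcs they lie on and identifying $p_i$ with $q_i$ for $i=1,\dots,4$. In $A$ let $u$ (resp. $v$) be the vertex containing $\overrightarrow{p_1p_2}$ (resp. $\overrightarrow{p_3p_4}$), $a$ the boundary component containing $p_1,p_4$, $b$ the one containing $p_2,p_3$; define $u',v',a',b'$ likewise in $A'$ using the $q_i$. In $A\oplus_\varphi A'$ let $\alpha_0,\beta_0,\gamma_0,\delta_0$ be the vertices and $h,i,j,k$ the boundary components containing $p_1=q_1$, $p_2=q_2$, $p_3=q_3$, $p_4=q_4$ respectively. Then $P\oplus_\varphi H=(A\oplus_\varphi A',\mathcal V^*,\mathcal B^*)$ where $\mathcal V^*=(\mathcal V\cup\mathcal V'-\{[u],[v],[u'],[v']\})\cup\{[u]\cup[u']\cup\{\alpha_0,\beta_0\}-\{u,u'\}\}\cup\{[v]\cup[v']\cup\{\gamma_0,\delta_0\}-\{v,v'\}\}$ and $\mathcal B^*=(\mathcal B\cup\mathcal B'-\{[a],[b],[a'],[b']\})\cup\{[a]\cup[a']\cup\{h,k\}-\{a,a'\}\}\cup\{[b]\cup[b']\cup\{i,j\}-\{b,b'\}\}$. Iterated 2-sums along couplings of distinct edges are independent of order and bracketing. Polynomial $\mathbf{Q}$: given a packaged arrow presentation $P=(A,\mathcal V,\mathcal B)$ and a 5-tuple $(a_e,b_e,c_e,x_e,y_e)$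 of weights for each edge $e$ (collectively $\mathbf{w}$), $\mathbf{Q}(P;\mathbf{w},\alpha,\beta,\gamma)$ is the unique map satisfying $\mathbf{Q}(P)=a_e\mathbf{Q}(P\setminus e)+b_e\mathbf{Q}(P/e)+c_e\mathbf{Q}(P\dagger e)+x_e\mathbf{Q}(P\setminus_m e)+y_e\mathbf{Q}(P/_m e)$ for any edge $e$, and $\mathbf{Q}(P)=\alpha^{|V(A)|}\beta^{|\mathcal V|}\gamma^{|\mathcal B|}$ if $A$ has no edges. -}

module Defs where

open import Level using (Level)
open import Data.Bool using (Bool; true; false; not; if_then_else_; _∧_; _∨_; _xor_)
open import Data.Nat using (ℕ; zero; suc; _≡ᵇ_; _<ᵇ_) renaming (_+_ to _+ℕ_; _*_ to _*ℕ_)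
open import Data.Fin using (Fin; toℕ; _↑ˡ_; _↑ʳ_; splitAt)
open import Data.List using (List; []; _∷_; map; _++_; filterᵇ; length; concatMap; allFin)
open import Data.Bool.ListAction using (any; all)
open import Data.Product using (_×_; _,_; proj₁; proj₂)
open import Data.Sum using (_⊎_; inj₁; inj₂)
open import Algebra.Bundles using (CommutativeRing)
open import Relation.Binary.PropositionalEquality using (_≡_; _≢_)

private variable a : Level

-- Points.  Every edge e has two arrows (arr = false / true); every arrow
-- has a tail (hd = false) and a head (hd = true).  The arrow presentation
-- is determined by the "gap" matching: gap x is the arrow endpoint reached
-- from x by following the circle away from the arrow on which x lies.
-- (Circles are the components of gap ∪ mA; empty circles are listed
-- separately.)

record Pt (n : ℕ) : Set where
  constructor pt
  field
    edge : Fin n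
    arr  : Bool
    hd   : Bool

b2n : Bool → ℕ
b2n false = 0
b2n true  = 1

idx : ∀ {n} → Pt n → ℕ
idx (pt e x h) = 4 *ℕ toℕ e +ℕ 2 *ℕ b2n x +ℕ b2n h

ptsOf : ∀ {n} → Fin n → List (Pt n)
ptsOf e = pt e false false ∷ pt e false true ∷ pt e true false ∷ pt e true true ∷ []

finEq : ∀ {n} → Fin n → Fin n → Bool
finEq i j = toℕ i ≡ᵇ toℕ j

memF : ∀ {n} → Fin n → List (Fin n) → Bool
memF j es = any (finEq j) es

removeF : ∀ {n} → Fin n → List (Fin n) → List (Fin n)
removeF e = filterᵇ (λ j → not (finEq e j))

-- the three matchings on the endpoints of an edge with arrows
-- p1p2 (arr = false) and q1q2 (arr = true):
-- mA : tail ↔ head of the same arrow (the arcs of the arrows),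
-- mB : q2 ↔ p1, p2 ↔ q1 (boundary curves; contraction identification),
-- mC : p1 ↔ q1, p2 ↔ q2 (Penrose identification).
mA mB mC : ∀ {n} → Pt n → Pt n
mA (pt e x h) = pt e x (not h)
mB (pt e x h) = pt e (not x) (not h)
mC (pt e x h) = pt e (not x) h

orbitL : ∀ {X : Set} → ℕ → (X → X) → X → List X
orbitL zero    f x = []
orbitL (suc k) f x = x ∷ orbitL k f (f x)

minPt : ∀ {n} → Pt n → List (Pt n) → Pt n
minPt x []       = x
minPt x (y ∷ ys) = minPt (if idx y <ᵇ idx x then y else x) ys

-- the component of x in the graph of the two matchings g and m
comp : ∀ {n} → (Pt n → Pt n) → (Pt n → Pt n) → Pt n → List (Pt n)
comp {n} g m x = let os = orbitL (4 *ℕ n) (λ y → m (g y)) x in os ++ map g os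

rep : ∀ {n} → (Pt n → Pt n) → (Pt n → Pt n) → Pt n → Pt n
rep g m x = minPt x (comp g m x)

countDistinct : List ℕ → ℕ
countDistinct []       = 0
countDistinct (x ∷ xs) = if any (x ≡ᵇ_) xs then countDistinct xs else suc (countDistinct xs)

record Wt (A : Set a) : Set a where
  constructor wt5
  field
    wa wb wc wx wy : A

-- Packaged arrow presentations (with weights on the edge slots).
-- vlab / blab give the block labels of the vertex / boundary partitions:
-- the block of a vertex (boundary component) is the label of its point
-- of minimal index; empty circles (vertices without arrows, which are
-- also boundary components) are listed with their two labels.

record Core (A : Set a) (n : ℕ) : Set a where
  field
    gap     : Pt n → Pt n
    vlab    : Pt n → ℕ
    blab    : Pt n → ℕ
    empties : List (ℕ × ℕ)
    wt      : Fin n → Wt A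

record PAP (A : Set a) : Set a where
  constructor pap
  field
    n    : ℕ
    live : List (Fin n)   -- the edges (other slots are removed edges)
    core : Core A n

open Core
open PAP

vL bL : ∀ {A : Set a} {n} → Core A n → Pt n → ℕ
vL c x = vlab c (rep (gap c) mA x)
bL c x = blab c (rep (gap c) mB x)

Valid : ∀ {A : Set a} → PAP A → Set
Valid P = (live P ≡ allFin (n P))
        × (∀ x → gap (core P) (gap (core P) x) ≡ x)
        × (∀ x → gap (core P) x ≢ x)

-- Generic surgery: remove the arrows of the edges ds together with the
-- arcs they lie on, identify endpoints according to m, and relabel
-- blocks by FV / FB.  New arrowless circles are added to the empties.
surgery : ∀ {A : Set a} {n} → Core A n → List (Fin n) → (Pt n → Pt n)
        → (ℕ → ℕ) → (ℕ → ℕ) → Core A n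
surgery {n = n} c ds m FV FB = record
  { gap     = λ x → chase (4 *ℕ n) (gap c x)
  ; vlab    = λ x → FV (vL c x)
  ; blab    = λ x → FB (bL c x)
  ; empties = map (λ p → FV (proj₁ p) , FB (proj₂ p)) (empties c)
              ++ map (λ z → FV (vL c z) , FB (bL c z)) loops
  ; wt      = wt c }
  where
  dead : Pt n → Bool
  dead x = memF (Pt.edge x) ds
  chase : ℕ → Pt n → Pt n
  chase zero    y = y
  chase (suc k) y = if dead y then chase k (gap c (m y)) else y
  deadPts : List (Pt n)
  deadPts = concatMap ptsOf ds
  loops : List (Pt n)
  loops = filterᵇ (λ z → all dead (comp (gap c) m z)
                         ∧ (idx (rep (gap c) m z) ≡ᵇ idx z)) deadPts

mergeInto : ℕ → ℕ → ℕ → ℕ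
mergeInto L L' l = if l ≡ᵇ L' then L else l

data Op : Set where
  del mdel con mcon pen : Op

edgeOp : ∀ {A : Set a} {n} → Op → Core A n → Fin n → Core A n
edgeOp o c e = go o
  where
  Lu = vL c (pt e false false)
  Lv = vL c (pt e true false)
  La = bL c (pt e false false)
  Lb = bL c (pt e false true)
  mV = mergeInto Lu Lv
  mBd = mergeInto La Lb
  go : Op → _
  go del  = surgery c (e ∷ []) mA (λ l → l) mBd
  go mdel = surgery c (e ∷ []) mA mV mBd
  go con  = surgery c (e ∷ []) mB mV (λ l → l)
  go mcon = surgery c (e ∷ []) mB mV mBd
  go pen  = surgery c (e ∷ []) mC mV mBd

applyOp : ∀ {A : Set a} → Op → (P : PAP A) → Fin (n P) → PAP A
applyOp o (pap n l c) e = pap n (removeF e l) (edgeOp o c e)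

module _ {A : Set a} where

  union : PAP A → PAP A → PAP A
  union (pap n₁ l₁ c₁) (pap n₂ l₂ c₂) = pap (n₁ +ℕ n₂)
    (map (_↑ˡ n₂) l₁ ++ map (n₁ ↑ʳ_) l₂)
    (record
      { gap = λ { (pt e x h) → side e
                    (λ e' → liftL (gap c₁ (pt e' x h)))
                    (λ e' → liftR (gap c₂ (pt e' x h))) }
      ; vlab = λ { (pt e x h) → side e (λ e' → 2 *ℕ vlab c₁ (pt e' x h))
                                        (λ e' → suc (2 *ℕ vlab c₂ (pt e' x h))) }
      ; blab = λ { (pt e x h) → side e (λ e' → 2 *ℕ blab c₁ (pt e' x h))
                                        (λ e' → suc (2 *ℕ blab c₂ (pt e' x h))) }
      ; empties = map (λ p → 2 *ℕ proj₁ p , 2 *ℕ proj₂ p) (empties c₁)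
               ++ map (λ p → suc (2 *ℕ proj₁ p) , suc (2 *ℕ proj₂ p)) (empties c₂)
      ; wt = λ e → side e (wt c₁) (wt c₂) })
    where
    side : ∀ {b} {B : Set b} → Fin (n₁ +ℕ n₂) → (Fin n₁ → B) → (Fin n₂ → B) → B
    side e f g with splitAt n₁ e
    ... | inj₁ e' = f e'
    ... | inj₂ e' = g e'
    liftL : Pt n₁ → Pt (n₁ +ℕ n₂)
    liftL (pt e x h) = pt (e ↑ˡ n₂) x h
    liftR : Pt n₂ → Pt (n₁ +ℕ n₂)
    liftR (pt e x h) = pt (n₁ ↑ʳ e) x h

  -- merge the classes {L1,L1'} and {L2,L2'} (taking the transitive
  -- closure if they overlap)
  merge2 : ℕ → ℕ → ℕ → ℕ → ℕ → ℕ
  merge2 L1 L1' L2 L2' l =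
    if (L1 ≡ᵇ L2) ∨ (L1' ≡ᵇ L2) ∨ (L1 ≡ᵇ L2') ∨ (L1' ≡ᵇ L2')
    then (if (l ≡ᵇ L1) ∨ (l ≡ᵇ L1') ∨ (l ≡ᵇ L2) ∨ (l ≡ᵇ L2') then L1 else l)
    else (if (l ≡ᵇ L1) ∨ (l ≡ᵇ L1') then L1
          else if (l ≡ᵇ L2) ∨ (l ≡ᵇ L2') then L2 else l)

  -- P ⊕_φ H, where the coupling φ sends arrow false of f (p1p2) to arrow s
  -- of e (q1q2) and arrow true of f (p3p4) to arrow (not s) of e (q3q4).
  twoSum : (P : PAP A) → Fin (n P) → (H : PAP A) → Fin (n H) → Bool → PAP A
  twoSum P f H e s = pap (n U) (removeF F (removeF E (live U)))
                         (surgery c (F ∷ E ∷ []) glue gV gB)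
    where
    U = union P H
    c = core U
    F = f ↑ˡ n H
    E = n P ↑ʳ e
    glue : Pt (n U) → Pt (n U)
    glue (pt g x h) = if finEq g F then pt E (x xor s) h
                      else if finEq g E then pt F (x xor s) h
                      else pt g x h
    gV = merge2 (vL c (pt F false false)) (vL c (pt E s false))
                (vL c (pt F true false)) (vL c (pt E (not s) false))
    gB = merge2 (bL c (pt F false false)) (bL c (pt E s false))
                (bL c (pt F false true)) (bL c (pt E s true))

  record Summand (nP : ℕ) : Set a where
    field
      H  : PAP A
      f  : Fin nP
      e  : Fin (n H)
      s  : Bool

  iter2Sum : ∀ {nP} → (acc : PAP A) → (Fin nP → Fin (n acc)) → List (Summand nP) → PAP A
  iter2Sum acc emb [] = acc
  iter2Sum acc emb (σ ∷ σs) =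
    iter2Sum (twoSum acc (emb (Summand.f σ)) (Summand.H σ) (Summand.e σ) (Summand.s σ))
             (λ i → emb i ↑ˡ n (Summand.H σ)) σs

  Pk : (P : PAP A) (k : ℕ) (H : Fin k → PAP A) (f : Fin k → Fin (n P))
       (e : (i : Fin k) → Fin (n (H i))) (s : Fin k → Bool) → PAP A
  Pk P k H f e s = iter2Sum P (λ i → i)
    (map (λ i → record { H = H i ; f = f i ; e = e i ; s = s i }) (allFin k))

  withWt : (P : PAP A) → (Fin (n P) → Wt A) → PAP A
  withWt (pap n l c) w = pap n l (record c { wt = w })

  replaceW : ∀ {k m} → (Fin k → Fin m) → (Fin k → Wt A) → (Fin m → Wt A) → Fin m → Wt A
  replaceW {zero}  f φ w j = w j
  replaceW {suc k} f φ w j =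
    if finEq (f Fin.zero) j then φ Fin.zero else replaceW (λ i → f (Fin.suc i)) (λ i → φ (Fin.suc i)) w j

module Poly {c ℓ} (R : CommutativeRing c ℓ) where
  open CommutativeRing R

  pow : Carrier → ℕ → Carrier
  pow x zero    = 1#
  pow x (suc k) = x * pow x k

  Qgo : ∀ {n} → Carrier → Carrier → Carrier → List (Fin n) → Core Carrier n → Carrier
  Qgo α β γ [] c =
    pow α (length (empties c)) * pow β (countDistinct (map proj₁ (empties c)))
      * pow γ (countDistinct (map proj₂ (empties c)))
  Qgo α β γ (e ∷ es) c =
    Wt.wa w * Qgo α β γ es (edgeOp del c e)
    + Wt.wb w * Qgo α β γ es (edgeOp con c e)
    + Wt.wc w * Qgo α β γ es (edgeOp pen c e)
    + Wt.wx w * Qgo α β γ es (edgeOp mdel c e)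
    + Wt.wy w * Qgo α β γ es (edgeOp mcon c e)
    where w = wt c e

  Q : PAP Carrier → Carrier → Carrier → Carrier → Carrier
  Q (pap n l c) α β γ = Qgo α β γ l c

  rhs : (H : PAP Carrier) → Fin (n H) → Carrier → Carrier → Carrier → Wt Carrier
  rhs H e α β γ = wt5 (Q (applyOp del H e) α β γ) (Q (applyOp con H e) α β γ)
                      (Q (applyOp pen H e) α β γ) (Q (applyOp mdel H e) α β γ)
                      (Q (applyOp mcon H e) α β γ)

  _≈W_ : Wt Carrier → Wt Carrier → Set ℓ
  wt5 a b c' x y ≈W wt5 a' b' c'' x' y' =
    (a ≈ a') × (b ≈ b') × (c' ≈ c'') × (x ≈ x') × (y ≈ y')

  -- α β γ · M · φ = r, for the 5×5 matrix M of the statement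
  -- (φ = (φ_(=,2), φ_(∥,2), φ_×, φ_(=,1), φ_(∥,1)) stored as (wa,wb,wc,wx,wy))
  Solves : Carrier → Carrier → Carrier → Wt Carrier → Wt Carrier → Set ℓ
  Solves α β γ r (wt5 p1 p2 p3 p4 p5) =
    let k = α * β * γ in
    (k * (α * β * p1 + p2 + p3 + α * p4 + p5) ≈ Wt.wa r)
    × (k * (p1 + α * γ * p2 + p3 + p4 + α * p5) ≈ Wt.wb r)
    × (k * (p1 + p2 + α * p3 + p4 + p5) ≈ Wt.wc r)
    × (k * (α * p1 + p2 + p3 + α * p4 + p5) ≈ Wt.wx r)
    × (k * (p1 + α * p2 + p3 + p4 + α * p5) ≈ Wt.wy r)

  IsUniqueSolution : Carrier → Carrier → Carrier → Wt Carrier → Wt Carrier → Set (c Level.⊔ ℓ)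
  IsUniqueSolution α β γ r φ = Solves α β γ r φ × (∀ ψ → Solves α β γ r ψ → ψ ≈W φ)

-- Q is a sum over states, in which every edge is resolved in one of five
-- ways.  Once all edges of H but e are resolved, what is left of H is, up
-- to a scalar, one of five types: the ends of e are joined by one of the
-- three matchings of mA, mB, mC, and for mA (mB) the two vertices (boundary
-- components) at e may or may not share a block.  Forming the 2-sum with H
-- in a state of type t has the same effect on P as the operation t at f, up
-- to that scalar.  So Q(P ⊕ H) = Σ φ_t Q(P resolved by t at f), where φ_t
-- adds up the weighted scalars of the states of type t.  Applying the five
-- operations at e to the five types gives the matrix of the linear system,
-- which φ therefore solves, and by uniqueness φ is the given solution.  The
-- summands are absorbed one at a time.
--
-- Resolving an edge and forming a 2-sum are both surgeries.  A surgery is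
-- determined, up to renaming blocks, by which ends it identifies and which
-- blocks it merges; surgeries on disjoint sets of edges compose by uniting
-- these relations, hence they commute.

module Submission where

open import Defs
import Data.Nat.Properties as ℕ
import Data.List.Relation.Unary.Any as Any
import Data.List.Relation.Unary.Any.Properties as Any
import Data.List.Relation.Unary.All as All
import Data.List.Relation.Unary.All.Properties as All
import Data.List.Relation.Unary.AllPairs as AllPairs
import Data.List.Relation.Unary.AllPairs.Properties as AllPairs
import Data.Fin as Fin
import Data.Fin.Properties as Fin
import Relation.Binary.Reasoning.Setoid as SetoidReasoning
import Algebra.Properties.CommutativeSemigroup as CommutativeSemigroup
import Data.List.Relation.Unary.Unique.Propositional.Properties as Unique
open import Level using (Level)
open import Data.Nat
  using (_<_; _<ᵇ_; _≡ᵇ_; _≤_; suc; s≤s; zero; z≤n; ℕ) renaming (_*_ to _*ℕ_; _+_ to _+ℕ_)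
open import Data.List using (List; []; _++_; _∷_; concatMap; filterᵇ; length; map; tabulate)
open import Data.List.Properties
  using (filter-++; length-++; length-map; map-++; map-tabulate; map-∘)
open import Data.List.Membership.Propositional using (_∈_; find; lose)
open import Data.List.Membership.Propositional.Properties
  using (∈-++⁺ʳ; ∈-++⁺ˡ; ∈-++⁻; ∈-allFin; ∈-concatMap⁺; ∈-concatMap⁻; ∈-filter⁺; ∈-filter⁻;
    ∈-map⁺; ∈-map⁻)
open import Data.List.Relation.Binary.Subset.Propositional using (_⊆_)
open import Data.List.Relation.Unary.Any using (Any; _─_; here; there)
open import Data.List.Relation.Unary.All using (All; []; _∷_)
open import Data.List.Relation.Unary.AllPairs using (AllPairs; []; _∷_)
open import Data.Product using (_,_; _×_; proj₁; proj₂; ∃; ∃₂)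
open import Data.Sum using ([_,_]′; _⊎_; inj₁; inj₂; swap)
open import Data.Empty using (⊥; ⊥-elim)
open import Relation.Nullary using (contradiction; no; yes; ¬_)
open import Relation.Binary.PropositionalEquality
  using (_≡_; _≢_; cong; cong₂; refl; subst; subst₂; sym; trans)
open import Data.Bool using (Bool; T; _xor_; _∧_; _∨_; false; if_then_else_; not; true)
open import Data.Bool.Properties
  using (T-∧; T-≡; T?; not-involutive; xor-assoc; xor-identityʳ; xor-same; ∨-zeroʳ)
open import Data.Bool.ListAction using (all; any)
open import Data.Fin using (Fin; _↑ʳ_; _↑ˡ_; combine; splitAt; toℕ)
open import Data.List.Relation.Unary.Unique.Propositional using (Unique)
open import Function using (Equivalence; _∘_)
open import Algebra.Bundles using (CommutativeRing)
open import Function.Definitions using (Injective)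

-- Two computations that agree mathematically rarely agree as data. A block is named at the point of
-- least index of a curve; this point, and the names of merged blocks, change with the order of the
-- operations, and closed curves are listed by such representatives too. So cores are never compared
-- directly. A surgery is replaced by a description of its outcome that leaves paths and
-- representatives open; the description is shown to fix the outcome up to a bijection between the
-- labels in use, and the value of an edgeless presentation depends on no more than that. The matrix
-- of the system is never inverted. A solution is built by recursion on the edges of H, together
-- with the formula that replaces H by it, and the hypothesis of uniqueness identifies it with the
-- given one. The factor αβγ in front of the matrix stands for one circle, one vertex block and one
-- boundary block, which arise at e in every state; the entries of the matrix count what goes beyond
-- these.

data Side : Set where
  vert bdry : Side

_≐_ : List ℕ → List ℕ → Set
xs ≐ ys = xs ⊆ ys × ys ⊆ xs

∈-resp : ∀ {X : Set} {x y : X} {xs : List X} → x ≡ y → x ∈ xs → y ∈ xs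
∈-resp refl x∈ = x∈

-- The data of a packaged arrow presentation that the state sum sees:
-- lab assigns to a point the block of its vertex or boundary component;
-- len circles carry no arrow, and emp lists their blocks.
record Pres (X : Set) : Set where
  field
    gap : X → X
    lab : Side → X → ℕ
    len : ℕ
    emp : Side → List ℕ

open Pres

-- M is a relation, unlike the gap, so that the identifications of several surgeries can be united.
-- Where M acts on removed points only, a path that reaches a remaining point can leave it only
-- along its gap.
data Conn {X : Set} (g : X → X) (M : X → X → Set) (x : X) : X → Set where
  here  : Conn g M x x
  gapᶜ  : ∀ {y} → Conn g M x y → Conn g M x (g y)
  stepᶜ : ∀ {y z} → Conn g M x y → M y z → Conn g M x z

module _ {X : Set} where

  Conn-trans : ∀ {g : X → X} {M : X → X → Set} {x y z} → Conn g M x y → Conn g M y z → Conn g M x z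
  Conn-trans p here        = p
  Conn-trans p (gapᶜ q)    = gapᶜ (Conn-trans p q)
  Conn-trans p (stepᶜ q m) = stepᶜ (Conn-trans p q) m

  Conn-mono : ∀ {g : X → X} {M M' : X → X → Set} → (∀ {x y} → M x y → M' x y) →
    ∀ {x y} → Conn g M x y → Conn g M' x y
  Conn-mono i here        = here
  Conn-mono i (gapᶜ q)    = gapᶜ (Conn-mono i q)
  Conn-mono i (stepᶜ q m) = stepᶜ (Conn-mono i q) (i m)

  -- F is a retraction onto representatives of the equivalence on block
  -- labels generated by identifying lab x and lab y whenever J x y.
  record Merges (lab : X → ℕ) (J : X → X → Set) (F : ℕ → ℕ) : Set where
    field
      joins : ∀ {x y} → J x y → F (lab x) ≡ F (lab y)
      least : (G : ℕ → ℕ) → (∀ {x y} → J x y → G (lab x) ≡ G (lab y)) → ∀ l → G (F l) ≡ G l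

  record WF (L : X → Set) (A : Pres X) : Set where
    field
      gap-L   : ∀ {x} → L x → L (gap A x)
      gap-inv : ∀ {x} → L x → gap A (gap A x) ≡ x
      gap-≢   : ∀ {x} → L x → gap A x ≢ x
      lab-gap : ∀ s {x} → L x → lab A s (gap A x) ≡ lab A s x

  -- A surgery removes the points D of L, leaving L', and identifies the
  -- ends of the removed arcs along M; J says which blocks are merged.
  record Cut (L L' : X → Set) : Set₁ where
    field
      D      : X → Set
      M      : X → X → Set
      J      : Side → X → X → Set
      split  : ∀ {x} → L x → D x ⊎ L' x
      D⊂L    : ∀ {x} → D x → L x
      L'⊂L   : ∀ {x} → L' x → L x
      D∩L'   : ∀ {x} → D x → L' x → ⊥
      M-D    : ∀ {x y} → M x y → D x × D y
      M-sym  : ∀ {x y} → M x y → M y x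
      M⊂J    : ∀ s {x y} → M x y → J s x y
      J-D    : ∀ s {x y} → J s x y → D x × D y

  -- Only the relations are compared, since two orders of the same surgeries pass through different
  -- intermediate sets of points. Inclusion both ways serves as equality.
  record _⊑_ {L L' N N' : X → Set} (K : Cut L L') (K' : Cut N N') : Set where
    private
      module K = Cut K
      module K' = Cut K'
    field
      D⊑ : ∀ {x} → K.D x → K'.D x
      M⊑ : ∀ {x y} → K.M x y → K'.M x y
      J⊑ : ∀ s {x y} → K.J s x y → K'.J s x y

  module _ {L L' : X → Set} (K : Cut L L') {A : Pres X} (wf : WF L A) where
    open Cut K
    open WF wf

    private C = Conn (gap A) M

    Conn-L : ∀ {x y} → L x → C x y → L y
    Conn-L l here        = l
    Conn-L l (gapᶜ q)    = gap-L (Conn-L l q)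
    Conn-L l (stepᶜ q m) = D⊂L (proj₂ (M-D m))

    Conn-sym : ∀ {x y} → L x → C x y → C y x
    Conn-sym l here = here
    Conn-sym {x} l (gapᶜ {y} q) =
      Conn-trans (subst (C (gap A y)) (gap-inv (Conn-L l q)) (gapᶜ here)) (Conn-sym l q)
    Conn-sym l (stepᶜ q m) = Conn-trans (stepᶜ here (M-sym m)) (Conn-sym l q)

    Conn-lab : ∀ s (F : ℕ → ℕ) → (∀ {x y} → M x y → F (lab A s x) ≡ F (lab A s y)) →
      ∀ {x y} → L x → C x y → F (lab A s x) ≡ F (lab A s y)
    Conn-lab s F h l here = refl
    Conn-lab s F h l (gapᶜ q) =
      trans (Conn-lab s F h l q) (cong F (sym (lab-gap s (Conn-L l q))))
    Conn-lab s F h l (stepᶜ q m) = trans (Conn-lab s F h l q) (h m)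

  -- The outcome A' of the surgery K on A, described without reference to
  -- how paths are traced: ls represents the closed curves that contain
  -- removed points only.
  record Surg {L L' : X → Set} (K : Cut L L') (A A' : Pres X) : Set where
    open Cut K
    field
      ls        : List X
      gap-live  : ∀ {x} → L' x → L' (gap A' x)
      gap-conn  : ∀ {x} → L' x → Conn (gap A) M x (gap A' x)
      gap-≢     : ∀ {x} → L' x → gap A' x ≢ x
      two-ends  : ∀ {x y} → L' x → L' y → Conn (gap A) M x y → y ≡ x ⊎ y ≡ gap A' x
      ls-D      : All D ls
      ls-closed : All (λ z → ∀ y → Conn (gap A) M z y → D y) ls
      ls-apart  : AllPairs (λ x y → ¬ Conn (gap A) M x y) ls
      ls-cover  : ∀ {x} → D x → Any (Conn (gap A) M x) ls ⊎ ∃ λ y → L' y × Conn (gap A) M x y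
      F         : Side → ℕ → ℕ
      merges    : ∀ s → Merges (lab A s) (J s) (F s)
      lab-eq    : ∀ s {x} → L' x → lab A' s x ≡ F s (lab A s x)
      len-eq    : len A' ≡ len A +ℕ length ls
      emp-eq    : ∀ s → emp A' s ≐ map (F s) (emp A s ++ map (lab A s) ls)

  module _ {L L' : X → Set} (K : Cut L L') {A A' : Pres X} (wf : WF L A) (S : Surg K A A') where
    open Cut K
    open Surg S

    M-lab : ∀ s {x y} → M x y → F s (lab A s x) ≡ F s (lab A s y)
    M-lab s m = Merges.joins (merges s) (M⊂J s m)

    Surg-WF : WF L' A'
    Surg-WF = record
      { gap-L   = gap-live
      ; gap-inv = inv
      ; gap-≢   = gap-≢
      ; lab-gap = λ s l → trans (lab-eq s (gap-live l)) (trans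
          (sym (Conn-lab K wf s (F s) (M-lab s) (L'⊂L l) (gap-conn l))) (sym (lab-eq s l))) }
      where
      inv : ∀ {x} → L' x → gap A' (gap A' x) ≡ x
      -- The point two gaps away from x is a remaining end of the curve through x; were it the end
      -- other than x, it would be a fixed point of `gap A'`.
      inv {x} l with two-ends l (gap-live (gap-live l))
                       (Conn-trans (gap-conn l) (gap-conn (gap-live l)))
      ... | inj₁ e = e
      ... | inj₂ e = ⊥-elim (gap-≢ (gap-live l) e)

  -- Composition of surgeries

  _⨾_ : ∀ {L L₁ L₂ : X → Set} → Cut L L₁ → Cut L₁ L₂ → Cut L L₂
  _⨾_ {L} {L₁} {L₂} K₁ K₂ = record
    { D = λ x → K₁.D x ⊎ K₂.D x
    ; M = λ x y → K₁.M x y ⊎ K₂.M x y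
    ; J = λ s x y → K₁.J s x y ⊎ K₂.J s x y
    ; split = λ l → [ (λ d → inj₁ (inj₁ d))
                    , (λ l₁ → [ (λ d → inj₁ (inj₂ d)) , inj₂ ]′ (K₂.split l₁)) ]′ (K₁.split l)
    ; D⊂L = [ K₁.D⊂L , (λ d → K₁.L'⊂L (K₂.D⊂L d)) ]′
    ; L'⊂L = λ l → K₁.L'⊂L (K₂.L'⊂L l)
    ; D∩L' = λ { (inj₁ d) l → K₁.D∩L' d (K₂.L'⊂L l) ; (inj₂ d) l → K₂.D∩L' d l }
    ; M-D = λ { (inj₁ m) → inj₁ (proj₁ (K₁.M-D m)) , inj₁ (proj₂ (K₁.M-D m))
              ; (inj₂ m) → inj₂ (proj₁ (K₂.M-D m)) , inj₂ (proj₂ (K₂.M-D m)) }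
    ; M-sym = λ { (inj₁ m) → inj₁ (K₁.M-sym m) ; (inj₂ m) → inj₂ (K₂.M-sym m) }
    ; M⊂J = λ { s (inj₁ m) → inj₁ (K₁.M⊂J s m) ; s (inj₂ m) → inj₂ (K₂.M⊂J s m) }
    ; J-D = λ { s (inj₁ m) → inj₁ (proj₁ (K₁.J-D s m)) , inj₁ (proj₂ (K₁.J-D s m))
              ; s (inj₂ m) → inj₂ (proj₁ (K₂.J-D s m)) , inj₂ (proj₂ (K₂.J-D s m)) } }
    where
    module K₁ = Cut K₁
    module K₂ = Cut K₂

  ⨾-⊑ : ∀ {L L₁ L₂ N N₁ N₂ : X → Set} {K₁ : Cut L L₁} {K₂ : Cut L₁ L₂}
    {K₁' : Cut N₁ N₂} {K₂' : Cut N N₁} → K₁ ⊑ K₁' → K₂ ⊑ K₂' → (K₁ ⨾ K₂) ⊑ (K₂' ⨾ K₁')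
  ⨾-⊑ i₁ i₂ = record
    { D⊑ = [ (λ d → inj₂ (_⊑_.D⊑ i₁ d)) , (λ d → inj₁ (_⊑_.D⊑ i₂ d)) ]′
    ; M⊑ = [ (λ d → inj₂ (_⊑_.M⊑ i₁ d)) , (λ d → inj₁ (_⊑_.M⊑ i₂ d)) ]′
    ; J⊑ = λ s → [ (λ d → inj₂ (_⊑_.J⊑ i₁ s d)) , (λ d → inj₁ (_⊑_.J⊑ i₂ s d)) ]′ }

  module _ {L L₁ L₂ : X → Set} {K₁ : Cut L L₁} {K₂ : Cut L₁ L₂} {A A₁ A₂ : Pres X}
           (wf : WF L A) (S₁ : Surg K₁ A A₁) (S₂ : Surg K₂ A₁ A₂) where
    private
      module K₁ = Cut K₁
      module K₂ = Cut K₂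
      module S₁ = Surg S₁
      module S₂ = Surg S₂
      K = K₁ ⨾ K₂
      C₁ = Conn (gap A) K₁.M
      C₂ = Conn (gap A₁) K₂.M
      C = Conn (gap A) (Cut.M K)
      wf₁ = Surg-WF K₁ wf S₁

      up₁ : ∀ {x y} → C₁ x y → C x y
      up₁ = Conn-mono inj₁

      up₂ : ∀ {x y} → L₁ x → C₂ x y → C x y
      up₂ l here        = here
      up₂ l (gapᶜ q)    = Conn-trans (up₂ l q) (up₁ (S₁.gap-conn (Conn-L K₂ wf₁ l q)))
      up₂ l (stepᶜ q m) = stepᶜ (up₂ l q) (inj₂ m)

      -- A path in A that uses both identifications is cut at a point w of A₁. Up to w it is read as
      -- a path in A₁; beyond w it uses the identifications of K₁ only, so wherever it meets A₁
      -- again it is at w or at `gap A₁ w`.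
      Inv : X → X → Set
      Inv x y = ∃ λ w → L₁ w × C₂ x w × C₁ w y

      collapse : ∀ {x y} → L₁ y → Inv x y → C₂ x y
      collapse l (w , lw , c , d) with S₁.two-ends lw l d
      ... | inj₁ refl = c
      ... | inj₂ refl = gapᶜ c

      inv : ∀ {x y} → L₁ x → C x y → Inv x y
      inv l here = _ , l , here , here
      inv l (gapᶜ q) with inv l q
      ... | w , lw , c , d = w , lw , c , gapᶜ d
      inv l (stepᶜ q (inj₁ m)) with inv l q
      ... | w , lw , c , d = w , lw , c , stepᶜ d m
      inv l (stepᶜ q (inj₂ m)) =
        _ , K₂.D⊂L (proj₂ (K₂.M-D m))
          , stepᶜ (collapse (K₂.D⊂L (proj₁ (K₂.M-D m))) (inv l q)) m , here

      down : ∀ {x y} → L₁ x → L₁ y → C x y → C₂ x y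
      down lx ly c = collapse ly (inv lx c)

      -- Identifications of K₂ start at points that K₁ leaves, so they cannot prolong a curve made
      -- of points that K₁ removes.
      closed₁ : ∀ {x y} → (∀ z → C₁ x z → K₁.D z) → C x y → C₁ x y
      closed₁ h here = here
      closed₁ h (gapᶜ q) = gapᶜ (closed₁ h q)
      closed₁ h (stepᶜ q (inj₁ m)) = stepᶜ (closed₁ h q) m
      closed₁ h (stepᶜ q (inj₂ m)) =
        ⊥-elim (K₁.D∩L' (h _ (closed₁ h q)) (K₂.D⊂L (proj₁ (K₂.M-D m))))

      closed₂ : ∀ {x y} → L₁ x → (∀ z → C₂ x z → K₂.D z) → C x y → Cut.D K y
      closed₂ l h c with K₁.split (Conn-L K wf (K₁.L'⊂L l) c)
      ... | inj₁ d = inj₁ d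
      ... | inj₂ l' = inj₂ (h _ (down l l' c))

      cover₂ : ∀ {x} → K₂.D x → Any (C x) (S₁.ls ++ S₂.ls) ⊎ ∃ λ y → L₂ y × C x y
      cover₂ d with S₂.ls-cover d
      ... | inj₁ a = inj₁ (Any.++⁺ʳ S₁.ls (Any.map (up₂ (K₂.D⊂L d)) a))
      ... | inj₂ (y , l , c) = inj₂ (y , l , up₂ (K₂.D⊂L d) c)

      cover : ∀ {x} → Cut.D K x → Any (C x) (S₁.ls ++ S₂.ls) ⊎ ∃ λ y → L₂ y × C x y
      cover (inj₂ d) = cover₂ d
      cover (inj₁ d) with S₁.ls-cover d
      ... | inj₁ a = inj₁ (Any.++⁺ˡ (Any.map up₁ a))
      ... | inj₂ (y , l , c) with K₂.split l
      ... | inj₂ l₂ = inj₂ (y , l₂ , up₁ c)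
      ... | inj₁ d₂ with cover₂ d₂
      ... | inj₁ a = inj₁ (Any.map (Conn-trans (up₁ c)) a)
      ... | inj₂ (z , lz , c') = inj₂ (z , lz , Conn-trans (up₁ c) c')

      D₂-L₁ : All L₁ S₂.ls
      D₂-L₁ = All.map K₂.D⊂L S₂.ls-D

      apart₂ : ∀ {xs} → All L₁ xs → AllPairs (λ x y → ¬ C₂ x y) xs → AllPairs (λ x y → ¬ C x y) xs
      apart₂ [] [] = []
      apart₂ (l ∷ ls) (a ∷ as) =
        All.zipWith (λ { (l' , n) c → n (down l l' c) }) (ls , a) ∷ apart₂ ls as

      apart₁ : ∀ {xs} → All (λ z → ∀ y → C₁ z y → K₁.D y) xs →
        AllPairs (λ x y → ¬ C₁ x y) xs → AllPairs (λ x y → ¬ C x y) xs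
      apart₁ [] [] = []
      apart₁ (h ∷ hs) (a ∷ as) = All.map (λ n c → n (closed₁ h c)) a ∷ apart₁ hs as

      F : Side → ℕ → ℕ
      F s l = S₂.F s (S₁.F s l)

      merge : ∀ s → Merges (lab A s) (Cut.J K s) (F s)
      merge s = record
        { joins = λ { (inj₁ j) → cong (S₂.F s) (m₁.joins j)
                    ; (inj₂ j) → trans (cong (S₂.F s) (sym (l₁ (proj₁ (K₂.J-D s j)))))
                        (trans (m₂.joins j) (cong (S₂.F s) (l₁ (proj₂ (K₂.J-D s j))))) }
        -- The hypothesis on G has to be transferred to the labels of A₁. These are `S₁.F`-images,
        -- and by `m₁.least` G does not tell a label from its image.
        ; least = λ G h l → trans (m₂.least G (λ j →
              trans (cong G (l₁ (proj₁ (K₂.J-D s j)))) (trans (m₁.least G (λ j → h (inj₁ j)) _)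
                (trans (h (inj₂ j)) (sym (trans (cong G (l₁ (proj₂ (K₂.J-D s j))))
                  (m₁.least G (λ j → h (inj₁ j)) _)))))) _)
            (m₁.least G (λ j → h (inj₁ j)) l) }
        where
        module m₁ = Merges (S₁.merges s)
        module m₂ = Merges (S₂.merges s)
        l₁ : ∀ {x} → K₂.D x → lab A₁ s x ≡ S₁.F s (lab A s x)
        l₁ d = S₁.lab-eq s (K₂.D⊂L d)

      emp→ : ∀ s → emp A₂ s ⊆ map (F s) (emp A s ++ map (lab A s) (S₁.ls ++ S₂.ls))
      emp→ s z∈ with ∈-map⁻ (S₂.F s) (proj₁ (S₂.emp-eq s) z∈)
      ... | w , w∈ , refl with ∈-++⁻ (emp A₁ s) w∈
      ... | inj₁ i with ∈-map⁻ (S₁.F s) (proj₁ (S₁.emp-eq s) i)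
      ... | v , v∈ , refl = ∈-map⁺ (F s) (widen (∈-++⁻ (emp A s) v∈))
        where
        widen : ∀ {v} → v ∈ emp A s ⊎ v ∈ map (lab A s) S₁.ls →
          v ∈ emp A s ++ map (lab A s) (S₁.ls ++ S₂.ls)
        widen (inj₁ i) = ∈-++⁺ˡ i
        widen (inj₂ i) with ∈-map⁻ (lab A s) i
        ... | x , x∈ , refl = ∈-++⁺ʳ (emp A s) (∈-map⁺ (lab A s) (∈-++⁺ˡ x∈))
      emp→ s z∈ | w , w∈ , refl | inj₂ i with ∈-map⁻ (lab A₁ s) i
      ... | x , x∈ , refl = ∈-resp (cong (S₂.F s) (sym (S₁.lab-eq s (All.lookup D₂-L₁ x∈))))
        (∈-map⁺ (F s) (∈-++⁺ʳ (emp A s) (∈-map⁺ (lab A s) (∈-++⁺ʳ S₁.ls x∈))))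

      emp← : ∀ s → map (F s) (emp A s ++ map (lab A s) (S₁.ls ++ S₂.ls)) ⊆ emp A₂ s
      emp← s z∈ with ∈-map⁻ (F s) z∈
      ... | v , v∈ , refl = proj₂ (S₂.emp-eq s) (go (∈-++⁻ (emp A s) v∈))
        where
        one : ∀ {v} → v ∈ emp A s ++ map (lab A s) S₁.ls →
          F s v ∈ map (S₂.F s) (emp A₁ s ++ map (lab A₁ s) S₂.ls)
        one i = ∈-map⁺ (S₂.F s) (∈-++⁺ˡ (proj₂ (S₁.emp-eq s) (∈-map⁺ (S₁.F s) i)))
        go : ∀ {v} → v ∈ emp A s ⊎ v ∈ map (lab A s) (S₁.ls ++ S₂.ls) →
          F s v ∈ map (S₂.F s) (emp A₁ s ++ map (lab A₁ s) S₂.ls)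
        go (inj₁ i) = one (∈-++⁺ˡ i)
        go (inj₂ i) with ∈-map⁻ (lab A s) i
        ... | x , x∈ , refl with ∈-++⁻ S₁.ls x∈
        ... | inj₁ x∈₁ = one (∈-++⁺ʳ (emp A s) (∈-map⁺ (lab A s) x∈₁))
        ... | inj₂ x∈₂ = ∈-resp (cong (S₂.F s) (S₁.lab-eq s (All.lookup D₂-L₁ x∈₂)))
          (∈-map⁺ (S₂.F s) (∈-++⁺ʳ (emp A₁ s) (∈-map⁺ (lab A₁ s) x∈₂)))

    Surg-⨾ : Surg (K₁ ⨾ K₂) A A₂
    Surg-⨾ = record
      { ls = S₁.ls ++ S₂.ls
      ; gap-live = S₂.gap-live
      ; gap-conn = λ l → up₂ (K₂.L'⊂L l) (S₂.gap-conn l)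
      ; gap-≢ = S₂.gap-≢
      ; two-ends = λ lx ly c → S₂.two-ends lx ly (down (K₂.L'⊂L lx) (K₂.L'⊂L ly) c)
      ; ls-D = All.++⁺ (All.map inj₁ S₁.ls-D) (All.map inj₂ S₂.ls-D)
      ; ls-closed = All.++⁺ (All.map (λ h _ c → inj₁ (h _ (closed₁ h c))) S₁.ls-closed)
          (All.zipWith (λ { (l , h) _ → closed₂ l h }) (D₂-L₁ , S₂.ls-closed))
      ; ls-apart = AllPairs.++⁺ (apart₁ S₁.ls-closed S₁.ls-apart) (apart₂ D₂-L₁ S₂.ls-apart)
          (All.map (λ h → All.map (λ l c → K₁.D∩L' (h _ (closed₁ h c)) l) D₂-L₁) S₁.ls-closed)
      ; ls-cover = cover
      ; F = F
      ; merges = merge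
      ; lab-eq = λ s l → trans (S₂.lab-eq s l) (cong (S₂.F s) (S₁.lab-eq s (K₂.L'⊂L l)))
      ; len-eq = trans S₂.len-eq (trans (cong (_+ℕ length S₂.ls) S₁.len-eq)
          (trans (ℕ.+-assoc (len A) (length S₁.ls) (length S₂.ls))
            (cong (len A +ℕ_) (sym (length-++ S₁.ls)))))
      ; emp-eq = λ s → emp→ s , emp← s }

  -- Uniqueness of the outcome of a surgery

  length-─ : ∀ {P : X → Set} {xs} (p : Any P xs) → length xs ≡ suc (length (xs ─ p))
  length-─ (here _)  = refl
  length-─ (there p) = cong suc (length-─ p)

  Any-─ : ∀ {P Q : X → Set} {xs} (p : Any P xs) → Any Q xs →
    Any Q (xs ─ p) ⊎ ∃ λ x → P x × Q x
  Any-─ (here p)  (here q)  = inj₂ (_ , p , q)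
  Any-─ (here p)  (there j) = inj₁ j
  Any-─ (there i) (here q)  = inj₁ (here q)
  Any-─ (there i) (there j) with Any-─ i j
  ... | inj₁ k = inj₁ (there k)
  ... | inj₂ k = inj₂ k

  -- A pigeonhole principle: the entry of ys used by the head is related to no other entry of xs, so
  -- it can be deleted. It serves to count closed curves as well as distinct labels.
  apart-length : ∀ {Y : Set} {P : Y → Y → Set} {R : Y → X → Set} {xs : List Y} {ys : List X} →
    (∀ {x x' y} → P x x' → R x y → R x' y → ⊥) →
    AllPairs P xs → All (λ x → Any (R x) ys) xs → length xs ≤ length ys
  apart-length h [] [] = z≤n
  apart-length {Y} {P} {R} {ys = ys} h (a ∷ as) (i ∷ is) =
    ℕ.≤-trans (s≤s (apart-length h as (shrink a is))) (ℕ.≤-reflexive (sym (length-─ i)))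
    where
    shrink : ∀ {zs} → All (P _) zs → All (λ x → Any (R x) ys) zs → All (λ x → Any (R x) (ys ─ i)) zs
    shrink [] [] = []
    shrink (p ∷ ps) (j ∷ js) with Any-─ i j
    ... | inj₁ k = k ∷ shrink ps js
    ... | inj₂ (y , r , r') = ⊥-elim (h p r r')

  -- ρ and ρ' are mutually inverse on the labels in use only.
  record LabEq (L : X → Set) (lab lab' : X → ℕ) (emp emp' : List ℕ) : Set where
    field
      ρ ρ'  : ℕ → ℕ
      ρ-lab : ∀ {x} → L x → lab' x ≡ ρ (lab x)
      ρ'-lab : ∀ {x} → L x → lab x ≡ ρ' (lab' x)
      ρ-emp : ∀ {z} → z ∈ emp → ρ z ∈ emp' × ρ' (ρ z) ≡ z
      ρ'-emp : ∀ {z} → z ∈ emp' → ρ' z ∈ emp × ρ (ρ' z) ≡ z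

  -- Nothing is required of gaps and labels outside L: at removed points they hold values left over
  -- from earlier stages.
  record _≅[_]_ (A : Pres X) (L : X → Set) (B : Pres X) : Set where
    field
      gap≡ : ∀ {x} → L x → gap A x ≡ gap B x
      len≡ : len A ≡ len B
      lab≡ : ∀ s → LabEq L (lab A s) (lab B s) (emp A s) (emp B s)

  LabEq-sym : ∀ {L lab lab' emp emp'} → LabEq L lab lab' emp emp' → LabEq L lab' lab emp' emp
  LabEq-sym e = record { ρ = ρ' ; ρ' = ρ ; ρ-lab = ρ'-lab ; ρ'-lab = ρ-lab
                       ; ρ-emp = ρ'-emp ; ρ'-emp = ρ-emp }
    where open LabEq e

  ≅-sym : ∀ {L A B} → A ≅[ L ] B → B ≅[ L ] A
  ≅-sym e = record { gap≡ = λ l → sym (gap≡ l) ; len≡ = sym len≡ ; lab≡ = λ s → LabEq-sym (lab≡ s) }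
    where open _≅[_]_ e

  ≅-refl : ∀ {L A} → A ≅[ L ] A
  ≅-refl = record { gap≡ = λ _ → refl ; len≡ = refl ; lab≡ = λ s → record
    { ρ = λ l → l ; ρ' = λ l → l ; ρ-lab = λ _ → refl ; ρ'-lab = λ _ → refl
    ; ρ-emp = λ i → i , refl ; ρ'-emp = λ i → i , refl } }

  ≅-⊂ : ∀ {L L' A B} → (∀ {x} → L' x → L x) → A ≅[ L ] B → A ≅[ L' ] B
  ≅-⊂ i e = record { gap≡ = λ l → gap≡ (i l) ; len≡ = len≡ ; lab≡ = λ s → record
    { ρ = ρ (lab≡ s) ; ρ' = ρ' (lab≡ s) ; ρ-lab = λ l → ρ-lab (lab≡ s) (i l)
    ; ρ'-lab = λ l → ρ'-lab (lab≡ s) (i l) ; ρ-emp = ρ-emp (lab≡ s) ; ρ'-emp = ρ'-emp (lab≡ s) } }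
    where
    open _≅[_]_ e
    open LabEq

  Conn-≅ : ∀ {L L'} {K K' : Cut L L'} {A B : Pres X} → WF L A → K ⊑ K' → A ≅[ L ] B →
    ∀ {x y} → L x → Conn (gap A) (Cut.M K) x y → Conn (gap B) (Cut.M K') x y
  Conn-≅ wf i e l here = here
  Conn-≅ {K = K} {K'} {A} {B} wf i e l (gapᶜ q) =
    subst (Conn (gap B) (Cut.M K') _) (sym (_≅[_]_.gap≡ e (Conn-L K wf l q)))
      (gapᶜ (Conn-≅ {K = K} {K'} wf i e l q))
  Conn-≅ {K = K} {K'} wf i e l (stepᶜ q m) = stepᶜ (Conn-≅ {K = K} {K'} wf i e l q) (_⊑_.M⊑ i m)

  -- One half of a symmetric comparison; the other half is the same module with the two surgeries
  -- exchanged.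
  module Half {L L' : X → Set} {K K' : Cut L L'} {A B A' B' : Pres X}
           (wfA : WF L A) (wfB : WF L B) (i : K ⊑ K') (i' : K' ⊑ K) (e : A ≅[ L ] B)
           (S : Surg K A A') (T : Surg K' B B') where
    private
      module K = Cut K
      module K' = Cut K'
      module S = Surg S
      module T = Surg T
      module e = _≅[_]_ e

    -- A closed curve of A is also one of B. No remaining point lies on it, so the covering property
    -- of T provides a representative in `T.ls`.
    ls-transfer : All (λ x → Any (λ y → L x × Conn (gap A) K.M x y) T.ls) S.ls
    ls-transfer = All.zipWith step (S.ls-D , S.ls-closed)
      where
      step : ∀ {x} → K.D x × (∀ y → Conn (gap A) K.M x y → K.D y) →
        Any (λ y → L x × Conn (gap A) K.M x y) T.ls
      step (d , h) with T.ls-cover (_⊑_.D⊑ i d)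
      ... | inj₁ a = Any.map (λ c → K.D⊂L d ,
              Conn-≅ {K = K'} {K} wfB i' (≅-sym e) (K.D⊂L d) c) a
      ... | inj₂ (y , l , c) =
        ⊥-elim (K.D∩L' (h _ (Conn-≅ {K = K'} {K} wfB i' (≅-sym e) (K.D⊂L d) c)) l)

    ls-≤ : length S.ls ≤ length T.ls
    ls-≤ = apart-length
      (λ { n (l , c) (l' , c') → n (Conn-trans c (Conn-sym K wfA l' c')) }) S.ls-apart ls-transfer

    module _ (s : Side) where
      open LabEq (e.lab≡ s)

      -- The map `T.F s` after ρ identifies whatever J identifies in A. By minimality of `S.F s` it
      -- then takes the same value at a label and at its image.
      relabel : ∀ l → T.F s (ρ (S.F s l)) ≡ T.F s (ρ l)
      relabel = Merges.least (S.merges s) (λ l → T.F s (ρ l)) λ j →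
        trans (cong (T.F s) (sym (ρ-lab (K.D⊂L (proj₁ (K.J-D s j))))))
          (trans (Merges.joins (T.merges s) (_⊑_.J⊑ i s j))
            (cong (T.F s) (ρ-lab (K.D⊂L (proj₂ (K.J-D s j))))))

      lab-transfer : ∀ {x} → L' x → lab B' s x ≡ T.F s (ρ (lab A' s x))
      lab-transfer l = trans (T.lab-eq s l) (trans (cong (T.F s) (ρ-lab (K.L'⊂L l)))
        (sym (trans (cong (λ z → T.F s (ρ z)) (S.lab-eq s l)) (relabel _))))

      emp-source : ∀ {w} → w ∈ emp A s ++ map (lab A s) S.ls →
        T.F s (ρ w) ∈ emp B' s × ρ' (ρ w) ≡ w
      emp-source w∈ with ∈-++⁻ (emp A s) w∈
      ... | inj₁ j = proj₂ (T.emp-eq s) (∈-map⁺ (T.F s) (∈-++⁺ˡ (proj₁ (ρ-emp j))))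
                   , proj₂ (ρ-emp j)
      ... | inj₂ j with ∈-map⁻ (lab A s) j
      ... | x , x∈ , refl = subst (_∈ emp B' s) same
              (proj₂ (T.emp-eq s) (∈-map⁺ (T.F s) (∈-++⁺ʳ (emp B s) (∈-map⁺ (lab B s) y∈))))
            , trans (cong ρ' (sym (ρ-lab lx))) (sym (ρ'-lab lx))
        where
        a = All.lookup ls-transfer x∈
        y∈ = proj₁ (proj₂ (find a))
        lx = proj₁ (proj₂ (proj₂ (find a)))
        c = proj₂ (proj₂ (proj₂ (find a)))
        -- The two surgeries may represent one closed curve by different points, but F of the label
        -- is constant along it.
        same : T.F s (lab B s (proj₁ (find a))) ≡ T.F s (ρ (lab A s x))
        same = trans (sym (Conn-lab K' wfB s (T.F s) (M-lab K' wfB T s) lx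
                 (Conn-≅ {K = K} {K'} wfA i e lx c))) (cong (T.F s) (ρ-lab lx))

  module _ {L L' : X → Set} {K K' : Cut L L'} {A B A' B' : Pres X}
           (wfA : WF L A) (wfB : WF L B) (i : K ⊑ K') (i' : K' ⊑ K) (e : A ≅[ L ] B)
           (S : Surg K A A') (T : Surg K' B B') where
    private
      module S = Surg S
      module T = Surg T
      module e = _≅[_]_ e
      module H  = Half {K = K} {K'} wfA wfB i i' e S T
      module H' = Half {K = K'} {K} wfB wfA i' i (≅-sym e) T S

    Surg-cong : A' ≅[ L' ] B'
    Surg-cong = record
      { gap≡ = gap-eq
      ; len≡ = trans S.len-eq (trans (cong₂ _+ℕ_ e.len≡ (ℕ.≤-antisym H.ls-≤ H'.ls-≤)) (sym T.len-eq))
      ; lab≡ = λ s → record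
        { ρ = λ l → T.F s (LabEq.ρ (e.lab≡ s) l)
        ; ρ' = λ l → S.F s (LabEq.ρ' (e.lab≡ s) l)
        ; ρ-lab = H.lab-transfer s
        ; ρ'-lab = H'.lab-transfer s
        ; ρ-emp = emp-half s
        ; ρ'-emp = emp-half' s } }
      where
      lw : ∀ {x} → L' x → L x
      lw = Cut.L'⊂L K
      gap-eq : ∀ {x} → L' x → gap A' x ≡ gap B' x
      -- `gap A' x` is a remaining point on the curve of x in B and differs from x, which leaves
      -- only the other end.
      gap-eq {x} l with T.two-ends l (S.gap-live l) (Conn-≅ {K = K} {K'} wfA i e (lw l) (S.gap-conn l))
      ... | inj₁ p = ⊥-elim (S.gap-≢ l p)
      ... | inj₂ p = p
      emp-half : ∀ s {z} → z ∈ emp A' s → T.F s (LabEq.ρ (e.lab≡ s) z) ∈ emp B' s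
        × S.F s (LabEq.ρ' (e.lab≡ s) (T.F s (LabEq.ρ (e.lab≡ s) z))) ≡ z
      emp-half s z∈ with ∈-map⁻ (S.F s) (proj₁ (S.emp-eq s) z∈)
      ... | w , w∈ , refl with H.emp-source s w∈
      ... | p , q = subst (_∈ emp B' s) (sym (H.relabel s w)) p
                  , trans (cong (λ z → S.F s (LabEq.ρ' (e.lab≡ s) z)) (H.relabel s w))
                      (trans (H'.relabel s _) (cong (S.F s) q))
      emp-half' : ∀ s {z} → z ∈ emp B' s → S.F s (LabEq.ρ' (e.lab≡ s) z) ∈ emp A' s
        × T.F s (LabEq.ρ (e.lab≡ s) (S.F s (LabEq.ρ' (e.lab≡ s) z))) ≡ z
      emp-half' s z∈ with ∈-map⁻ (T.F s) (proj₁ (T.emp-eq s) z∈)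
      ... | w , w∈ , refl with H'.emp-source s w∈
      ... | p , q = subst (_∈ emp A' s) (sym (H'.relabel s w)) p
                  , trans (cong (λ z → T.F s (LabEq.ρ (e.lab≡ s) z)) (H'.relabel s w))
                      (trans (H.relabel s _) (cong (T.F s) q))

-- Indices of points

open Pt
open Core

≡ᵇ⇒ : ∀ {i j} → (i ≡ᵇ j) ≡ true → i ≡ j
≡ᵇ⇒ {i} {j} p = ℕ.≡ᵇ⇒≡ i j (Equivalence.from T-≡ p)

⇒≡ᵇ : ∀ {i j} → i ≡ j → (i ≡ᵇ j) ≡ true
⇒≡ᵇ {i} {j} p = Equivalence.to T-≡ (ℕ.≡⇒≡ᵇ i j p)

finEq⇒ : ∀ {n} {i j : Fin n} → finEq i j ≡ true → i ≡ j
finEq⇒ p = Fin.toℕ-injective (≡ᵇ⇒ p)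

⇒finEq : ∀ {n} {i j : Fin n} → i ≡ j → finEq i j ≡ true
⇒finEq p = ⇒≡ᵇ (cong toℕ p)

finEq-refl : ∀ {n} (i : Fin n) → finEq i i ≡ true
finEq-refl i = ⇒finEq {i = i} refl

finEq-false : ∀ {n} {i j : Fin n} → i ≢ j → finEq i j ≡ false
finEq-false {i = i} {j} h with finEq i j in eq
... | true  = ⊥-elim (h (finEq⇒ eq))
... | false = refl

bit : Bool → Fin 2
bit false = Fin.zero
bit true  = Fin.suc Fin.zero

bit-injective : ∀ x y → bit x ≡ bit y → x ≡ y
bit-injective false false _ = refl
bit-injective true  true  _ = refl

slot : Bool → Bool → Fin 4
slot x h = combine (bit x) (bit h)

slot-injective : ∀ x h x' h' → slot x h ≡ slot x' h' → x ≡ x' × h ≡ h'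
slot-injective x h x' h' p with Fin.combine-injective (bit x) (bit h) (bit x') (bit h') p
... | q , r = bit-injective x x' q , bit-injective h h' r

-- `idx` as an element of a finite set. This yields both the injectivity of `idx` and, by
-- pigeonhole, the bound `4 *ℕ n` on periods.
pos : ∀ {n} → Pt n → Fin (n *ℕ 4)
pos (pt e x h) = combine e (slot x h)

pos-injective : ∀ {n} {x y : Pt n} → pos x ≡ pos y → x ≡ y
pos-injective {x = pt e x h} {pt e' x' h'} p
  with refl , q ← Fin.combine-injective e (slot x h) e' (slot x' h') p
  with refl , refl ← slot-injective x h x' h' q = refl

toℕ-slot : ∀ x h → toℕ (slot x h) ≡ 2 *ℕ b2n x +ℕ b2n h
toℕ-slot false false = refl
toℕ-slot false true  = refl
toℕ-slot true  false = refl
toℕ-slot true  true  = refl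

toℕ-pos : ∀ {n} (x : Pt n) → toℕ (pos x) ≡ idx x
toℕ-pos (pt e x h) = trans (Fin.toℕ-combine e (slot x h))
  (trans (cong (4 *ℕ toℕ e +ℕ_) (toℕ-slot x h)) (sym (ℕ.+-assoc (4 *ℕ toℕ e) (2 *ℕ b2n x) (b2n h))))

idx-injective : ∀ {n} {x y : Pt n} → idx x ≡ idx y → x ≡ y
idx-injective {x = x} {y} p =
  pos-injective (Fin.toℕ-injective (trans (toℕ-pos x) (trans p (sym (toℕ-pos y)))))

-- Orbits

iter : {X : Set} → ℕ → (X → X) → X → X
iter zero    f x = x
iter (suc k) f x = iter k f (f x)

module _ {X : Set} where

  iter-suc : ∀ k (f : X → X) x → iter (suc k) f x ≡ f (iter k f x)
  iter-suc zero    f x = refl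
  iter-suc (suc k) f x = iter-suc k f (f x)

  iter-+ : ∀ d k (f : X → X) x → iter (d +ℕ k) f x ≡ iter k f (iter d f x)
  iter-+ zero    k f x = refl
  iter-+ (suc d) k f x = iter-+ d k f (f x)

  iter-L : {L : X → Set} {f : X → X} → (∀ {x} → L x → L (f x)) → ∀ k {x} → L x → L (iter k f x)
  iter-L {L} h zero    l = l
  iter-L {L} h (suc k) l = iter-L {L} h k (h l)

  ∈-orbitL⁺ : ∀ {k i} (f : X → X) x → i < k → iter i f x ∈ orbitL k f x
  ∈-orbitL⁺ {i = zero}  f x (s≤s _) = here refl
  ∈-orbitL⁺ {i = suc i} f x (s≤s p) = there (∈-orbitL⁺ f (f x) p)

  ∈-orbitL⁻ : ∀ k (f : X → X) x {y} → y ∈ orbitL k f x → ∃ λ i → y ≡ iter i f x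
  ∈-orbitL⁻ (suc k) f x (here p)  = 0 , p
  ∈-orbitL⁻ (suc k) f x (there p) with ∈-orbitL⁻ k f (f x) p
  ... | i , q = suc i , q

module _ {n} {L : Pt n → Set} {f : Pt n → Pt n} (f-L : ∀ {x} → L x → L (f x))
         (f-inj : ∀ {x y} → L x → L y → f x ≡ f y → x ≡ y) where

  iter-injective : ∀ k {x y} → L x → L y → iter k f x ≡ iter k f y → x ≡ y
  iter-injective zero    lx ly p = p
  iter-injective (suc k) lx ly p = f-inj lx ly (iter-injective k (f-L lx) (f-L ly) p)

  -- Among `suc (4 *ℕ n)` iterates two coincide, and injectivity cancels the smaller exponent. Hence
  -- `4 *ℕ n` steps, the number made by `comp` and by the tracing in `surgery`, suffice for a full
  -- turn.
  period : ∀ {x} → L x → ∃ λ p → p < 4 *ℕ n × iter (suc p) f x ≡ x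
  period {x} l with Fin.pigeonhole {n *ℕ 4} {suc (4 *ℕ n)} (s≤s (ℕ.≤-reflexive (ℕ.*-comm n 4)))
                      (λ i → pos (iter (toℕ i) f x))
  ... | i , j , i<j , q with ℕ.m≤n⇒∃[o]m+o≡n i<j
  ... | p , r = p , ℕ.≤-trans (ℕ.≤-trans (s≤s (ℕ.m≤n+m p (toℕ i))) (ℕ.≤-reflexive r)) (ℕ.≤-pred (Fin.toℕ<n j))
              , sym (iter-injective (toℕ i) l (iter-L {L = L} f-L (suc p) l)
                  (trans (pos-injective q) (trans (cong (λ k → iter k f x) eq)
                    (iter-+ (suc p) (toℕ i) f x))))
    where
    eq : toℕ j ≡ suc p +ℕ toℕ i
    eq = trans (sym r) (cong suc (ℕ.+-comm (toℕ i) p))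

  ∈-orbit : ∀ {x} → L x → ∀ i → iter i f x ∈ orbitL (4 *ℕ n) f x
  ∈-orbit {x} l i = go i i ℕ.≤-refl
    where
    -- The exponent i drops by a whole period at a time, so the recursion runs on a bound b for it.
    go : ∀ b i → i ≤ b → iter i f x ∈ orbitL (4 *ℕ n) f x
    go b i i≤b with period l
    ... | p , p< , q with i ℕ.<? 4 *ℕ n
    ... | yes i< = ∈-orbitL⁺ f x i<
    ... | no i≮ with ℕ.m≤n⇒∃[o]m+o≡n (ℕ.≤-trans p< (ℕ.≮⇒≥ i≮))
    go zero i i≤b | p , p< , q | no i≮ | o , refl = ⊥-elim (ℕ.n≮0 (ℕ.≤-trans (s≤s (ℕ.m≤m+n p o)) i≤b))
    go (suc b) i i≤b | p , p< , q | no i≮ | o , refl =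
      subst (_∈ orbitL (4 *ℕ n) f x) (sym (trans (iter-+ (suc p) o f x) (cong (iter o f) q)))
        (go b o (ℕ.≤-trans (ℕ.m≤n+m o p) (ℕ.≤-pred i≤b)))

Graph : {X : Set} → (X → X) → X → X → Set
Graph m x y = y ≡ m x

module _ {n : ℕ} where

  minPt-∈ : ∀ (x : Pt n) ys → minPt x ys ≡ x ⊎ minPt x ys ∈ ys
  minPt-∈ x [] = inj₁ refl
  minPt-∈ x (y ∷ ys) with idx y <ᵇ idx x
  ... | true with minPt-∈ y ys
  ... | inj₁ p = inj₂ (here p)
  ... | inj₂ p = inj₂ (there p)
  minPt-∈ x (y ∷ ys) | false with minPt-∈ x ys
  ... | inj₁ p = inj₁ p
  ... | inj₂ p = inj₂ (there p)

  minPt-≤ : ∀ (x : Pt n) ys → idx (minPt x ys) ≤ idx x × (∀ {y} → y ∈ ys → idx (minPt x ys) ≤ idx y)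
  minPt-≤ x [] = ℕ.≤-refl , λ ()
  minPt-≤ x (y ∷ ys) with idx y <ᵇ idx x in eq
  ... | true with minPt-≤ y ys
  ... | p , q = ℕ.≤-trans p (ℕ.<⇒≤ (ℕ.<ᵇ⇒< (idx y) (idx x) (Equivalence.from T-≡ eq)))
              , λ { (here refl) → p ; (there i) → q i }
  minPt-≤ x (y ∷ ys) | false with minPt-≤ x ys
  ... | p , q = p , λ { (here refl) → ℕ.≤-trans p (ℕ.≮⇒≥ λ lt →
                          subst T eq (ℕ.<⇒<ᵇ lt))
                      ; (there i) → q i }

module _ {n} (g m : Pt n → Pt n) where

  private
    f : Pt n → Pt n
    f y = m (g y)
    C = Conn g (Graph m)

  iter-conn : ∀ {x} i → C x (iter i f x)
  iter-conn zero    = here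
  iter-conn (suc i) = Conn-trans (stepᶜ (gapᶜ here) refl) (iter-conn i)

  comp-conn : ∀ {x y} → y ∈ comp g m x → C x y
  comp-conn {x} y∈ with ∈-++⁻ (orbitL (4 *ℕ n) f x) y∈
  ... | inj₁ p with ∈-orbitL⁻ (4 *ℕ n) f x p
  ... | i , refl = iter-conn i
  comp-conn {x} y∈ | inj₂ p with ∈-map⁻ g p
  ... | z , z∈ , refl with ∈-orbitL⁻ (4 *ℕ n) f x z∈
  ... | i , refl = gapᶜ (iter-conn i)

  rep-conn : ∀ {x} → C x (rep g m x)
  rep-conn {x} with minPt-∈ x (comp g m x)
  ... | inj₁ p = subst (C x) (sym p) here
  ... | inj₂ p = comp-conn p

module Component {n} (L : Pt n → Set) (g m : Pt n → Pt n)
                 (g-L : ∀ {x} → L x → L (g x)) (g-inv : ∀ {x} → L x → g (g x) ≡ x)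
                 (m-L : ∀ {x} → L x → L (m x)) (m-inv : ∀ {x} → L x → m (m x) ≡ x) where

  private
    f : Pt n → Pt n
    f y = m (g y)
    C = Conn g (Graph m)

  f-L : ∀ {x} → L x → L (f x)
  f-L l = m-L (g-L l)

  f-inj : ∀ {x y} → L x → L y → f x ≡ f y → x ≡ y
  f-inj lx ly p = trans (sym (g-inv lx)) (trans (cong g (trans (sym (m-inv (g-L lx)))
    (trans (cong m p) (m-inv (g-L ly))))) (g-inv ly))

  C-L : ∀ {x y} → L x → C x y → L y
  C-L l here           = l
  C-L l (gapᶜ q)       = g-L (C-L l q)
  C-L l (stepᶜ q refl) = m-L (C-L l q)

  C-sym : ∀ {x y} → L x → C x y → C y x
  C-sym l here = here
  C-sym l (gapᶜ {y} q) = Conn-trans (subst (C (g y)) (g-inv (C-L l q)) (gapᶜ here)) (C-sym l q)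
  C-sym l (stepᶜ q refl) = Conn-trans (stepᶜ here (sym (m-inv (C-L l q)))) (C-sym l q)

  private
    -- The forward orbit of x under f and its gaps exhaust the component: m undoes a step of f, and
    -- at x itself, where there is no step to undo, the period supplies one.
    In : Pt n → Pt n → Set
    In x y = ∃ λ i → y ≡ iter i f x ⊎ y ≡ g (iter i f x)

    In-m : ∀ {x y} → L x → In x y → In x (m y)
    In-m l (i , inj₂ refl) = suc i , inj₁ (sym (iter-suc i f _))
    In-m {x} l (suc i , inj₁ refl) = i , inj₂
      (trans (cong m (iter-suc i f x)) (m-inv (g-L (iter-L {L = L} f-L i l))))
    In-m {x} l (zero , inj₁ refl) with period {L = L} f-L f-inj l
    ... | p , _ , q = p , inj₂ (trans (cong m (trans (sym q) (iter-suc p f x)))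
            (m-inv (g-L (iter-L {L = L} f-L p l))))

    In-C : ∀ {x y} → L x → C x y → In x y
    In-C l here = 0 , inj₁ refl
    In-C l (gapᶜ q) with In-C l q
    ... | i , inj₁ refl = i , inj₂ refl
    ... | i , inj₂ refl = i , inj₁ (g-inv (iter-L {L = L} f-L i l))
    In-C l (stepᶜ q refl) = In-m l (In-C l q)

  comp⁺ : ∀ {x y} → L x → C x y → y ∈ comp g m x
  comp⁺ {x} l c with In-C l c
  ... | i , inj₁ refl = ∈-++⁺ˡ (∈-orbit {L = L} f-L f-inj l i)
  ... | i , inj₂ refl = ∈-++⁺ʳ (orbitL (4 *ℕ n) f x) (∈-map⁺ g (∈-orbit {L = L} f-L f-inj l i))

  rep-unique : ∀ {x z} → L x → C x z → (∀ {y} → C x y → idx z ≤ idx y) → rep g m x ≡ z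
  rep-unique {x} l c h = idx-injective
    (ℕ.≤-antisym (proj₂ (minPt-≤ x (comp g m x)) (comp⁺ l c)) (h (rep-conn g m)))

  rep-min : ∀ {x y} → L x → C x y → idx (rep g m x) ≤ idx y
  rep-min {x} l c = proj₂ (minPt-≤ x (comp g m x)) (comp⁺ l c)

  rep-cong : ∀ {x y} → L x → C x y → rep g m x ≡ rep g m y
  rep-cong l c = rep-unique l (Conn-trans c (rep-conn g m)) (λ d → rep-min (C-L l c) (Conn-trans (C-sym l c) d))

-- From cores to presentations

private
  variable
    a : Level
    A : Set a

all-true : ∀ {X : Set} {p : X → Bool} xs → all p xs ≡ true → ∀ {y} → y ∈ xs → p y ≡ true
all-true {p = p} (x ∷ xs) h i with p x in eq
all-true (x ∷ xs) h (here refl) | true = eq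
all-true (x ∷ xs) h (there i) | true = all-true xs h i

all-false : ∀ {X : Set} {p : X → Bool} xs → all p xs ≡ false → ∃ λ y → y ∈ xs × p y ≡ false
all-false {p = p} (x ∷ xs) h with p x in eq
... | false = x , here refl , eq
... | true with all-false xs h
... | y , i , q = y , there i , q

any-true : ∀ {X : Set} {p : X → Bool} xs → any p xs ≡ true → ∃ λ y → y ∈ xs × p y ≡ true
any-true {p = p} (x ∷ xs) h with p x in eq
... | true = x , here refl , eq
... | false with any-true xs h
... | y , i , q = y , there i , q

any-intro : ∀ {X : Set} {p : X → Bool} {xs y} → y ∈ xs → p y ≡ true → any p xs ≡ true
any-intro (here refl) q rewrite q = refl
any-intro {p = p} {x ∷ xs} (there i) q with p x
... | true  = refl
... | false = any-intro i q

memF⇒∈ : ∀ {n} {j : Fin n} es → memF j es ≡ true → j ∈ es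
memF⇒∈ es h with any-true es h
... | y , i , q = subst (_∈ es) (sym (finEq⇒ q)) i

∈⇒memF : ∀ {n} {j : Fin n} {es} → j ∈ es → memF j es ≡ true
∈⇒memF {j = j} i = any-intro i (⇒finEq {i = j} refl)

-- A record and not the bare type `E (edge x)`, from which unification could not recover E and x.
record On {n} (E : Fin n → Set) (x : Pt n) : Set where
  constructor on
  field at : E (edge x)

data Kind : Set where
  kA kB kC : Kind

kindM : ∀ {n} → Kind → Pt n → Pt n
kindM kA = mA
kindM kB = mB
kindM kC = mC

edge-kindM : ∀ {n} k (x : Pt n) → edge (kindM k x) ≡ edge x
edge-kindM kA x = refl
edge-kindM kB x = refl
edge-kindM kC x = refl

kindM-inv : ∀ {n} k (x : Pt n) → kindM k (kindM k x) ≡ x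
kindM-inv kA (pt e x h) = cong (pt e x) (not-involutive h)
kindM-inv kB (pt e x h) = cong₂ (pt e) (not-involutive x) (not-involutive h)
kindM-inv kC (pt e x h) = cong (λ z → pt e z h) (not-involutive x)

kindM-≢ : ∀ {n} k (x : Pt n) → kindM k x ≢ x
kindM-≢ kA (pt e x false) ()
kindM-≢ kA (pt e x true)  ()
kindM-≢ kB (pt e x false) ()
kindM-≢ kB (pt e x true)  ()
kindM-≢ kC (pt e false h) ()
kindM-≢ kC (pt e true h)  ()

kindS : Side → Kind
kindS vert = kA
kindS bdry = kB

mS : ∀ {n} → Side → Pt n → Pt n
mS s = kindM (kindS s)

block : Side → ℕ × ℕ → ℕ
block vert = proj₁
block bdry = proj₂

rawLab : ∀ {n} → Core A n → Side → Pt n → ℕ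
rawLab c vert = vlab c
rawLab c bdry = blab c

-- `vL` and `bL` under one name: vertices are the components of the gaps with `mA`, boundary
-- components those of the gaps with `mB`.
labC : ∀ {n} → Core A n → Side → Pt n → ℕ
labC c s x = rawLab c s (rep (Core.gap c) (mS s) x)

abs : ∀ {n} → Core A n → Pres (Pt n)
abs c = record
  { gap = Core.gap c
  ; lab = labC c
  ; len = length (empties c)
  ; emp = λ s → map (block s) (empties c) }

record GapWF {n} (E : Fin n → Set) (g : Pt n → Pt n) : Set where
  field
    gap-L   : ∀ {x} → On E x → On E (g x)
    gap-inv : ∀ {x} → On E x → g (g x) ≡ x
    gap-≢   : ∀ {x} → On E x → g x ≢ x

module _ {n} {E : Fin n → Set} (c : Core A n) (wf : GapWF E (Core.gap c)) where
  open GapWF wf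

  mS-L : ∀ s {x} → On E x → On E (mS s x)
  mS-L s (on l) = on (subst E (sym (edge-kindM (kindS s) _)) l)

  module Circle (s : Side) =
    Component (On E) (Core.gap c) (mS s) gap-L gap-inv (mS-L s) (λ {x} _ → kindM-inv (kindS s) x)

  labC-cong : ∀ s {x y} → On E x → Conn (Core.gap c) (Graph (mS s)) x y → labC c s x ≡ labC c s y
  labC-cong s l p = cong (rawLab c s) (Circle.rep-cong s l p)

  labC-mS : ∀ s {x} → On E x → labC c s (mS s x) ≡ labC c s x
  labC-mS s l = sym (labC-cong s l (stepᶜ here refl))

  abs-WF : WF (On E) (abs c)
  abs-WF = record
    { gap-L = gap-L ; gap-inv = gap-inv ; gap-≢ = gap-≢
    ; lab-gap = λ s l → sym (labC-cong s l (gapᶜ here)) }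

WF-Gap : ∀ {n} {E : Fin n → Set} {c : Core A n} → WF (On E) (abs c) → GapWF E (Core.gap c)
WF-Gap wf = record { gap-L = gap-L ; gap-inv = gap-inv ; gap-≢ = gap-≢ }
  where open WF wf

-- Tracing curves through removed arcs

module Chase {X : Set} (g m : X → X) (dead : X → Bool) where

  chase : ℕ → X → X
  chase zero    y = y
  chase (suc k) y = if dead y then chase k (g (m y)) else y

  chase-unique : (ch : ℕ → X → X) → (∀ y → ch 0 y ≡ y) →
    (∀ k y → ch (suc k) y ≡ (if dead y then ch k (g (m y)) else y)) →
    ∀ k y → ch k y ≡ chase k y
  chase-unique ch h₀ h₁ zero y = h₀ y
  chase-unique ch h₀ h₁ (suc k) y = trans (h₁ k y) (cong (if dead y then_else y)
    (chase-unique ch h₀ h₁ k (g (m y))))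

  private
    f : X → X
    f y = m (g y)

  Exit : ℕ → X → Set
  Exit j x = (∀ i → i < j → dead (g (iter i f x)) ≡ true) × dead (g (iter j f x)) ≡ false

  chase-exit : ∀ k x → (∃ λ j → Exit j x × chase k (g x) ≡ g (iter j f x))
                     ⊎ (∀ i → i < k → dead (g (iter i f x)) ≡ true)
  chase-exit zero x = inj₂ λ _ ()
  chase-exit (suc k) x with dead (g x) in eq
  ... | false = inj₁ (0 , ((λ _ ()) , eq) , refl)
  ... | true with chase-exit k (f x)
  ... | inj₁ (j , (h , q) , r) = inj₁ (suc j ,
          ((λ { zero _ → eq ; (suc i) (s≤s lt) → h i lt }) , q) , r)
  ... | inj₂ h = inj₂ λ { zero _ → eq ; (suc i) (s≤s lt) → h i lt }

-- chase is local to surgery; unification recovers it as surgeryChase.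
mutual
  surgeryChase : ∀ {n} → Core A n → List (Fin n) → (Pt n → Pt n) → (ℕ → ℕ) → (ℕ → ℕ) →
    ℕ → Pt n → Pt n
  surgeryChase c ds m FV FB = _

  surgery-gap : ∀ {n} (c : Core A n) ds m FV FB x →
    Core.gap (surgery c ds m FV FB) x ≡ surgeryChase c ds m FV FB (4 *ℕ n) (Core.gap c x)
  surgery-gap {n = n} c ds m FV FB x with 4 *ℕ n | Core.gap c x
  ... | k | y = refl

surgery-chase : ∀ {n} (c : Core A n) ds m FV FB x →
  Core.gap (surgery c ds m FV FB) x
    ≡ Chase.chase (Core.gap c) m (λ y → memF (edge y) ds) (4 *ℕ n) (Core.gap c x)
surgery-chase {n = n} c ds m FV FB x = trans (surgery-gap c ds m FV FB x)
  (Chase.chase-unique (Core.gap c) m _ (surgeryChase c ds m FV FB)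
    (λ _ → refl) (λ _ _ → refl) (4 *ℕ n) (Core.gap c x))

-- m is total, and `comp` and `rep` follow it everywhere, whereas M is its restriction to removed
-- points, which governs the outcome. The 2-sum needs the distinction: its m fixes all points off
-- the two edges, so `m-≢` is asked on D only.
module Surgery {n} {E E' : Fin n → Set} (K : Cut (On E) (On E')) (c : Core A n)
  (wf : GapWF E (Core.gap c)) (ds : List (Fin n)) (m : Pt n → Pt n) (F : Side → ℕ → ℕ)
  (uniq : Unique ds)
  (dead⇒ : ∀ {x} → edge x ∈ ds → Cut.D K x) (⇒dead : ∀ {x} → Cut.D K x → edge x ∈ ds)
  (M⇒ : ∀ {x y} → Cut.M K x y → y ≡ m x) (⇒M : ∀ {x} → Cut.D K x → Cut.M K x (m x))
  (m-L : ∀ {x} → On E x → On E (m x)) (m-inv : ∀ {x} → On E x → m (m x) ≡ x)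
  (m-≢ : ∀ {x} → Cut.D K x → m x ≢ x)
  (merges : ∀ s → Merges (labC c s) (Cut.J K s) (F s))
  where

  open GapWF wf
  open Cut K

  c' : Core A n
  c' = surgery c ds m (F vert) (F bdry)

  private
    g = Core.gap c
    dead : Pt n → Bool
    dead y = memF (edge y) ds
    C = Conn g M
    f : Pt n → Pt n
    f y = m (g y)
    open module CC = Component (On E) g m gap-L gap-inv m-L m-inv
      using (f-L; f-inj; comp⁺; rep-cong; C-L)
    r-C : ∀ {x} → Conn g (Graph m) x (rep g m x)
    r-C = rep-conn g m
    open Chase g m dead using (Exit; chase-exit)

  dead-D : ∀ {x} → dead x ≡ true → D x
  dead-D p = dead⇒ (memF⇒∈ ds p)

  D-dead : ∀ {x} → D x → dead x ≡ true
  D-dead d = ∈⇒memF (⇒dead d)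

  alive : ∀ {x} → On E x → dead x ≡ false → On E' x
  alive l p with split l
  ... | inj₂ l' = l'
  ... | inj₁ d with () ← trans (sym (D-dead d)) p

  D-m : ∀ {x} → D x → D (m x)
  D-m d = proj₂ (M-D (⇒M d))

  iter-On : ∀ i {x} → On E x → On E (iter i f x)
  iter-On = iter-L {L = On E} f-L

  -- If tracing never came out, all gaps along a full period from x would end at removed points.
  -- Then x, being m of the last of these, would be removed too.
  exit : ∀ {x} → On E' x → ∃ λ j → Exit j x × Core.gap c' x ≡ g (iter j f x)
  exit {x} l with chase-exit (4 *ℕ n) x
  ... | inj₁ (j , h , q) = j , h , trans (surgery-chase c ds m (F vert) (F bdry) x) q
  ... | inj₂ h with period {L = On E} f-L f-inj (L'⊂L l)
  ... | p , p< , q = ⊥-elim (D∩L' (subst D (trans (sym (iter-suc p f x)) q)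
          (D-m (dead-D (h p p<)))) l)

  reach-iter : ∀ {x} → On E x → ∀ j → (∀ i → i < j → dead (g (iter i f x)) ≡ true) →
    C x (iter j f x)
  reach-iter l zero h = here
  reach-iter l (suc j) h = Conn-trans (stepᶜ (gapᶜ here) (⇒M (dead-D (h 0 (s≤s z≤n)))))
    (reach-iter (f-L l) j (λ i lt → h (suc i) (s≤s lt)))

  -- A path from x that returned to x would contain one from f x to f x, two steps
  -- shorter, and finally a fixed point of g or m.
  no-return : ∀ k {x} → On E x → (∀ i → i < k → dead (g (iter i f x)) ≡ true) →
    g (iter k f x) ≢ x
  no-return zero l h p = gap-≢ l p
  no-return (suc zero) l h p = m-≢ (dead-D (h 0 (s≤s z≤n)))
    (trans (sym (gap-inv (f-L l))) (cong g p))
  no-return (suc (suc k)) {x} l h p = no-return k (f-L l) (λ i lt → h (suc i) (s≤s (ℕ.m≤n⇒m≤1+n lt)))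
    (trans (sym (m-inv (gap-L (iter-On (suc k) l)))) (cong m
      (trans (sym (iter-suc (suc k) f x))
        (trans (sym (gap-inv (iter-On (suc (suc k)) l))) (cong g p)))))

  -- The curve through x consists of the points `iter i f x` and `g (iter i f x)` with `i ≤ j`, and
  -- all of these but the first and the last are removed.
  two : ∀ {x y} j → On E' x → Exit j x → On E' y → C x y → y ≡ x ⊎ y ≡ g (iter j f x)
  two {x} j lx (h , out) ly q = ends ly (trace q)
    where
    l = L'⊂L lx
    Tr : Pt n → Set
    Tr y = ∃ λ i → i ≤ j × (y ≡ iter i f x ⊎ y ≡ g (iter i f x))
    last : ∀ {i} → i ≤ j → D (g (iter i f x)) → i < j
    last {i} i≤j d with ℕ.m≤n⇒m<n∨m≡n i≤j
    ... | inj₁ lt = lt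
    ... | inj₂ refl with () ← trans (sym (D-dead d)) out
    trace : ∀ {y} → C x y → Tr y
    trace here = 0 , z≤n , inj₁ refl
    trace (gapᶜ q) with trace q
    ... | i , i≤j , inj₁ refl = i , i≤j , inj₂ refl
    ... | i , i≤j , inj₂ refl = i , i≤j , inj₁ (gap-inv (iter-On i l))
    trace (stepᶜ q d) with trace q
    ... | zero , i≤j , inj₁ refl = ⊥-elim (D∩L' (proj₁ (M-D d)) lx)
    ... | suc i , i≤j , inj₁ refl = i , ℕ.≤-trans (ℕ.n≤1+n i) i≤j , inj₂ (trans (M⇒ d)
            (trans (cong m (iter-suc i f x)) (m-inv (gap-L (iter-On i l)))))
    ... | i , i≤j , inj₂ refl = suc i , last i≤j (proj₁ (M-D d)) ,
            inj₁ (trans (M⇒ d) (sym (iter-suc i f x)))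
    ends : ∀ {y} → On E' y → Tr y → y ≡ x ⊎ y ≡ g (iter j f x)
    ends ly (zero , i≤j , inj₁ p) = inj₁ p
    ends ly (suc i , i≤j , inj₁ refl) = ⊥-elim (D∩L' (subst D (sym (iter-suc i f x))
      (D-m (dead-D (h i i≤j)))) ly)
    ends ly (i , i≤j , inj₂ refl) with ℕ.m≤n⇒m<n∨m≡n i≤j
    ... | inj₁ lt = ⊥-elim (D∩L' (dead-D (h i lt)) ly)
    ... | inj₂ refl = inj₂ refl

  -- Closed curves

  loops : List (Pt n)
  loops = filterᵇ (λ z → all dead (comp g m z) ∧ (idx (rep g m z) ≡ᵇ idx z)) (concatMap ptsOf ds)

  ∈-ptsOf : ∀ x → x ∈ ptsOf {n} (edge x)
  ∈-ptsOf (pt e false false) = here refl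
  ∈-ptsOf (pt e false true)  = there (here refl)
  ∈-ptsOf (pt e true false)  = there (there (here refl))
  ∈-ptsOf (pt e true true)   = there (there (there (here refl)))

  ptsOf-edge : ∀ {e x} → x ∈ ptsOf {n} e → edge x ≡ e
  ptsOf-edge (here refl) = refl
  ptsOf-edge (there (here refl)) = refl
  ptsOf-edge (there (there (here refl))) = refl
  ptsOf-edge (there (there (there (here refl)))) = refl

  ptsOf-unique : ∀ e → Unique (ptsOf {n} e)
  ptsOf-unique e = ((λ ()) ∷ (λ ()) ∷ (λ ()) ∷ []) ∷ ((λ ()) ∷ (λ ()) ∷ []) ∷ ((λ ()) ∷ []) ∷ [] ∷ []

  deadPts-unique : ∀ {ds} → Unique ds → Unique (concatMap (ptsOf {n}) ds)
  deadPts-unique [] = []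
  deadPts-unique {d ∷ ds} (u ∷ us) = AllPairs.++⁺ (ptsOf-unique d) (deadPts-unique us)
    (All.tabulate λ i → All.tabulate λ {y} j → λ { refl →
      let z , z∈ , y∈ = find (∈-concatMap⁻ ptsOf {xs = ds} j) in
      All.lookup u z∈ (trans (sym (ptsOf-edge i)) (ptsOf-edge y∈)) })

  full : ∀ {x y} → C x y → Conn g (Graph m) x y
  full = Conn-mono M⇒

  ∈-loops⁻ : ∀ {z} → z ∈ loops → edge z ∈ ds × all dead (comp g m z) ≡ true × rep g m z ≡ z
  ∈-loops⁻ {z} i with ∈-filter⁻ (T? ∘ _) {xs = concatMap ptsOf ds} i
  ... | j , t with find (∈-concatMap⁻ ptsOf {xs = ds} j) | Equivalence.to T-∧ t
  ... | e , e∈ , z∈ | t₁ , t₂ = subst (_∈ ds) (sym (ptsOf-edge z∈)) e∈ , Equivalence.to T-≡ t₁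
        , idx-injective (ℕ.≡ᵇ⇒≡ _ _ t₂)

  ∈-loops⁺ : ∀ {z} → edge z ∈ ds → all dead (comp g m z) ≡ true → rep g m z ≡ z → z ∈ loops
  ∈-loops⁺ {z} e∈ p q = ∈-filter⁺ (T? ∘ _)
    (∈-concatMap⁺ ptsOf (Any.map (λ { refl → ∈-ptsOf z }) e∈))
    (Equivalence.from T-∧ (Equivalence.from T-≡ p , ℕ.≡⇒≡ᵇ _ _ (cong idx q)))

  -- Compares the components listed by `comp` with the curves of M: where m is followed without M
  -- for the first time, a remaining point has been reached.
  escape : ∀ {x y} → On E x → Conn g (Graph m) x y →
    C x y ⊎ ∃ λ z → On E' z × C x z
  escape l here = inj₁ here
  escape l (gapᶜ q) with escape l q
  ... | inj₁ c = inj₁ (gapᶜ c)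
  ... | inj₂ r = inj₂ r
  escape l (stepᶜ q refl) with escape l q
  ... | inj₂ r = inj₂ r
  ... | inj₁ c with split (C-L l q)
  ... | inj₁ d = inj₁ (stepᶜ c (⇒M d))
  ... | inj₂ l' = inj₂ (_ , l' , c)

  all-dead⇒ : ∀ {z} → On E z → all dead (comp g m z) ≡ true → ∀ {y} → Conn g (Graph m) z y → D y
  all-dead⇒ l p q = dead-D (all-true (comp g m _) p (comp⁺ l q))

  ⇒all-dead : ∀ {z} → On E z → (∀ {y} → Conn g (Graph m) z y → D y) → all dead (comp g m z) ≡ true
  ⇒all-dead {z} l h with all dead (comp g m z) in eq
  ... | true = refl
  ... | false with all-false (comp g m z) eq
  ... | y , i , q with () ← trans (sym (D-dead (h (comp-conn g m i)))) q

  cover : ∀ {x} → D x → Any (C x) loops ⊎ ∃ λ y → On E' y × C x y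
  cover {x} d with all dead (comp g m x) in eq
  ... | false with all-false (comp g m x) eq
  ... | y , i , q with escape (D⊂L d) (comp-conn g m i)
  ... | inj₁ r = inj₂ (y , alive (C-L (D⊂L d) (comp-conn g m i)) q , r)
  ... | inj₂ r = inj₂ r
  cover {x} d | true with escape (D⊂L d) r-C
  ... | inj₂ r = inj₂ r
  ... | inj₁ r = inj₁ (lose (∈-loops⁺ (⇒dead (h r-C))
                    (⇒all-dead lr (λ q → h (Conn-trans r-C q)))
                    (sym (rep-cong (D⊂L d) r-C))) r)
    where
    h : ∀ {y} → Conn g (Graph m) x y → D y
    h = all-dead⇒ (D⊂L d) eq
    lr = C-L (D⊂L d) r-C

  loops-D : All D loops
  loops-D = All.tabulate λ i → dead⇒ (proj₁ (∈-loops⁻ i))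

  loops-apart : AllPairs (λ x y → ¬ C x y) loops
  loops-apart = apart loops (λ i → i) (AllPairs.filter⁺ (T? ∘ _) (deadPts-unique uniq))
    where
    apart : ∀ xs → (∀ {z} → z ∈ xs → z ∈ loops) → Unique xs → AllPairs (λ x y → ¬ C x y) xs
    apart [] h [] = []
    apart (x ∷ xs) h (u ∷ us) = All.tabulate (λ i q → All.lookup u i
      (trans (sym (proj₂ (proj₂ (∈-loops⁻ (h (here refl))))))
        (trans (rep-cong (D⊂L (All.lookup loops-D (h (here refl)))) (full q))
          (proj₂ (proj₂ (∈-loops⁻ (h (there i)))))))) ∷ apart xs (λ i → h (there i)) us

  -- Block labels

  Fr : ∀ s {x y} → M x y → F s (labC c s x) ≡ F s (labC c s y)
  Fr s q = Merges.joins (merges s) (M⊂J s q)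

  rawLab-c' : ∀ s x → rawLab c' s x ≡ F s (labC c s x)
  rawLab-c' vert x = refl
  rawLab-c' bdry x = refl

  emp-c' : ∀ s → map (block s) (empties c') ≡ map (F s) (map (block s) (empties c) ++ map (labC c s) loops)
  emp-c' vert = trans (map-++ proj₁ (map _ (empties c)) _) (trans (cong₂ _++_
    (trans (sym (map-∘ (empties c))) (map-∘ (empties c))) (trans (sym (map-∘ loops)) (map-∘ loops)))
    (sym (map-++ (F vert) (map proj₁ (empties c)) _)))
  emp-c' bdry = trans (map-++ proj₂ (map _ (empties c)) _) (trans (cong₂ _++_
    (trans (sym (map-∘ (empties c))) (map-∘ (empties c))) (trans (sym (map-∘ loops)) (map-∘ loops)))
    (sym (map-++ (F bdry) (map proj₂ (empties c)) _)))

  len-c' : length (empties c') ≡ length (empties c) +ℕ length loops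
  len-c' = trans (length-++ (map _ (empties c))) (cong₂ _+ℕ_ (length-map _ (empties c)) (length-map _ loops))

  gap' = Core.gap c'

  gap-live : ∀ {x} → On E' x → On E' (gap' x)
  gap-live l with exit l
  ... | j , (h , out) , q = subst (On E') (sym q) (alive (gap-L (iter-On j (L'⊂L l))) out)

  gap-conn : ∀ {x} → On E' x → C x (gap' x)
  gap-conn l with exit l
  ... | j , (h , out) , q = subst (C _) (sym q) (gapᶜ (reach-iter (L'⊂L l) j h))

  wf-abs : WF (On E) (abs c)
  wf-abs = abs-WF c wf

  -- `surgery` stores at each point the merged old label of that point, but the new label is read at
  -- the representative of the new component. So merged old labels have to be constant along new
  -- components.
  FS-const : ∀ s {x y} → On E' x → Conn gap' (Graph (mS s)) x y →
    On E' y × F s (labC c s x) ≡ F s (labC c s y)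
  FS-const s l here = l , refl
  FS-const s l (gapᶜ q) with FS-const s l q
  ... | l' , r = gap-live l' , trans r (Conn-lab K wf-abs s (F s) (Fr s) (L'⊂L l') (gap-conn l'))
  FS-const s l (stepᶜ {y} q refl) with FS-const s l q
  ... | l' , r = on (subst E' (sym (edge-kindM (kindS s) y)) (On.at l'))
               , trans r (cong (F s) (sym (labC-mS c wf s (L'⊂L l'))))

  surg : Surg K (abs c) (abs c')
  surg = record
    { ls = loops
    ; gap-live = gap-live
    ; gap-conn = gap-conn
    ; gap-≢ = λ l → let j , (h , _) , q = exit l in λ p → no-return j (L'⊂L l) h (trans (sym q) p)
    ; two-ends = λ lx ly q → let j , e , r = exit lx in
        [ inj₁ , (λ p → inj₂ (trans p (sym r))) ]′ (two j lx e ly q)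
    ; ls-D = loops-D
    ; ls-closed = All.tabulate λ i _ q →
        all-dead⇒ (D⊂L (All.lookup loops-D i)) (proj₁ (proj₂ (∈-loops⁻ i))) (full q)
    ; ls-apart = loops-apart
    ; ls-cover = cover
    ; F = F
    ; merges = merges
    ; lab-eq = λ s {x} l → trans (rawLab-c' s _) (sym (proj₂ (FS-const s l (reach s))))
    ; len-eq = len-c'
    ; emp-eq = λ s → (λ i → subst (_ ∈_) (emp-c' s) i) , (λ i → subst (_ ∈_) (sym (emp-c' s)) i) }
    where
    reach : ∀ s {x} → Conn gap' (Graph (mS s)) x (rep gap' (mS s) x)
    reach s {x} = rep-conn gap' (mS s)

-- A relation between edge sets and not an operation on them, so that removals in different orders
-- can end in the same predicate.
record Removal {n} (e : Fin n) (E E' : Fin n → Set) : Set where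
  field
    present : E e
    split   : ∀ {j} → E j → j ≡ e ⊎ E' j
    rest    : ∀ {j} → E' j → E j
    absent  : ¬ E' e

-- Operations at an edge as surgeries

kind : Op → Kind
kind del  = kA
kind mdel = kA
kind con  = kB
kind mcon = kB
kind pen  = kC

opM : ∀ {n} → Op → Pt n → Pt n
opM o = kindM (kind o)

mergesBlocks : Side → Op → Bool
mergesBlocks vert del = false
mergesBlocks bdry con = false
mergesBlocks _    _   = true

opM-mS : ∀ {n} s o (x : Pt n) → mergesBlocks s o ≡ true ⊎ opM o x ≡ mS s x
opM-mS vert del  x = inj₂ refl
opM-mS vert mdel x = inj₁ refl
opM-mS vert con  x = inj₁ refl
opM-mS vert mcon x = inj₁ refl
opM-mS vert pen  x = inj₁ refl
opM-mS bdry del  x = inj₁ refl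
opM-mS bdry mdel x = inj₁ refl
opM-mS bdry con  x = inj₂ refl
opM-mS bdry mcon x = inj₁ refl
opM-mS bdry pen  x = inj₁ refl

-- J always joins the ends paired by `mS`, which share a label anyway. This gives `M⊂J` also where
-- blocks are not merged, since the identification is then `mS` itself.
edgeCut : ∀ {n} {E E' : Fin n → Set} (o : Op) (e : Fin n) → Removal e E E' → Cut (On E) (On E')
edgeCut o e r = record
  { D = λ x → edge x ≡ e
  ; M = λ x y → edge x ≡ e × y ≡ opM o x
  ; J = λ s x y → edge x ≡ e × edge y ≡ e × (mergesBlocks s o ≡ true ⊎ y ≡ mS s x)
  ; split = λ { (on l) → [ inj₁ , (λ l' → inj₂ (on l')) ]′ (split l) }
  ; D⊂L = λ { refl → on present }
  ; L'⊂L = λ { (on l) → on (rest l) }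
  ; D∩L' = λ { refl (on l) → absent l }
  ; M-D = λ { {x} (p , refl) → p , trans (edge-kindM (kind o) x) p }
  ; M-sym = λ { {x} (p , refl) → trans (edge-kindM (kind o) x) p , sym (kindM-inv (kind o) x) }
  ; M⊂J = λ { s {x} (p , refl) → p , trans (edge-kindM (kind o) x) p , opM-mS s o x }
  ; J-D = λ { s (p , q , _) → p , q } }
  where open Removal r

edgeCut-⊑ : ∀ {n} {E E' N N' : Fin n → Set} o e {r : Removal e E E'} {r' : Removal e N N'} →
  edgeCut o e r ⊑ edgeCut o e r'
edgeCut-⊑ o e = record { D⊑ = λ d → d ; M⊑ = λ m → m ; J⊑ = λ s j → j }

-- A point of e outside the orbit of `pt e false false` under the matching. For `mA` it marks the
-- second vertex incident with e, for `mB` the second boundary component.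
aside : ∀ {n} → Kind → Fin n → Pt n
aside kA e = pt e true false
aside kB e = pt e false true
aside kC e = pt e false true

edge-aside : ∀ {n} k (e : Fin n) → edge (aside k e) ≡ e
edge-aside kA e = refl
edge-aside kB e = refl
edge-aside kC e = refl

corner : ∀ {n} → Side → Fin n → Pt n
corner s = aside (kindS s)

opF : ∀ {n} {A : Set a} → Op → Core A n → Fin n → Side → ℕ → ℕ
opF o c e s = if mergesBlocks s o then mergeInto (labC c s (pt e false false)) (labC c s (corner s e))
              else (λ l → l)

mergeInto-left : ∀ L L' → mergeInto L L' L ≡ L
mergeInto-left L L' with L ≡ᵇ L'
... | true  = refl
... | false = refl

mergeInto-right : ∀ L L' → mergeInto L L' L' ≡ L
mergeInto-right L L' rewrite ⇒≡ᵇ {L'} refl = refl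

mergeInto-least : ∀ {L L'} (G : ℕ → ℕ) → G L ≡ G L' → ∀ l → G (mergeInto L L' l) ≡ G l
mergeInto-least {L} {L'} G p l with l ≡ᵇ L' in eq
... | true  = trans p (cong G (sym (≡ᵇ⇒ eq)))
... | false = refl

module _ {n} {E : Fin n → Set} (c : Core A n) (wf : GapWF E (Core.gap c)) {e : Fin n} (l : E e) where

  lab-corner : ∀ s x → edge x ≡ e →
    labC c s x ≡ labC c s (pt e false false) ⊎ labC c s x ≡ labC c s (corner s e)
  lab-corner vert (pt e false false) refl = inj₁ refl
  lab-corner vert (pt e false true)  refl = inj₁ (labC-mS c wf vert {pt e false false} (on l))
  lab-corner vert (pt e true false)  refl = inj₂ refl
  lab-corner vert (pt e true true)   refl = inj₂ (labC-mS c wf vert {pt e true false} (on l))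
  lab-corner bdry (pt e false false) refl = inj₁ refl
  lab-corner bdry (pt e false true)  refl = inj₂ refl
  lab-corner bdry (pt e true false)  refl = inj₂ (labC-mS c wf bdry {pt e false true} (on l))
  lab-corner bdry (pt e true true)   refl = inj₁ (labC-mS c wf bdry {pt e false false} (on l))

  opF-merges : ∀ {E'} o (r : Removal e E E') s →
    Merges (labC c s) (Cut.J (edgeCut o e r) s) (opF o c e s)
  opF-merges o r s with mergesBlocks s o in eq
  ... | false = record
    { joins = λ { (p , q , inj₂ refl) → sym (labC-mS c wf s (on (subst E (sym p) l))) }
    ; least = λ G h k → refl }
  ... | true = record
    { joins = λ { (p , q , _) → trans (to-left p) (sym (to-left q)) }
    ; least = λ G h → mergeInto-least G (h (refl , edge-aside (kindS s) e , inj₁ refl)) }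
    where
    La = labC c s (pt e false false)
    Lb = labC c s (corner s e)
    to-left : ∀ {x} → edge x ≡ e → mergeInto La Lb (labC c s x) ≡ La
    to-left {x} p with lab-corner s x p
    ... | inj₁ q = trans (cong (mergeInto La Lb) q) (mergeInto-left La Lb)
    ... | inj₂ q = trans (cong (mergeInto La Lb) q) (mergeInto-right La Lb)

edgeOp-surgery : ∀ {n} {A : Set a} o (c : Core A n) e →
  edgeOp o c e ≡ surgery c (e ∷ []) (opM o) (opF o c e vert) (opF o c e bdry)
edgeOp-surgery del  c e = refl
edgeOp-surgery mdel c e = refl
edgeOp-surgery con  c e = refl
edgeOp-surgery mcon c e = refl
edgeOp-surgery pen  c e = refl

module _ {n} {E E' : Fin n → Set} (o : Op) {e : Fin n} (r : Removal e E E')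
         (c : Core A n) (wf : GapWF E (Core.gap c)) where

  abstract
    edgeOp-Surg : Surg (edgeCut o e r) (abs c) (abs (edgeOp o c e))
    edgeOp-Surg = subst (λ c' → Surg (edgeCut o e r) (abs c) (abs c')) (sym (edgeOp-surgery o c e))
      (Surgery.surg (edgeCut o e r) c wf (e ∷ []) (opM o) (opF o c e) ([] ∷ [])
        (λ { (here p) → p }) here proj₂ (λ d → d , refl)
        (λ { {x} (on l) → on (subst E (sym (edge-kindM (kind o) x)) l) })
        (λ {x} _ → kindM-inv (kind o) x) (λ {x} _ → kindM-≢ (kind o) x)
        (opF-merges c wf (Removal.present r) o r))

  edgeOp-WF : GapWF E' (Core.gap (edgeOp o c e))
  edgeOp-WF = WF-Gap (Surg-WF (edgeCut o e r) (abs-WF c wf) edgeOp-Surg)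

  edgeOp-wt : ∀ j → wt (edgeOp o c e) j ≡ wt c j
  edgeOp-wt j rewrite edgeOp-surgery o c e = refl

record CoreEq {A : Set a} {n} (E : Fin n → Set) (c c' : Core A n) : Set a where
  field
    abs≅ : abs c ≅[ On E ] abs c'
    wt≡  : ∀ {e} → E e → wt c e ≡ wt c' e

edgeOp-cong : ∀ {n} {E E' : Fin n → Set} o {e} (r : Removal e E E') {c c' : Core A n} →
  GapWF E (Core.gap c) → GapWF E (Core.gap c') → CoreEq E c c' →
  CoreEq E' (edgeOp o c e) (edgeOp o c' e)
edgeOp-cong o {e} r {c} {c'} wf wf' q = record
  { abs≅ = Surg-cong (abs-WF c wf) (abs-WF c' wf') i i abs≅
      (edgeOp-Surg o r c wf) (edgeOp-Surg o r c' wf')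
  ; wt≡ = λ {j} l → trans (edgeOp-wt o r c wf j)
      (trans (wt≡ (Removal.rest r l)) (sym (edgeOp-wt o r c' wf' j))) }
  where
  open CoreEq q
  i = edgeCut-⊑ o e {r} {r}

edgeOp-comm : ∀ {n} {E E₁ E₂ E₁' : Fin n → Set} o o' {e e'} (r : Removal e E E₁) (r' : Removal e' E₁ E₂)
  (t' : Removal e' E E₁') (t : Removal e E₁' E₂) (c : Core A n) → GapWF E (Core.gap c) →
  CoreEq E₂ (edgeOp o' (edgeOp o c e) e') (edgeOp o (edgeOp o' c e') e)
edgeOp-comm o o' {e} {e'} r r' t' t c wf = record
  { abs≅ = Surg-cong {K = edgeCut o e r ⨾ edgeCut o' e' r'} {K' = edgeCut o' e' t' ⨾ edgeCut o e t}
      (abs-WF c wf) (abs-WF c wf)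
      (⨾-⊑ (edgeCut-⊑ o e) (edgeCut-⊑ o' e')) (⨾-⊑ (edgeCut-⊑ o' e') (edgeCut-⊑ o e)) ≅-refl
      (Surg-⨾ (abs-WF c wf) (edgeOp-Surg o r c wf) (edgeOp-Surg o' r' _ wf₁))
      (Surg-⨾ (abs-WF c wf) (edgeOp-Surg o' t' c wf) (edgeOp-Surg o t _ wf₂))
  ; wt≡ = λ {j} _ → trans (edgeOp-wt o' r' _ wf₁ j) (trans (edgeOp-wt o r c wf j)
      (sym (trans (edgeOp-wt o t _ wf₂ j) (edgeOp-wt o' t' c wf j)))) }
  where
  wf₁ = edgeOp-WF o r c wf
  wf₂ = edgeOp-WF o' t' c wf

-- Disjoint unions of presentations

-- Kept abstract so that one argument covers surgeries on either summand: `tagsˡ` and `tagsʳ`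
-- exchange the roles of even and odd labels.
record Tags : Set where
  field
    j₁ j₂     : ℕ → ℕ
    untag     : ℕ → ℕ ⊎ ℕ
    untag-j₁  : ∀ l → untag (j₁ l) ≡ inj₁ l
    untag-j₂  : ∀ l → untag (j₂ l) ≡ inj₂ l
    tag-untag : ∀ l → [ j₁ , j₂ ]′ (untag l) ≡ l

  ext : (ℕ → ℕ) → ℕ → ℕ
  ext F l = [ (λ k → j₁ (F k)) , j₂ ]′ (untag l)

  ext-j₁ : ∀ F l → ext F (j₁ l) ≡ j₁ (F l)
  ext-j₁ F l = cong [ (λ k → j₁ (F k)) , j₂ ]′ (untag-j₁ l)

  ext-j₂ : ∀ F l → ext F (j₂ l) ≡ j₂ l
  ext-j₂ F l = cong [ (λ k → j₁ (F k)) , j₂ ]′ (untag-j₂ l)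

module Union {X₁ X₂ Y : Set} (ι : X₁ → Y) (κ : X₂ → Y) (t : Tags)
             (ι-inj : ∀ {x y} → ι x ≡ ι y → x ≡ y) (ι≢κ : ∀ {x y} → ι x ≢ κ y) where
  open Tags t

  record Covers (L₁ : X₁ → Set) (L₂ : X₂ → Set) (L : Y → Set) : Set where
    field
      view : ∀ {y} → L y → (∃ λ x → L₁ x × y ≡ ι x) ⊎ (∃ λ x → L₂ x × y ≡ κ x)
      ι-L  : ∀ {x} → L₁ x → L (ι x)
      κ-L  : ∀ {x} → L₂ x → L (κ x)

    ι-L⁻ : ∀ {x} → L (ι x) → L₁ x
    ι-L⁻ l with view l
    ... | inj₁ (x , l' , p) rewrite ι-inj p = l'
    ... | inj₂ (x , l' , p) = ⊥-elim (ι≢κ p)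

  record IsUnion (L₁ : X₁ → Set) (L₂ : X₂ → Set) (A₁ : Pres X₁) (A₂ : Pres X₂) (B : Pres Y) : Set where
    field
      gap-ι : ∀ {x} → L₁ x → gap B (ι x) ≡ ι (gap A₁ x)
      gap-κ : ∀ {x} → L₂ x → gap B (κ x) ≡ κ (gap A₂ x)
      lab-ι : ∀ s {x} → L₁ x → lab B s (ι x) ≡ j₁ (lab A₁ s x)
      lab-κ : ∀ s {x} → L₂ x → lab B s (κ x) ≡ j₂ (lab A₂ s x)
      len-∪ : len B ≡ len A₁ +ℕ len A₂
      emp-∪ : ∀ s → emp B s ≐ (map j₁ (emp A₁ s) ++ map j₂ (emp A₂ s))

  liftCut : ∀ {L₁ L₁' L₂ L L'} → Covers L₁ L₂ L → Covers L₁' L₂ L' → Cut L₁ L₁' → Cut L L'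
  liftCut {L₂ = L₂} {L} {L'} v v' K = record
    { D = λ y → ∃ λ x → D x × y ≡ ι x
    ; M = λ y z → ∃₂ λ x x' → M x x' × y ≡ ι x × z ≡ ι x'
    ; J = λ s y z → ∃₂ λ x x' → J s x x' × y ≡ ι x × z ≡ ι x'
    ; split = λ l → sp (v.view l)
    ; D⊂L = λ { (x , d , refl) → v.ι-L (D⊂L d) }
    ; L'⊂L = λ l → [ (λ { (x , l' , refl) → v.ι-L (L'⊂L l') })
                   , (λ { (x , l' , refl) → v.κ-L l' }) ]′ (v'.view l)
    ; D∩L' = λ { (x , d , refl) l → D∩L' d (v'.ι-L⁻ l) }
    ; M-D = λ { (x , x' , m , refl , refl) → (x , proj₁ (M-D m) , refl) , (x' , proj₂ (M-D m) , refl) }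
    ; M-sym = λ { (x , x' , m , p , q) → x' , x , M-sym m , q , p }
    ; M⊂J = λ { s (x , x' , m , p , q) → x , x' , M⊂J s m , p , q }
    ; J-D = λ { s (x , x' , j , refl , refl) →
        (x , proj₁ (J-D s j) , refl) , (x' , proj₂ (J-D s j) , refl) } }
    where
    open Cut K
    module v = Covers v
    module v' = Covers v'
    sp : ∀ {y} → (∃ λ x → _ × y ≡ ι x) ⊎ (∃ λ x → L₂ x × y ≡ κ x) → (∃ λ x → D x × y ≡ ι x) ⊎ L' y
    sp (inj₂ (x , l , refl)) = inj₂ (v'.κ-L l)
    sp (inj₁ (x , l , refl)) with split l
    ... | inj₁ d = inj₁ (x , d , refl)
    ... | inj₂ l' = inj₂ (v'.ι-L l')

  module _ {L₁ L₁' : X₁ → Set} {L₂ : X₂ → Set} {L L' : Y → Set}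
           (v : Covers L₁ L₂ L) (v' : Covers L₁' L₂ L') (K : Cut L₁ L₁')
           {A₁ A₁' : Pres X₁} {A₂ : Pres X₂} {B B' : Pres Y}
           (wf₁ : WF L₁ A₁) (wf₂ : WF L₂ A₂)
           (U : IsUnion L₁ L₂ A₁ A₂ B) (U' : IsUnion L₁' L₂ A₁' A₂ B') (S : Surg K A₁ A₁') where
    private
      module U = IsUnion U
      module U' = IsUnion U'
      module v = Covers v
      module v' = Covers v'
      module K = Cut K
      module S = Surg S
      K' = liftCut v v' K
      module K' = Cut K'
      C₁ = Conn (gap A₁) K.M
      C = Conn (gap B) K'.M

      fore : ∀ {x y} → L₁ x → C₁ x y → C (ι x) (ι y)
      fore l here = here
      fore l (gapᶜ q) = subst (C _) (U.gap-ι (Conn-L K wf₁ l q)) (gapᶜ (fore l q))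
      fore l (stepᶜ q m) = stepᶜ (fore l q) (_ , _ , m , refl , refl)

      back : ∀ {x z} → L₁ x → C (ι x) z → ∃ λ y → C₁ x y × z ≡ ι y
      back l here = _ , here , refl
      back l (gapᶜ q) with back l q
      ... | y , c , refl = _ , gapᶜ c , U.gap-ι (Conn-L K wf₁ l c)
      back l (stepᶜ q (x , x' , m , p , refl)) with back l q
      ... | y , c , r with refl ← ι-inj (trans (sym r) p) = x' , stepᶜ c m , refl

      back-ι : ∀ {x y} → L₁ x → C (ι x) (ι y) → C₁ x y
      back-ι l q with back l q
      ... | y , c , p with refl ← ι-inj p = c

      -- No identification touches the passive summand, so a path there can only go back and forth
      -- along one gap.
      backκ : ∀ {x z} → L₂ x → C (κ x) z → z ≡ κ x ⊎ z ≡ κ (gap A₂ x)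
      backκ l here = inj₁ refl
      backκ l (gapᶜ q) with backκ l q
      ... | inj₁ refl = inj₂ (U.gap-κ l)
      ... | inj₂ refl = inj₁ (trans (U.gap-κ (WF.gap-L wf₂ l)) (cong κ (WF.gap-inv wf₂ l)))
      backκ l (stepᶜ q (x , x' , m , p , refl)) with backκ l q
      ... | inj₁ refl = ⊥-elim (ι≢κ (sym p))
      ... | inj₂ refl = ⊥-elim (ι≢κ (sym p))

      F : Side → ℕ → ℕ
      F s = ext (S.F s)

      gl : ∀ {y} → L' y → L' (gap B' y)
      gl l with v'.view l
      ... | inj₁ (x , l' , refl) = subst L' (sym (U'.gap-ι l')) (v'.ι-L (S.gap-live l'))
      ... | inj₂ (x , l' , refl) = subst L' (sym (U'.gap-κ l')) (v'.κ-L (WF.gap-L wf₂ l'))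

      gc : ∀ {y} → L' y → C y (gap B' y)
      gc l with v'.view l
      ... | inj₁ (x , l' , refl) = subst (C _) (sym (U'.gap-ι l')) (fore (K.L'⊂L l') (S.gap-conn l'))
      ... | inj₂ (x , l' , refl) = subst (C _) (trans (U.gap-κ l') (sym (U'.gap-κ l'))) (gapᶜ here)

      gn : (∀ {x y} → κ x ≡ κ y → x ≡ y) → ∀ {y} → L' y → gap B' y ≢ y
      gn κ-inj l p with v'.view l
      ... | inj₁ (x , l' , refl) = S.gap-≢ l' (ι-inj (trans (sym (U'.gap-ι l')) p))
      ... | inj₂ (x , l' , refl) = WF.gap-≢ wf₂ l' (κ-inj (trans (sym (U'.gap-κ l')) p))

      te : ∀ {y z} → L' y → L' z → C y z → z ≡ y ⊎ z ≡ gap B' y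
      te l lz q with v'.view l
      ... | inj₂ (x , l' , refl) with backκ l' q
      ... | inj₁ p = inj₁ p
      ... | inj₂ p = inj₂ (trans p (sym (U'.gap-κ l')))
      te l lz q | inj₁ (x , l' , refl) with back (K.L'⊂L l') q
      ... | y , c , refl with S.two-ends l' (v'.ι-L⁻ lz) c
      ... | inj₁ p = inj₁ (cong ι p)
      ... | inj₂ p = inj₂ (trans (cong ι p) (sym (U'.gap-ι l')))

      cover : ∀ {y} → K'.D y → Any (C y) (map ι S.ls) ⊎ ∃ λ z → L' z × C y z
      cover (x , d , refl) with S.ls-cover d
      ... | inj₁ i = inj₁ (Any.map⁺ (Any.map (fore (K.D⊂L d)) i))
      ... | inj₂ (y , l , c) = inj₂ (ι y , v'.ι-L l , fore (K.D⊂L d) c)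

      apart : ∀ {xs} → All K.D xs → AllPairs (λ x y → ¬ C₁ x y) xs →
        AllPairs (λ x y → ¬ C (ι x) (ι y)) xs
      apart [] [] = []
      apart (d ∷ ds) (n ∷ ns) = All.map (λ n c → n (back-ι (K.D⊂L d) c)) n ∷ apart ds ns

      mg : ∀ s → Merges (lab B s) (K'.J s) (F s)
      mg s = record
        { joins = λ { (x , x' , j , refl , refl) → trans (at (proj₁ (K.J-D s j)))
            (trans (cong j₁ (Merges.joins (S.merges s) j)) (sym (at (proj₂ (K.J-D s j))))) }
        ; least = least }
        where
        at : ∀ {x} → K.D x → F s (lab B s (ι x)) ≡ j₁ (S.F s (lab A₁ s x))
        at d = trans (cong (F s) (U.lab-ι s (K.D⊂L d))) (ext-j₁ (S.F s) _)
        least : (G : ℕ → ℕ) → (∀ {y z} → K'.J s y z → G (lab B s y) ≡ G (lab B s z)) →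
          ∀ l → G (F s l) ≡ G l
        least G h l with untag l | tag-untag l
        ... | inj₂ k | p = cong G p
        ... | inj₁ k | p = trans (Merges.least (S.merges s) (λ l → G (j₁ l)) (λ {x} {x'} j →
            trans (cong G (sym (U.lab-ι s (K.D⊂L (proj₁ (K.J-D s j))))))
              (trans (h (x , x' , j , refl , refl))
                (cong G (U.lab-ι s (K.D⊂L (proj₂ (K.J-D s j))))))) k) (cong G p)

      le : ∀ s {y} → L' y → lab B' s y ≡ F s (lab B s y)
      le s l with v'.view l
      ... | inj₁ (x , l' , refl) = trans (U'.lab-ι s l') (trans (cong j₁ (S.lab-eq s l'))
              (sym (trans (cong (F s) (U.lab-ι s (K.L'⊂L l'))) (ext-j₁ (S.F s) _))))
      ... | inj₂ (x , l' , refl) = trans (U'.lab-κ s l')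
              (sym (trans (cong (F s) (U.lab-κ s l')) (ext-j₂ (S.F s) _)))

      lab-ls : ∀ s {x} → x ∈ S.ls → F s (lab B s (ι x)) ≡ j₁ (S.F s (lab A₁ s x))
      lab-ls s x∈ = trans (cong (F s) (U.lab-ι s (K.D⊂L (All.lookup S.ls-D x∈)))) (ext-j₁ (S.F s) _)

      into : ∀ s {w} → w ∈ emp B s ⊎ w ∈ map (lab B s) (map ι S.ls) →
        F s w ∈ map (F s) (emp B s ++ map (lab B s) (map ι S.ls))
      into s (inj₁ i) = ∈-map⁺ (F s) (∈-++⁺ˡ i)
      into s (inj₂ i) = ∈-map⁺ (F s) (∈-++⁺ʳ (emp B s) i)

      e→ : ∀ s {z} → z ∈ emp B' s → z ∈ map (F s) (emp B s ++ map (lab B s) (map ι S.ls))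
      e→ s z∈ with ∈-++⁻ (map j₁ (emp A₁' s)) (proj₁ (U'.emp-∪ s) z∈)
      ... | inj₂ i with ∈-map⁻ j₂ i
      ... | w , w∈ , refl = ∈-resp (ext-j₂ (S.F s) w) (into s (inj₁
              (proj₂ (U.emp-∪ s) (∈-++⁺ʳ (map j₁ (emp A₁ s)) (∈-map⁺ j₂ w∈)))))
      e→ s z∈ | inj₁ i with ∈-map⁻ j₁ i
      ... | w , w∈ , refl with ∈-map⁻ (S.F s) (proj₁ (S.emp-eq s) w∈)
      ... | u , u∈ , refl with ∈-++⁻ (emp A₁ s) u∈
      ... | inj₁ k = ∈-resp (ext-j₁ (S.F s) u)
              (into s (inj₁ (proj₂ (U.emp-∪ s) (∈-++⁺ˡ (∈-map⁺ j₁ k)))))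
      ... | inj₂ k with ∈-map⁻ (lab A₁ s) k
      ... | x , x∈ , refl = ∈-resp (lab-ls s x∈) (into s (inj₂ (∈-map⁺ (lab B s) (∈-map⁺ ι x∈))))

      e← : ∀ s {z} → z ∈ map (F s) (emp B s ++ map (lab B s) (map ι S.ls)) → z ∈ emp B' s
      e← s z∈ with ∈-map⁻ (F s) z∈
      ... | w , w∈ , refl with ∈-++⁻ (emp B s) w∈
      ... | inj₂ i with ∈-map⁻ (lab B s) i
      ... | y , y∈ , refl with ∈-map⁻ ι y∈
      ... | x , x∈ , refl = ∈-resp (sym (lab-ls s x∈)) (proj₂ (U'.emp-∪ s) (∈-++⁺ˡ (∈-map⁺ j₁
              (proj₂ (S.emp-eq s) (∈-map⁺ (S.F s) (∈-++⁺ʳ (emp A₁ s) (∈-map⁺ (lab A₁ s) x∈)))))))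
      e← s z∈ | w , w∈ , refl | inj₁ i with ∈-++⁻ (map j₁ (emp A₁ s)) (proj₁ (U.emp-∪ s) i)
      ... | inj₁ k with ∈-map⁻ j₁ k
      ... | u , u∈ , refl = ∈-resp (sym (ext-j₁ (S.F s) u)) (proj₂ (U'.emp-∪ s) (∈-++⁺ˡ (∈-map⁺ j₁
              (proj₂ (S.emp-eq s) (∈-map⁺ (S.F s) (∈-++⁺ˡ u∈))))))
      e← s z∈ | w , w∈ , refl | inj₁ i | inj₂ k with ∈-map⁻ j₂ k
      ... | u , u∈ , refl = ∈-resp (sym (ext-j₂ (S.F s) u))
              (proj₂ (U'.emp-∪ s) (∈-++⁺ʳ (map j₁ (emp A₁' s)) (∈-map⁺ j₂ u∈)))

    Surg-lift : (∀ {x y} → κ x ≡ κ y → x ≡ y) → Surg (liftCut v v' K) B B'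
    Surg-lift κ-inj = record
      { ls = map ι S.ls
      ; gap-live = gl
      ; gap-conn = gc
      ; gap-≢ = gn κ-inj
      ; two-ends = te
      ; ls-D = All.map⁺ (All.map (λ d → _ , d , refl) S.ls-D)
      ; ls-closed = All.map⁺ (All.zipWith (λ { (d , h) z q →
          let y , c , p = back (K.D⊂L d) q in y , h y c , p }) (S.ls-D , S.ls-closed))
      ; ls-apart = AllPairs.map⁺ (apart S.ls-D S.ls-apart)
      ; ls-cover = cover
      ; F = F
      ; merges = mg
      ; lab-eq = le
      ; len-eq = trans U'.len-∪ (trans (cong (_+ℕ len A₂) S.len-eq) (trans
          (trans (ℕ.+-assoc (len A₁) _ _) (trans (cong (len A₁ +ℕ_) (ℕ.+-comm (length S.ls) (len A₂)))
            (sym (ℕ.+-assoc (len A₁) _ _))))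
          (sym (cong₂ _+ℕ_ U.len-∪ (length-map ι S.ls)))))
      ; emp-eq = λ s → e→ s , e← s }

open PAP

-- The concrete union

even odd : ℕ → ℕ
even l = 2 *ℕ l
odd l = suc (2 *ℕ l)

parity : ℕ → ℕ ⊎ ℕ
parity zero          = inj₁ 0
parity (suc zero)    = inj₂ 0
parity (suc (suc l)) = [ (λ k → inj₁ (suc k)) , (λ k → inj₂ (suc k)) ]′ (parity l)

even-suc : ∀ l → even (suc l) ≡ suc (suc (even l))
even-suc l = cong suc (ℕ.+-suc l (l +ℕ 0))

parity-even : ∀ l → parity (even l) ≡ inj₁ l
parity-even zero = refl
parity-even (suc l) rewrite even-suc l | parity-even l = refl

parity-odd : ∀ l → parity (odd l) ≡ inj₂ l
parity-odd zero = refl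
parity-odd (suc l) = trans (cong (parity ∘ suc) (even-suc l))
  (cong [ (λ k → inj₁ (suc k)) , (λ k → inj₂ (suc k)) ]′ (parity-odd l))

unparity : ∀ l → [ even , odd ]′ (parity l) ≡ l
unparity zero = refl
unparity (suc zero) = refl
unparity (suc (suc l)) with parity l | unparity l
... | inj₁ k | p = trans (even-suc k) (cong (suc ∘ suc) p)
... | inj₂ k | p = cong suc (trans (even-suc k) (cong suc p))

tagsˡ tagsʳ : Tags
tagsˡ = record { j₁ = even ; j₂ = odd ; untag = parity
  ; untag-j₁ = parity-even ; untag-j₂ = parity-odd ; tag-untag = unparity }
tagsʳ = record { j₁ = odd ; j₂ = even ; untag = λ l → swap (parity l)
  ; untag-j₁ = λ l → cong swap (parity-odd l) ; untag-j₂ = λ l → cong swap (parity-even l)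
  ; tag-untag = λ l → trans (flip (parity l)) (unparity l) }
  where
  flip : ∀ (z : ℕ ⊎ ℕ) → [ odd , even ]′ (swap z) ≡ [ even , odd ]′ z
  flip (inj₁ _) = refl
  flip (inj₂ _) = refl

along : ∀ {n m} → (Fin n → Fin m) → Pt n → Pt m
along j (pt e x h) = pt (j e) x h

along-injective : ∀ {n m} (j : Fin n → Fin m) → (∀ {i i'} → j i ≡ j i' → i ≡ i') →
  ∀ {x y} → along j x ≡ along j y → x ≡ y
along-injective j inj p = unpt (inj (cong edge p)) (cong arr p) (cong hd p)
  where
  unpt : ∀ {n} {x y : Pt n} → edge x ≡ edge y → arr x ≡ arr y → hd x ≡ hd y → x ≡ y
  unpt refl refl refl = refl

kindM-along : ∀ {n m} (j : Fin n → Fin m) k x → kindM k (along j x) ≡ along j (kindM k x)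
kindM-along j kA x = refl
kindM-along j kB x = refl
kindM-along j kC x = refl

inL : ∀ {n₁} n₂ → Pt n₁ → Pt (n₁ +ℕ n₂)
inL n₂ = along (_↑ˡ n₂)

inR : ∀ n₁ {n₂} → Pt n₂ → Pt (n₁ +ℕ n₂)
inR n₁ = along (n₁ ↑ʳ_)

data _⊕_ {n₁ n₂} (E₁ : Fin n₁ → Set) (E₂ : Fin n₂ → Set) : Fin (n₁ +ℕ n₂) → Set where
  inˡ : ∀ {i} → E₁ i → (E₁ ⊕ E₂) (i ↑ˡ n₂)
  inʳ : ∀ {i} → E₂ i → (E₁ ⊕ E₂) (n₁ ↑ʳ i)

↑ˡ≢↑ʳ : ∀ {m} n (i : Fin m) (j : Fin n) → i ↑ˡ n ≢ m ↑ʳ j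
↑ˡ≢↑ʳ {m} n i j p with () ← trans (sym (Fin.splitAt-↑ˡ m i n)) (trans (cong (splitAt m) p) (Fin.splitAt-↑ʳ m n j))

inL-injective : ∀ {n₁} n₂ {x y : Pt n₁} → inL n₂ x ≡ inL n₂ y → x ≡ y
inL-injective n₂ = along-injective (_↑ˡ n₂) (Fin.↑ˡ-injective n₂ _ _)

inR-injective : ∀ n₁ {n₂} {x y : Pt n₂} → inR n₁ x ≡ inR n₁ y → x ≡ y
inR-injective n₁ = along-injective (n₁ ↑ʳ_) (Fin.↑ʳ-injective n₁ _ _)

inL≢inR : ∀ {n₁ n₂} {x : Pt n₁} {y : Pt n₂} → inL n₂ x ≢ inR n₁ y
inL≢inR p = ↑ˡ≢↑ʳ _ _ _ (cong edge p)

idx-inL : ∀ {n₁} n₂ (x : Pt n₁) → idx (inL n₂ x) ≡ idx x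
idx-inL n₂ (pt e x h) rewrite Fin.toℕ-↑ˡ e n₂ = refl

idx-inR : ∀ n₁ {n₂} (x : Pt n₂) → idx (inR n₁ x) ≡ 4 *ℕ n₁ +ℕ idx x
idx-inR n₁ (pt e x h) = trans (cong (λ k → 4 *ℕ k +ℕ 2 *ℕ b2n x +ℕ b2n h) (Fin.toℕ-↑ʳ n₁ e))
  (trans (cong (λ k → k +ℕ 2 *ℕ b2n x +ℕ b2n h) (ℕ.*-distribˡ-+ 4 n₁ (toℕ e)))
  (trans (cong (_+ℕ b2n h) (ℕ.+-assoc (4 *ℕ n₁) _ _)) (ℕ.+-assoc (4 *ℕ n₁) _ _)))

⊕-view : ∀ {n₁ n₂} {E₁ : Fin n₁ → Set} {E₂ : Fin n₂ → Set} {y} → On (E₁ ⊕ E₂) y →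
  (∃ λ x → On E₁ x × y ≡ inL n₂ x) ⊎ (∃ λ x → On E₂ x × y ≡ inR n₁ x)
⊕-view {n₁} {n₂} {y = pt e x h} (on l) = go l
  where
  go : ∀ {E₁ : Fin n₁ → Set} {E₂ : Fin n₂ → Set} {e} → (E₁ ⊕ E₂) e →
    (∃ λ z → On E₁ z × pt e x h ≡ inL n₂ z) ⊎ (∃ λ z → On E₂ z × pt e x h ≡ inR n₁ z)
  go (inˡ l) = inj₁ (pt _ x h , on l , refl)
  go (inʳ l) = inj₂ (pt _ x h , on l , refl)

module UnionL n₁ n₂ =
  Union {Pt n₁} {Pt n₂} {Pt (n₁ +ℕ n₂)} (inL n₂) (inR n₁) tagsˡ (inL-injective n₂) inL≢inR
module UnionR n₁ n₂ =
  Union {Pt n₂} {Pt n₁} {Pt (n₁ +ℕ n₂)} (inR n₁) (inL n₂) tagsʳ (inR-injective n₁) (λ p → inL≢inR (sym p))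

coversL : ∀ {n₁ n₂} {E₁ : Fin n₁ → Set} {E₂ : Fin n₂ → Set} →
  UnionL.Covers n₁ n₂ (On E₁) (On E₂) (On (E₁ ⊕ E₂))
coversL = record { view = ⊕-view ; ι-L = λ { (on l) → on (inˡ l) } ; κ-L = λ { (on l) → on (inʳ l) } }

coversR : ∀ {n₁ n₂} {E₁ : Fin n₁ → Set} {E₂ : Fin n₂ → Set} →
  UnionR.Covers n₁ n₂ (On E₂) (On E₁) (On (E₁ ⊕ E₂))
coversR = record { view = λ l → swap (⊕-view l)
                 ; ι-L = λ { (on l) → on (inʳ l) } ; κ-L = λ { (on l) → on (inˡ l) } }

module _ {n m} (j : Fin n → Fin m) {g : Pt n → Pt n} {g' : Pt m → Pt m}
         (gap-j : ∀ x → g' (along j x) ≡ along j (g x)) (k : Kind) where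

  Conn-along : ∀ {x y} → Conn g (Graph (kindM k)) x y → Conn g' (Graph (kindM k)) (along j x) (along j y)
  Conn-along here = here
  Conn-along (gapᶜ {y} q) = subst (Conn g' _ _) (gap-j y) (gapᶜ (Conn-along q))
  Conn-along (stepᶜ {y} q refl) = stepᶜ (Conn-along q) (sym (kindM-along j k y))

  Conn-along⁻ : ∀ {x z} → Conn g' (Graph (kindM k)) (along j x) z →
    ∃ λ y → Conn g (Graph (kindM k)) x y × z ≡ along j y
  Conn-along⁻ here = _ , here , refl
  Conn-along⁻ (gapᶜ q) with Conn-along⁻ q
  ... | y , r , refl = _ , gapᶜ r , gap-j y
  Conn-along⁻ (stepᶜ q refl) with Conn-along⁻ q
  ... | y , r , refl = _ , stepᶜ r refl , kindM-along j k y

-- An embedding that preserves gaps, matchings and the order of `idx` carries components onto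
-- components and least points, where labels are read, to least points.
labC-along : ∀ {n m} (j : Fin n → Fin m) {E : Fin n → Set} {E' : Fin m → Set}
  {c : Core A n} {c' : Core A m} (wf : GapWF E (Core.gap c)) (wf' : GapWF E' (Core.gap c')) →
  (∀ x → Core.gap c' (along j x) ≡ along j (Core.gap c x)) →
  (∀ {x y} → idx x ≤ idx y → idx (along j x) ≤ idx (along j y)) →
  (tag : ℕ → ℕ) → ∀ s → (∀ x → rawLab c' s (along j x) ≡ tag (rawLab c s x)) →
  ∀ {x} → On E x → On E' (along j x) → labC c' s (along j x) ≡ tag (labC c s x)
labC-along j {c = c} {c'} wf wf' gap-j mono tag s raw {x} l l' = trans (cong (rawLab c' s)
  (Circle.rep-unique c' wf' s l' (Conn-along j gap-j (kindS s) (rep-conn (Core.gap c) (mS s))) least))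
  (raw (rep (Core.gap c) (mS s) x))
  where
  least : ∀ {y} → Conn (Core.gap c') (Graph (mS s)) (along j x) y →
    idx (along j (rep (Core.gap c) (mS s) x)) ≤ idx y
  least q with Conn-along⁻ j gap-j (kindS s) q
  ... | y , r , refl = mono {rep (Core.gap c) (mS s) x} {y} (Circle.rep-min c wf s l r)

module _ {A : Set a} (P H : PAP A) where
  private
    n₁ = n P
    n₂ = n H
    c₁ = core P
    c₂ = core H
    c = core (union P H)

  gap-inL : ∀ x → Core.gap c (inL n₂ x) ≡ inL n₂ (Core.gap c₁ x)
  gap-inL (pt e x h) rewrite Fin.splitAt-↑ˡ n₁ e n₂ = refl

  gap-inR : ∀ x → Core.gap c (inR n₁ x) ≡ inR n₁ (Core.gap c₂ x)
  gap-inR (pt e x h) rewrite Fin.splitAt-↑ʳ n₁ n₂ e = refl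

  rawLab-inL : ∀ s x → rawLab c s (inL n₂ x) ≡ even (rawLab c₁ s x)
  rawLab-inL vert (pt e x h) rewrite Fin.splitAt-↑ˡ n₁ e n₂ = refl
  rawLab-inL bdry (pt e x h) rewrite Fin.splitAt-↑ˡ n₁ e n₂ = refl

  rawLab-inR : ∀ s x → rawLab c s (inR n₁ x) ≡ odd (rawLab c₂ s x)
  rawLab-inR vert (pt e x h) rewrite Fin.splitAt-↑ʳ n₁ n₂ e = refl
  rawLab-inR bdry (pt e x h) rewrite Fin.splitAt-↑ʳ n₁ n₂ e = refl

  wt-inL : ∀ e → wt c (e ↑ˡ n₂) ≡ wt c₁ e
  wt-inL e rewrite Fin.splitAt-↑ˡ n₁ e n₂ = refl

  wt-inR : ∀ e → wt c (n₁ ↑ʳ e) ≡ wt c₂ e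
  wt-inR e rewrite Fin.splitAt-↑ʳ n₁ n₂ e = refl

  module _ {E₁ : Fin n₁ → Set} {E₂ : Fin n₂ → Set}
           (wf₁ : GapWF E₁ (Core.gap c₁)) (wf₂ : GapWF E₂ (Core.gap c₂)) where
    private
      module w₁ = GapWF wf₁
      module w₂ = GapWF wf₂

    union-WF : GapWF (E₁ ⊕ E₂) (Core.gap c)
    union-WF = record { gap-L = gl ; gap-inv = gi ; gap-≢ = gn }
      where
      onL : ∀ {x} → On E₁ x → On (E₁ ⊕ E₂) (inL n₂ x)
      onL (on l) = on (inˡ l)
      onR : ∀ {x} → On E₂ x → On (E₁ ⊕ E₂) (inR n₁ x)
      onR (on l) = on (inʳ l)
      gl : ∀ {y} → On (E₁ ⊕ E₂) y → On (E₁ ⊕ E₂) (Core.gap c y)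
      gl l with ⊕-view l
      ... | inj₁ (x , l' , refl) = subst (On (E₁ ⊕ E₂)) (sym (gap-inL x)) (onL (w₁.gap-L l'))
      ... | inj₂ (x , l' , refl) = subst (On (E₁ ⊕ E₂)) (sym (gap-inR x)) (onR (w₂.gap-L l'))
      gi : ∀ {y} → On (E₁ ⊕ E₂) y → Core.gap c (Core.gap c y) ≡ y
      gi l with ⊕-view l
      ... | inj₁ (x , l' , refl) = trans (cong (Core.gap c) (gap-inL x))
              (trans (gap-inL _) (cong (inL n₂) (w₁.gap-inv l')))
      ... | inj₂ (x , l' , refl) = trans (cong (Core.gap c) (gap-inR x))
              (trans (gap-inR _) (cong (inR n₁) (w₂.gap-inv l')))
      gn : ∀ {y} → On (E₁ ⊕ E₂) y → Core.gap c y ≢ y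
      gn l p with ⊕-view l
      ... | inj₁ (x , l' , refl) = w₁.gap-≢ l' (inL-injective n₂ (trans (sym (gap-inL x)) p))
      ... | inj₂ (x , l' , refl) = w₂.gap-≢ l' (inR-injective n₁ (trans (sym (gap-inR x)) p))

    module _ (s : Side) where

      labC-inL : ∀ {x} → On E₁ x → labC c s (inL n₂ x) ≡ even (labC c₁ s x)
      labC-inL (on l) = labC-along (_↑ˡ n₂) {c = c₁} {c} wf₁ union-WF gap-inL
        (λ {x} {y} → subst₂ _≤_ (sym (idx-inL n₂ x)) (sym (idx-inL n₂ y)))
        even s (rawLab-inL s) (on l) (on (inˡ l))

      labC-inR : ∀ {x} → On E₂ x → labC c s (inR n₁ x) ≡ odd (labC c₂ s x)
      labC-inR (on l) = labC-along (n₁ ↑ʳ_) {c = c₂} {c} wf₂ union-WF gap-inR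
        (λ {x} {y} p → subst₂ _≤_ (sym (idx-inR n₁ x)) (sym (idx-inR n₁ y)) (ℕ.+-monoʳ-≤ (4 *ℕ n₁) p))
        odd s (rawLab-inR s) (on l) (on (inʳ l))

    len-union : length (empties c) ≡ length (empties c₁) +ℕ length (empties c₂)
    len-union = trans (length-++ (map _ (empties c₁)))
      (cong₂ _+ℕ_ (length-map _ (empties c₁)) (length-map _ (empties c₂)))

    emp-union : ∀ s → emp (abs c) s ≡ map even (emp (abs c₁) s) ++ map odd (emp (abs c₂) s)
    emp-union vert = trans (map-++ proj₁ (map _ (empties c₁)) _) (cong₂ _++_
      (trans (sym (map-∘ (empties c₁))) (map-∘ (empties c₁)))
      (trans (sym (map-∘ (empties c₂))) (map-∘ (empties c₂))))
    emp-union bdry = trans (map-++ proj₂ (map _ (empties c₁)) _) (cong₂ _++_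
      (trans (sym (map-∘ (empties c₁))) (map-∘ (empties c₁)))
      (trans (sym (map-∘ (empties c₂))) (map-∘ (empties c₂))))

    isUnionL : UnionL.IsUnion n₁ n₂ (On E₁) (On E₂) (abs c₁) (abs c₂) (abs c)
    isUnionL = record
      { gap-ι = λ {x} _ → gap-inL x ; gap-κ = λ {x} _ → gap-inR x
      ; lab-ι = λ s → labC-inL s ; lab-κ = λ s → labC-inR s
      ; len-∪ = len-union
      ; emp-∪ = λ s → (λ i → subst (_ ∈_) (emp-union s) i) , (λ i → subst (_ ∈_) (sym (emp-union s)) i) }

    isUnionR : UnionR.IsUnion n₁ n₂ (On E₂) (On E₁) (abs c₂) (abs c₁) (abs c)
    isUnionR = record
      { gap-ι = λ {x} _ → gap-inR x ; gap-κ = λ {x} _ → gap-inL x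
      ; lab-ι = λ s → labC-inR s ; lab-κ = λ s → labC-inL s
      ; len-∪ = trans len-union (ℕ.+-comm (length (empties c₁)) _)
      ; emp-∪ = λ s → (λ i → flip (map even (emp (abs c₁) s)) (subst (_ ∈_) (emp-union s) i))
                    , (λ i → subst (_ ∈_) (sym (emp-union s)) (flip (map odd (emp (abs c₂) s)) i)) }
      where
      flip : ∀ {z : ℕ} xs {ys} → z ∈ xs ++ ys → z ∈ ys ++ xs
      flip xs {ys} i = [ ∈-++⁺ʳ ys , ∈-++⁺ˡ ]′ (∈-++⁻ xs i)

-- Block merging in 2-sums

if-true : ∀ {b} {x y : ℕ} → b ≡ true → (if b then x else y) ≡ x
if-true refl = refl

if-false : ∀ {b} {x y : ℕ} → b ≡ false → (if b then x else y) ≡ y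
if-false refl = refl

∨-split : ∀ {b c} → b ∨ c ≡ true → b ≡ true ⊎ c ≡ true
∨-split {true}  p = inj₁ refl
∨-split {false} p = inj₂ p

∨-left : ∀ {b c} → b ≡ true → b ∨ c ≡ true
∨-left refl = refl

∨-right : ∀ b {c} → c ≡ true → b ∨ c ≡ true
∨-right b refl = ∨-zeroʳ b

module _ (A : Set a) (L₁ L₁' L₂ L₂' : ℕ) where
  private
    meets : Bool
    meets = (L₁ ≡ᵇ L₂) ∨ (L₁' ≡ᵇ L₂) ∨ (L₁ ≡ᵇ L₂') ∨ (L₁' ≡ᵇ L₂')

    meet : L₁ ≡ L₂ ⊎ L₁' ≡ L₂ ⊎ L₁ ≡ L₂' ⊎ L₁' ≡ L₂' → meets ≡ true
    meet (inj₁ p) = ∨-left (⇒≡ᵇ p)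
    meet (inj₂ (inj₁ p)) = ∨-right (L₁ ≡ᵇ L₂) (∨-left (⇒≡ᵇ p))
    meet (inj₂ (inj₂ (inj₁ p))) = ∨-right (L₁ ≡ᵇ L₂) (∨-right (L₁' ≡ᵇ L₂) (∨-left (⇒≡ᵇ p)))
    meet (inj₂ (inj₂ (inj₂ p))) =
      ∨-right (L₁ ≡ᵇ L₂) (∨-right (L₁' ≡ᵇ L₂) (∨-right (L₁ ≡ᵇ L₂') (⇒≡ᵇ p)))

    member₂ : ∀ {l x y} → (l ≡ᵇ x) ∨ (l ≡ᵇ y) ≡ true → l ≡ x ⊎ l ≡ y
    member₂ h = [ (λ p → inj₁ (≡ᵇ⇒ p)) , (λ p → inj₂ (≡ᵇ⇒ p)) ]′ (∨-split h)

  module _ (G : ℕ → ℕ) (p : G L₁ ≡ G L₁') (q : G L₂ ≡ G L₂') where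
    private
      -- Overlapping pairs fall into one class: each of the four possible coincidences links a label
      -- of the first pair to one of the second.
      bridge : meets ≡ true → G L₁ ≡ G L₂
      bridge h with ∨-split {L₁ ≡ᵇ L₂} h
      ... | inj₁ r = cong G (≡ᵇ⇒ r)
      ... | inj₂ h with ∨-split {L₁' ≡ᵇ L₂} h
      ... | inj₁ r = trans p (cong G (≡ᵇ⇒ r))
      ... | inj₂ h with ∨-split {L₁ ≡ᵇ L₂'} h
      ... | inj₁ r = trans (cong G (≡ᵇ⇒ r)) (sym q)
      ... | inj₂ r = trans p (trans (cong G (≡ᵇ⇒ r)) (sym q))

    merge2-least : ∀ l → G (merge2 {A = A} L₁ L₁' L₂ L₂' l) ≡ G l
    merge2-least l with meets in eq
    merge2-least l | true with (l ≡ᵇ L₁) ∨ (l ≡ᵇ L₁') ∨ (l ≡ᵇ L₂) ∨ (l ≡ᵇ L₂') in eq'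
    ... | false = refl
    ... | true with ∨-split {l ≡ᵇ L₁} eq'
    ... | inj₁ r = cong G (sym (≡ᵇ⇒ r))
    ... | inj₂ h with ∨-split {l ≡ᵇ L₁'} h
    ... | inj₁ r = trans p (cong G (sym (≡ᵇ⇒ r)))
    ... | inj₂ h with member₂ {l} h
    ... | inj₁ r = trans (bridge eq) (cong G (sym r))
    ... | inj₂ r = trans (bridge eq) (trans q (cong G (sym r)))
    merge2-least l | false with (l ≡ᵇ L₁) ∨ (l ≡ᵇ L₁') in eq'
    ... | true = [ (λ r → cong G (sym r)) , (λ r → trans p (cong G (sym r))) ]′ (member₂ {l} eq')
    ... | false with (l ≡ᵇ L₂) ∨ (l ≡ᵇ L₂') in eq''
    ... | true = [ (λ r → cong G (sym r)) , (λ r → trans q (cong G (sym r))) ]′ (member₂ {l} eq'')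
    ... | false = refl

  private
    M : ℕ → ℕ
    M = merge2 {A = A} L₁ L₁' L₂ L₂'

  merge2-left : M L₁ ≡ M L₁'
  merge2-left with meets
  ... | true = trans (if-true (∨-left (⇒≡ᵇ {L₁} refl)))
          (sym (if-true (∨-right (L₁' ≡ᵇ L₁) (∨-left (⇒≡ᵇ {L₁'} refl)))))
  ... | false = trans (if-true (∨-left (⇒≡ᵇ {L₁} refl)))
          (sym (if-true (∨-right (L₁' ≡ᵇ L₁) (⇒≡ᵇ {L₁'} refl))))

  merge2-right : M L₂ ≡ M L₂'
  merge2-right with meets in eq
  ... | true = trans (if-true (∨-right (L₂ ≡ᵇ L₁) (∨-right (L₂ ≡ᵇ L₁') (∨-left (⇒≡ᵇ {L₂} refl)))))
          (sym (if-true (∨-right (L₂' ≡ᵇ L₁) (∨-right (L₂' ≡ᵇ L₁')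
            (∨-right (L₂' ≡ᵇ L₂) (⇒≡ᵇ {L₂'} refl))))))
  ... | false = trans (if-false (away (λ { (inj₁ r) → inj₁ (sym r) ; (inj₂ r) → inj₂ (inj₁ (sym r)) })))
          (trans (if-true (∨-left (⇒≡ᵇ {L₂} refl)))
          (sym (trans (if-false (away (λ { (inj₁ r) → inj₂ (inj₂ (inj₁ (sym r)))
                                         ; (inj₂ r) → inj₂ (inj₂ (inj₂ (sym r))) })))
            (if-true (∨-right (L₂' ≡ᵇ L₂) (⇒≡ᵇ {L₂'} refl))))))
    where
    -- In this branch the pairs do not meet, so a label of the second pair falls through the test
    -- for the first.
    away : ∀ {l} → (l ≡ L₁ ⊎ l ≡ L₁' → L₁ ≡ L₂ ⊎ L₁' ≡ L₂ ⊎ L₁ ≡ L₂' ⊎ L₁' ≡ L₂') →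
      (l ≡ᵇ L₁) ∨ (l ≡ᵇ L₁') ≡ false
    away {l} h with (l ≡ᵇ L₁) ∨ (l ≡ᵇ L₁') in eq'
    ... | false = refl
    ... | true with () ← trans (sym (meet (h (member₂ {l} eq')))) eq

-- The 2-sum as a surgery

module _ {n₁ n₂} (f : Fin n₁) (e : Fin n₂) (s : Bool) where
  private
    Fᵉ : Fin (n₁ +ℕ n₂)
    Fᵉ = f ↑ˡ n₂
    Eᵉ : Fin (n₁ +ℕ n₂)
    Eᵉ = n₁ ↑ʳ e

  -- The coupling as an involution on all ends. Tails go to tails and heads to heads, so only the
  -- choice of the arrow is shifted by s.
  glue : Pt (n₁ +ℕ n₂) → Pt (n₁ +ℕ n₂)
  glue (pt g x h) = if finEq g Fᵉ then pt Eᵉ (x xor s) h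
                    else if finEq g Eᵉ then pt Fᵉ (x xor s) h
                    else pt g x h

  glue-F : ∀ x h → glue (pt Fᵉ x h) ≡ pt Eᵉ (x xor s) h
  glue-F x h rewrite finEq-refl Fᵉ = refl

  glue-E : ∀ x h → glue (pt Eᵉ x h) ≡ pt Fᵉ (x xor s) h
  glue-E x h rewrite finEq-false (λ p → ↑ˡ≢↑ʳ n₂ f e (sym p)) | finEq-refl Eᵉ = refl

  xor-twice : ∀ x → (x xor s) xor s ≡ x
  xor-twice x = trans (xor-assoc x s s) (trans (cong (x xor_) (xor-same s)) (xor-identityʳ x))

  glued : Pt (n₁ +ℕ n₂) → Set
  glued x = edge x ≡ Fᵉ ⊎ edge x ≡ Eᵉ

  glue-glued : ∀ {x} → glued x → glued (glue x)
  glue-glued {pt _ x h} (inj₁ refl) = inj₂ (cong edge (glue-F x h))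
  glue-glued {pt _ x h} (inj₂ refl) = inj₁ (cong edge (glue-E x h))

  glue-inv′ : ∀ {x} → glued x → glue (glue x) ≡ x
  glue-inv′ {pt _ x h} (inj₁ refl) = trans (cong glue (glue-F x h))
    (trans (glue-E (x xor s) h) (cong (λ z → pt Fᵉ z h) (xor-twice x)))
  glue-inv′ {pt _ x h} (inj₂ refl) = trans (cong glue (glue-E x h))
    (trans (glue-F (x xor s) h) (cong (λ z → pt Eᵉ z h) (xor-twice x)))

  glued? : ∀ x → glued x ⊎ glue x ≡ x
  glued? (pt g x h) with finEq g Fᵉ in eq
  ... | true = inj₁ (inj₁ (finEq⇒ eq))
  ... | false with finEq g Eᵉ in eq'
  ... | true = inj₁ (inj₂ (finEq⇒ eq'))
  ... | false = inj₂ refl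

  glue-inv : ∀ x → glue (glue x) ≡ x
  glue-inv x with glued? x
  ... | inj₁ g = glue-inv′ g
  ... | inj₂ p = trans (cong glue p) p

  glue-≢ : ∀ {x} → glued x → glue x ≢ x
  glue-≢ {pt _ x h} (inj₁ refl) p = ↑ˡ≢↑ʳ n₂ f e (sym (trans (sym (cong edge (glue-F x h))) (cong edge p)))
  glue-≢ {pt _ x h} (inj₂ refl) p = ↑ˡ≢↑ʳ n₂ f e (trans (sym (cong edge (glue-E x h))) (cong edge p))

  module _ {E₁ E₁' : Fin n₁ → Set} {E₂ E₂' : Fin n₂ → Set}
           (r₁ : Removal f E₁ E₁') (r₂ : Removal e E₂ E₂') where
    private
      module r₁ = Removal r₁
      module r₂ = Removal r₂

      glued-on : ∀ {x} → glued x → On (E₁ ⊕ E₂) x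
      glued-on (inj₁ refl) = on (inˡ r₁.present)
      glued-on (inj₂ refl) = on (inʳ r₂.present)

      sp : ∀ {x} → On (E₁ ⊕ E₂) x → glued x ⊎ On (E₁' ⊕ E₂') x
      sp l with ⊕-view l
      sp l | inj₁ (x , on l' , refl) with r₁.split l'
      ... | inj₁ refl = inj₁ (inj₁ refl)
      ... | inj₂ k = inj₂ (on (inˡ k))
      sp l | inj₂ (x , on l' , refl) with r₂.split l'
      ... | inj₁ refl = inj₁ (inj₂ refl)
      ... | inj₂ k = inj₂ (on (inʳ k))

      weaken : ∀ {x} → On (E₁' ⊕ E₂') x → On (E₁ ⊕ E₂) x
      weaken l with ⊕-view l
      ... | inj₁ (x , on l' , refl) = on (inˡ (r₁.rest l'))
      ... | inj₂ (x , on l' , refl) = on (inʳ (r₂.rest l'))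

      gone : ∀ {x} → glued x → On (E₁' ⊕ E₂') x → ⊥
      gone d l with ⊕-view l
      gone (inj₁ p) l | inj₁ (x , on l' , refl) = r₁.absent (subst E₁' (Fin.↑ˡ-injective n₂ _ _ p) l')
      gone (inj₂ p) l | inj₁ (x , on l' , refl) = ↑ˡ≢↑ʳ n₂ _ _ p
      gone (inj₁ p) l | inj₂ (x , on l' , refl) = ↑ˡ≢↑ʳ n₂ _ _ (sym p)
      gone (inj₂ p) l | inj₂ (x , on l' , refl) = r₂.absent (subst E₂' (Fin.↑ʳ-injective n₁ _ _ p) l')

    sumCut : Cut (On (E₁ ⊕ E₂)) (On (E₁' ⊕ E₂'))
    sumCut = record
      { D = glued
      ; M = λ x y → glued x × y ≡ glue x
      ; J = λ _ x y → glued x × y ≡ glue x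
      ; split = sp
      ; D⊂L = glued-on
      ; L'⊂L = weaken
      ; D∩L' = gone
      ; M-D = λ { (d , refl) → d , glue-glued d }
      ; M-sym = λ { {x} (d , refl) → glue-glued d , sym (glue-inv x) }
      ; M⊂J = λ s m → m
      ; J-D = λ { s (d , refl) → d , glue-glued d } }

module _ {A : Set a} (P : PAP A) (f : Fin (n P)) (H : PAP A) (e : Fin (n H)) (s : Bool) where
  private
    c = core (union P H)
    Fᵉ : Fin (n P +ℕ n H)
    Fᵉ = f ↑ˡ n H
    Eᵉ : Fin (n P +ℕ n H)
    Eᵉ = n P ↑ʳ e

  sumF : Side → ℕ → ℕ
  sumF vert = merge2 {A = A} (labC c vert (pt Fᵉ false false)) (labC c vert (pt Eᵉ s false))
                     (labC c vert (pt Fᵉ true false)) (labC c vert (pt Eᵉ (not s) false))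
  sumF bdry = merge2 {A = A} (labC c bdry (pt Fᵉ false false)) (labC c bdry (pt Eᵉ s false))
                     (labC c bdry (pt Fᵉ false true)) (labC c bdry (pt Eᵉ s true))

  -- Abstract, so that type checking never unfolds surgeries on unions.
  abstract
    sumCore : Core A (n P +ℕ n H)
    sumCore = core (twoSum P f H e s)

    sumCore-def : sumCore ≡ core (twoSum P f H e s)
    sumCore-def = refl

    sumCore-surgery : sumCore ≡ surgery c (Fᵉ ∷ Eᵉ ∷ []) (glue f e s) (sumF vert) (sumF bdry)
    sumCore-surgery = refl

    sumCore-wt : ∀ j → wt sumCore j ≡ wt c j
    sumCore-wt j = refl

  module _ {E₁ E₁' : Fin (n P) → Set} {E₂ E₂' : Fin (n H) → Set}
           (r₁ : Removal f E₁ E₁') (r₂ : Removal e E₂ E₂')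
           (wf₁ : GapWF E₁ (Core.gap (core P))) (wf₂ : GapWF E₂ (Core.gap (core H))) where
    private
      wfU : GapWF (E₁ ⊕ E₂) (Core.gap c)
      wfU = union-WF P H wf₁ wf₂
      K = sumCut f e s r₁ r₂

      onE : ∀ x h → On (E₁ ⊕ E₂) (pt Eᵉ x h)
      onE x h = on (inʳ (Removal.present r₂))
      onF : ∀ x h → On (E₁ ⊕ E₂) (pt Fᵉ x h)
      onF x h = on (inˡ (Removal.present r₁))

      flipV : ∀ {g x} → On (E₁ ⊕ E₂) (pt g x false) →
        labC c vert (pt g x true) ≡ labC c vert (pt g x false)
      flipV l = labC-mS c wfU vert l
      flipB : ∀ {g x h} → On (E₁ ⊕ E₂) (pt g x h) →
        labC c bdry (pt g (not x) (not h)) ≡ labC c bdry (pt g x h)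
      flipB l = labC-mS c wfU bdry l

      flipB′ : ∀ {g} x → On (E₁ ⊕ E₂) (pt g x true) →
        labC c bdry (pt g (not x) false) ≡ labC c bdry (pt g x true)
      flipB′ x l = flipB l
      flipB″ : ∀ {g} x → On (E₁ ⊕ E₂) (pt g x false) →
        labC c bdry (pt g (not x) true) ≡ labC c bdry (pt g x false)
      flipB″ x l = flipB l

      module Right {side} (G : ℕ → ℕ)
        (h : ∀ {x y} → Cut.J K side x y → G (labC c side x) ≡ G (labC c side y)) where
        glue-eq : ∀ x k → G (labC c side (pt Fᵉ x k)) ≡ G (labC c side (pt Eᵉ (x xor s) k))
        glue-eq x k = h {pt Fᵉ x k} (inj₁ refl , sym (glue-F f e s x k))

      leftV  = merge2-left A (labC c vert (pt Fᵉ false false)) (labC c vert (pt Eᵉ s false))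
                 (labC c vert (pt Fᵉ true false)) (labC c vert (pt Eᵉ (not s) false))
      rightV = merge2-right A (labC c vert (pt Fᵉ false false)) (labC c vert (pt Eᵉ s false))
                 (labC c vert (pt Fᵉ true false)) (labC c vert (pt Eᵉ (not s) false))
      leftB  = merge2-left A (labC c bdry (pt Fᵉ false false)) (labC c bdry (pt Eᵉ s false))
                 (labC c bdry (pt Fᵉ false true)) (labC c bdry (pt Eᵉ s true))
      rightB = merge2-right A (labC c bdry (pt Fᵉ false false)) (labC c bdry (pt Eᵉ s false))
                 (labC c bdry (pt Fᵉ false true)) (labC c bdry (pt Eᵉ s true))

      -- The 2-sum joins blocks explicitly at two of the four pairs of glued ends. The other two
      -- pairs lie on the same vertices or boundary components as these.
      joinF : ∀ side x h → sumF side (labC c side (pt Fᵉ x h)) ≡ sumF side (labC c side (pt Eᵉ (x xor s) h))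
      joinF vert false false = leftV
      joinF vert false true = trans (cong (sumF vert) (flipV (onF false false)))
        (trans leftV (cong (sumF vert) (sym (flipV (onE s false)))))
      joinF vert true false = rightV
      joinF vert true true = trans (cong (sumF vert) (flipV (onF true false)))
        (trans rightV
          (cong (sumF vert) (sym (flipV (onE (not s) false)))))
      joinF bdry false false = leftB
      joinF bdry false true = rightB
      joinF bdry true true = trans (cong (sumF bdry) (flipB″ false (onF false false)))
        (trans leftB (cong (sumF bdry) (sym (flipB″ s (onE s false)))))
      joinF bdry true false = trans (cong (sumF bdry) (flipB′ false (onF false true)))
        (trans rightB
          (cong (sumF bdry) (sym (flipB′ s (onE s true)))))

      joinJ : ∀ side {x} → glued f e s x → sumF side (labC c side x) ≡ sumF side (labC c side (glue f e s x))
      joinJ side {pt _ x h} (inj₁ refl) =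
        trans (joinF side x h) (cong (λ z → sumF side (labC c side z)) (sym (glue-F f e s x h)))
      joinJ side {pt _ x h} (inj₂ refl) = trans
        (cong (λ z → sumF side (labC c side (pt Eᵉ z h))) (sym (xor-twice f e s x)))
        (trans (sym (joinF side (x xor s) h)) (cong (λ z → sumF side (labC c side z)) (sym (glue-E f e s x h))))

      sumF-merges : ∀ side → Merges (labC c side) (Cut.J K side) (sumF side)
      sumF-merges vert = record
        { joins = λ { (d , refl) → joinJ vert d }
        ; least = λ G h → merge2-least A (labC c vert (pt Fᵉ false false)) (labC c vert (pt Eᵉ s false))
            (labC c vert (pt Fᵉ true false)) (labC c vert (pt Eᵉ (not s) false)) G (Right.glue-eq {vert} G h false false)
            (Right.glue-eq {vert} G h true false) }
      sumF-merges bdry = record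
        { joins = λ { (d , refl) → joinJ bdry d }
        ; least = λ G h → merge2-least A (labC c bdry (pt Fᵉ false false)) (labC c bdry (pt Eᵉ s false))
            (labC c bdry (pt Fᵉ false true)) (labC c bdry (pt Eᵉ s true)) G (Right.glue-eq {bdry} G h false false)
            (Right.glue-eq {bdry} G h false true) }

      glue-L : ∀ {x} → On (E₁ ⊕ E₂) x → On (E₁ ⊕ E₂) (glue f e s x)
      glue-L {x} l with glued? f e s x
      ... | inj₁ d = Cut.D⊂L K (glue-glued f e s d)
      ... | inj₂ p = subst (On (E₁ ⊕ E₂)) (sym p) l

    abstract
      twoSum-Surg : Surg K (abs c) (abs sumCore)
      twoSum-Surg = subst (λ c' → Surg K (abs c) (abs c')) (sym sumCore-surgery)
        (Surgery.surg K c wfU (Fᵉ ∷ Eᵉ ∷ []) (glue f e s) sumF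
        ((↑ˡ≢↑ʳ (n H) f e ∷ []) ∷ [] ∷ [])
        (λ { (here p) → inj₁ p ; (there (here p)) → inj₂ p })
        (λ { (inj₁ p) → here p ; (inj₂ p) → there (here p) })
        proj₂ (λ d → d , refl) glue-L (λ {x} _ → glue-inv f e s x) (glue-≢ f e s) sumF-merges)

    twoSum-WF : GapWF (E₁' ⊕ E₂') (Core.gap sumCore)
    twoSum-WF = WF-Gap (Surg-WF K (abs-WF c wfU) twoSum-Surg)

Removalˡ : ∀ {n₁ n₂} {g : Fin n₁} {E₁ E₁' : Fin n₁ → Set} {E₂ : Fin n₂ → Set} →
  Removal g E₁ E₁' → Removal (g ↑ˡ n₂) (E₁ ⊕ E₂) (E₁' ⊕ E₂)
Removalˡ {n₁} {n₂} {g} {E₁} {E₁'} {E₂} r = record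
  { present = inˡ r.present
  ; split = λ { (inˡ l) → [ (λ p → inj₁ (cong (_↑ˡ n₂) p)) , (λ k → inj₂ (inˡ k)) ]′ (r.split l)
              ; (inʳ l) → inj₂ (inʳ l) }
  ; rest = λ { (inˡ l) → inˡ (r.rest l) ; (inʳ l) → inʳ l }
  ; absent = λ l → gone l refl }
  where
  module r = Removal r
  gone : ∀ {j} → (E₁' ⊕ E₂) j → j ≢ g ↑ˡ n₂
  gone (inˡ l) p = r.absent (subst E₁' (Fin.↑ˡ-injective n₂ _ _ p) l)
  gone (inʳ l) p = ↑ˡ≢↑ʳ n₂ _ _ (sym p)

Removalʳ : ∀ {n₁ n₂} {g : Fin n₂} {E₁ : Fin n₁ → Set} {E₂ E₂' : Fin n₂ → Set} →
  Removal g E₂ E₂' → Removal (n₁ ↑ʳ g) (E₁ ⊕ E₂) (E₁ ⊕ E₂')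
Removalʳ {n₁} {n₂} {g} {E₁} {E₂} {E₂'} r = record
  { present = inʳ r.present
  ; split = λ { (inʳ l) → [ (λ p → inj₁ (cong (n₁ ↑ʳ_) p)) , (λ k → inj₂ (inʳ k)) ]′ (r.split l)
              ; (inˡ l) → inj₂ (inˡ l) }
  ; rest = λ { (inʳ l) → inʳ (r.rest l) ; (inˡ l) → inˡ l }
  ; absent = λ l → gone l refl }
  where
  module r = Removal r
  gone : ∀ {j} → (E₁ ⊕ E₂') j → j ≢ n₁ ↑ʳ g
  gone (inʳ l) p = r.absent (subst E₂' (Fin.↑ʳ-injective n₁ _ _ p) l)
  gone (inˡ l) p = ↑ˡ≢↑ʳ n₂ _ _ p

-- 2-sums commute with operations at other edges

module _ {n₁ n₂ m} (j : Fin n₁ → Fin m) (j-inj : ∀ {i i'} → j i ≡ j i' → i ≡ i')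
         (κ : Pt n₂ → Pt m) (t : Tags) (j≢κ : ∀ {x y} → along j x ≢ κ y) where
  open Union (along j) κ t (along-injective j j-inj) j≢κ

  module _ {E₁ E₁' : Fin n₁ → Set} {L₂ : Pt n₂ → Set} {E E' N N' : Fin m → Set} (o : Op) {g : Fin n₁}
           {v : Covers (On E₁) L₂ (On E)} {v' : Covers (On E₁') L₂ (On E')}
           (r : Removal g E₁ E₁') (r' : Removal (j g) N N') where

    edgeCut-⊑-lift : edgeCut o (j g) r' ⊑ liftCut v v' (edgeCut o g r)
    edgeCut-⊑-lift = record
      { D⊑ = λ { {pt _ x h} refl → pt g x h , refl , refl }
      ; M⊑ = λ { {pt _ x h} (refl , refl) →
          pt g x h , opM o (pt g x h) , (refl , refl) , refl , kindM-along j (kind o) (pt g x h) }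
      ; J⊑ = λ { side {pt _ x h} {pt _ y k} (refl , refl , q) →
          pt g x h , pt g y k , (refl , refl , [ inj₁ , (λ q → inj₂ (along-injective j j-inj
            (trans q (kindM-along j (kindS side) (pt g x h))))) ]′ q) , refl , refl } }

    lift-⊑-edgeCut : liftCut v v' (edgeCut o g r) ⊑ edgeCut o (j g) r'
    lift-⊑-edgeCut = record
      { D⊑ = λ { (x , refl , refl) → refl }
      ; M⊑ = λ { (x , _ , (refl , refl) , refl , refl) → refl , sym (kindM-along j (kind o) x) }
      ; J⊑ = λ { side (x , y , (refl , q , t) , refl , refl) → refl , cong j q
          , [ inj₁ , (λ { refl → inj₂ (sym (kindM-along j (kindS side) x)) }) ]′ t } }

module _ {A : Set a} (P : PAP A) (f : Fin (n P)) (H : PAP A) (e : Fin (n H)) (s : Bool) where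
  private
    n₁ = n P
    n₂ = n H

  module _ {E₁ E₁ᶠ E₁ᵍ E₁ᶠᵍ : Fin n₁ → Set} {E₂ E₂ᵉ : Fin n₂ → Set} (o : Op) {g : Fin n₁}
    (rf : Removal f E₁ E₁ᶠ) (rg : Removal g E₁ᶠ E₁ᶠᵍ)
    (tg : Removal g E₁ E₁ᵍ) (tf : Removal f E₁ᵍ E₁ᶠᵍ) (re : Removal e E₂ E₂ᵉ)
    (wf₁ : GapWF E₁ (Core.gap (core P))) (wf₂ : GapWF E₂ (Core.gap (core H))) (l : List (Fin n₁)) where
    private
      P' = pap n₁ l (edgeOp o (core P) g)
      U = union P H
      wf' = edgeOp-WF o tg (core P) wf₁
      K₁ = sumCut f e s rf re
      K₂ = edgeCut o (g ↑ˡ n₂) (Removalˡ {E₂ = E₂ᵉ} rg)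
      lift : Cut (On (E₁ ⊕ E₂)) (On (E₁ᵍ ⊕ E₂))
      lift = UnionL.liftCut n₁ n₂ coversL coversL (edgeCut o g tg)
      N = sumCut f e s tf re

      i : K₂ ⊑ lift
      i = edgeCut-⊑-lift (_↑ˡ n₂) (Fin.↑ˡ-injective n₂ _ _) (inR n₁) tagsˡ inL≢inR o tg (Removalˡ rg)
      j : lift ⊑ K₂
      j = lift-⊑-edgeCut (_↑ˡ n₂) (Fin.↑ˡ-injective n₂ _ _) (inR n₁) tagsˡ inL≢inR o tg (Removalˡ rg)
      K₁⊑N : K₁ ⊑ N
      K₁⊑N = record { D⊑ = λ d → d ; M⊑ = λ m → m ; J⊑ = λ _ q → q }
      N⊑K₁ : N ⊑ K₁
      N⊑K₁ = record { D⊑ = λ d → d ; M⊑ = λ m → m ; J⊑ = λ _ q → q }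
      wfU = abs-WF (core U) (union-WF P H wf₁ wf₂)

    -- Both cores arise from the union of P and H by the same two surgeries in opposite orders: the
    -- operation in P, made before the union is formed, becomes a surgery on the union by
    -- `Surg-lift`.
    twoSum-edgeOpˡ : CoreEq (E₁ᶠᵍ ⊕ E₂ᵉ) (edgeOp o (sumCore P f H e s) (g ↑ˡ n₂)) (sumCore P' f H e s)
    twoSum-edgeOpˡ = record
      { abs≅ = Surg-cong {K = K₁ ⨾ K₂} {K' = lift ⨾ N} wfU wfU
          (⨾-⊑ K₁⊑N i) (⨾-⊑ j N⊑K₁) ≅-refl
          (Surg-⨾ wfU (twoSum-Surg P f H e s rf re wf₁ wf₂)
            (edgeOp-Surg o (Removalˡ rg) (sumCore P f H e s) (twoSum-WF P f H e s rf re wf₁ wf₂)))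
          (Surg-⨾ wfU (UnionL.Surg-lift n₁ n₂ coversL coversL (edgeCut o g tg)
              (abs-WF (core P) wf₁) (abs-WF (core H) wf₂) (isUnionL P H wf₁ wf₂)
              (isUnionL P' H wf' wf₂) (edgeOp-Surg o tg (core P) wf₁) (inR-injective n₁))
            (twoSum-Surg P' f H e s tf re wf' wf₂))
      ; wt≡ = λ {k} l → trans (edgeOp-wt o (Removalˡ {E₂ = E₂ᵉ} rg) (sumCore P f H e s)
          (twoSum-WF P f H e s rf re wf₁ wf₂) k)
          (trans (sumCore-wt P f H e s k) (trans (weights l) (sym (sumCore-wt P' f H e s k)))) }
      where
      weights : ∀ {k} → (E₁ᶠᵍ ⊕ E₂ᵉ) k → wt (core U) k ≡ wt (core (union P' H)) k
      weights (inˡ {i} _) = trans (wt-inL P H i)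
        (sym (trans (wt-inL P' H i) (edgeOp-wt o tg (core P) wf₁ i)))
      weights (inʳ {i} _) = trans (wt-inR P H i) (sym (wt-inR P' H i))

  module _ {E₁ E₁ᶠ : Fin n₁ → Set} {E₂ E₂ᵉ E₂ᵍ E₂ᵉᵍ : Fin n₂ → Set} (o : Op) {g : Fin n₂}
    (re : Removal e E₂ E₂ᵉ) (rg : Removal g E₂ᵉ E₂ᵉᵍ)
    (tg : Removal g E₂ E₂ᵍ) (te : Removal e E₂ᵍ E₂ᵉᵍ) (rf : Removal f E₁ E₁ᶠ)
    (wf₁ : GapWF E₁ (Core.gap (core P))) (wf₂ : GapWF E₂ (Core.gap (core H))) (l : List (Fin n₂)) where
    private
      H' = pap n₂ l (edgeOp o (core H) g)
      U = union P H
      wf' = edgeOp-WF o tg (core H) wf₂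
      K₁ = sumCut f e s rf re
      K₂ = edgeCut o (n₁ ↑ʳ g) (Removalʳ {E₁ = E₁ᶠ} rg)
      lift : Cut (On (E₁ ⊕ E₂)) (On (E₁ ⊕ E₂ᵍ))
      lift = UnionR.liftCut n₁ n₂ coversR coversR (edgeCut o g tg)
      N = sumCut f e s rf te

      i : K₂ ⊑ lift
      i = edgeCut-⊑-lift (n₁ ↑ʳ_) (Fin.↑ʳ-injective n₁ _ _) (inL n₂) tagsʳ (λ p → inL≢inR (sym p)) o tg (Removalʳ rg)
      j : lift ⊑ K₂
      j = lift-⊑-edgeCut (n₁ ↑ʳ_) (Fin.↑ʳ-injective n₁ _ _) (inL n₂) tagsʳ (λ p → inL≢inR (sym p)) o tg (Removalʳ rg)
      K₁⊑N : K₁ ⊑ N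
      K₁⊑N = record { D⊑ = λ d → d ; M⊑ = λ m → m ; J⊑ = λ _ q → q }
      N⊑K₁ : N ⊑ K₁
      N⊑K₁ = record { D⊑ = λ d → d ; M⊑ = λ m → m ; J⊑ = λ _ q → q }
      wfU = abs-WF (core U) (union-WF P H wf₁ wf₂)

    twoSum-edgeOpʳ : CoreEq (E₁ᶠ ⊕ E₂ᵉᵍ) (edgeOp o (sumCore P f H e s) (n₁ ↑ʳ g)) (sumCore P f H' e s)
    twoSum-edgeOpʳ = record
      { abs≅ = Surg-cong {K = K₁ ⨾ K₂} {K' = lift ⨾ N} wfU wfU
          (⨾-⊑ K₁⊑N i) (⨾-⊑ j N⊑K₁) ≅-refl
          (Surg-⨾ wfU (twoSum-Surg P f H e s rf re wf₁ wf₂)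
            (edgeOp-Surg o (Removalʳ rg) (sumCore P f H e s) (twoSum-WF P f H e s rf re wf₁ wf₂)))
          (Surg-⨾ wfU (UnionR.Surg-lift n₁ n₂ coversR coversR (edgeCut o g tg)
              (abs-WF (core H) wf₂) (abs-WF (core P) wf₁) (isUnionR P H wf₁ wf₂)
              (isUnionR P H' wf₁ wf') (edgeOp-Surg o tg (core H) wf₂) (inL-injective n₂))
            (twoSum-Surg P f H' e s rf te wf₁ wf'))
      ; wt≡ = λ {k} l → trans (edgeOp-wt o (Removalʳ {E₁ = E₁ᶠ} rg) (sumCore P f H e s)
          (twoSum-WF P f H e s rf re wf₁ wf₂) k)
          (trans (sumCore-wt P f H e s k) (trans (weights l) (sym (sumCore-wt P f H' e s k)))) }
      where
      weights : ∀ {k} → (E₁ᶠ ⊕ E₂ᵉᵍ) k → wt (core U) k ≡ wt (core (union P H')) k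
      weights (inˡ {i} _) = trans (wt-inL P H i) (sym (wt-inL P H' i))
      weights (inʳ {i} _) = trans (wt-inR P H i)
        (sym (trans (wt-inR P H' i) (edgeOp-wt o tg (core H) wf₂ i)))

-- Counting distinct labels

any-false : ∀ {X : Set} {p : X → Bool} {xs y} → any p xs ≡ false → y ∈ xs → p y ≡ false
any-false {p = p} {xs} {y} h i with p y in eq
... | false = refl
... | true with () ← trans (sym (any-intro i eq)) h

nub : List ℕ → List ℕ
nub []       = []
nub (x ∷ xs) = if any (x ≡ᵇ_) xs then nub xs else (x ∷ nub xs)

nub-length : ∀ xs → length (nub xs) ≡ countDistinct xs
nub-length [] = refl
nub-length (x ∷ xs) with any (x ≡ᵇ_) xs
... | true  = nub-length xs
... | false = cong suc (nub-length xs)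

∈-nub⁻ : ∀ xs {z} → z ∈ nub xs → z ∈ xs
∈-nub⁻ (x ∷ xs) i with any (x ≡ᵇ_) xs
∈-nub⁻ (x ∷ xs) i | true = there (∈-nub⁻ xs i)
∈-nub⁻ (x ∷ xs) (here p) | false = here p
∈-nub⁻ (x ∷ xs) (there i) | false = there (∈-nub⁻ xs i)

∈-nub⁺ : ∀ xs {z} → z ∈ xs → z ∈ nub xs
∈-nub⁺ (x ∷ xs) i with any (x ≡ᵇ_) xs in eq
∈-nub⁺ (x ∷ xs) (here refl) | false = here refl
∈-nub⁺ (x ∷ xs) (there i) | false = there (∈-nub⁺ xs i)
∈-nub⁺ (x ∷ xs) (there i) | true = ∈-nub⁺ xs i
∈-nub⁺ (x ∷ xs) (here refl) | true with any-true xs eq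
... | y , y∈ , p = ∈-nub⁺ xs (subst (_∈ xs) (sym (≡ᵇ⇒ {x} p)) y∈)

nub-unique : ∀ xs → Unique (nub xs)
nub-unique [] = []
nub-unique (x ∷ xs) with any (x ≡ᵇ_) xs in eq
... | true = nub-unique xs
... | false = All.tabulate (λ { i refl → contradiction (trans (sym (any-false eq (∈-nub⁻ xs i))) (⇒≡ᵇ {x} refl)) λ () })
                ∷ nub-unique xs

-- ρ is injective on xs, because ρ' undoes it there, so the pigeonhole principle applies once
-- repetitions are dropped.
countDistinct-≤ : ∀ {xs ys} (ρ ρ' : ℕ → ℕ) → (∀ {z} → z ∈ xs → ρ z ∈ ys × ρ' (ρ z) ≡ z) →
  countDistinct xs ≤ countDistinct ys
countDistinct-≤ {xs} {ys} ρ ρ' h = ℕ.≤-trans (ℕ.≤-reflexive (sym (nub-length xs)))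
  (ℕ.≤-trans (apart-length {R = λ x y → y ≡ ρ x × ρ' y ≡ x}
    (λ { n (refl , p) (q , r) → n (trans (sym p) r) }) (nub-unique xs)
    (All.tabulate λ i → let j , q = h (∈-nub⁻ xs i) in lose (∈-nub⁺ ys j) (refl , q)))
  (ℕ.≤-reflexive (nub-length ys)))

countDistinct-≐ : ∀ {xs ys} → xs ≐ ys → countDistinct xs ≡ countDistinct ys
countDistinct-≐ {xs} {ys} (i , j) = ℕ.≤-antisym
  (countDistinct-≤ {xs} {ys} (λ l → l) (λ l → l) (λ k → i k , refl))
  (countDistinct-≤ {ys} {xs} (λ l → l) (λ l → l) (λ k → j k , refl))

countDistinct-map : ∀ (f g : ℕ → ℕ) → (∀ l → g (f l) ≡ l) → ∀ xs →
  countDistinct (map f xs) ≡ countDistinct xs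
countDistinct-map f g h xs = ℕ.≤-antisym
  (countDistinct-≤ {map f xs} {xs} g f λ i → let x , x∈ , p = ∈-map⁻ f i in
    ∈-resp (sym (trans (cong g p) (h x))) x∈ , trans (cong f (trans (cong g p) (h x))) (sym p))
  (countDistinct-≤ {xs} {map f xs} f g λ i → ∈-map⁺ f i , h _)

countDistinct-++ : ∀ xs {ys} → (∀ {z} → z ∈ xs → z ∈ ys → ⊥) →
  countDistinct (xs ++ ys) ≡ countDistinct xs +ℕ countDistinct ys
countDistinct-++ [] h = refl
countDistinct-++ (x ∷ xs) {ys} h with any (x ≡ᵇ_) xs in eq | any (x ≡ᵇ_) (xs ++ ys) in eq'
... | true  | true  = countDistinct-++ xs (λ i → h (there i))
... | false | false = cong suc (countDistinct-++ xs (λ i → h (there i)))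
... | true  | false with any-true xs eq
... | y , i , p with () ← trans (sym p) (any-false eq' (∈-++⁺ˡ i))
countDistinct-++ (x ∷ xs) {ys} h | false | true with any-true (xs ++ ys) eq'
... | y , i , p with ∈-++⁻ xs i
... | inj₁ j with () ← trans (sym p) (any-false eq j)
... | inj₂ j = ⊥-elim (h (here refl) (subst (_∈ ys) (sym (≡ᵇ⇒ {x} p)) j))

≅-countDistinct : ∀ {X : Set} {L : X → Set} {A B : Pres X} → A ≅[ L ] B → ∀ s →
  countDistinct (emp A s) ≡ countDistinct (emp B s)
≅-countDistinct e s = ℕ.≤-antisym (countDistinct-≤ ρ ρ' ρ-emp) (countDistinct-≤ ρ' ρ ρ'-emp)
  where open LabEq (_≅[_]_.lab≡ e s)

-- Lists of live edges

Removal-here : ∀ {n} {e : Fin n} {es} → Unique (e ∷ es) → Removal e (_∈ e ∷ es) (_∈ es)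
Removal-here (u ∷ _) = record
  { present = here refl
  ; split = λ { (here p) → inj₁ p ; (there i) → inj₂ i }
  ; rest = there
  ; absent = λ i → All.lookup u i refl }

∈-removeF⁺ : ∀ {n} (e : Fin n) {j es} → j ∈ es → j ≢ e → j ∈ removeF e es
∈-removeF⁺ e {j} i h = ∈-filter⁺ (T? ∘ λ j → not (finEq e j)) i
  (Equivalence.from T-≡ (cong not (finEq-false (λ p → h (sym p)))))

∈-removeF⁻ : ∀ {n} (e : Fin n) {j} es → j ∈ removeF e es → j ∈ es × j ≢ e
∈-removeF⁻ e {j} es i with ∈-filter⁻ (T? ∘ λ j → not (finEq e j)) {xs = es} i
... | k , t = k , λ { refl → contradiction (trans (sym (Equivalence.to T-≡ t)) (cong not (finEq-refl e))) λ () }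

removeF-unique : ∀ {n} (e : Fin n) {es} → Unique es → Unique (removeF e es)
removeF-unique e = AllPairs.filter⁺ (λ j → T? (not (finEq e j)))

removeF-absent : ∀ {n} {e : Fin n} es → ¬ e ∈ es → removeF e es ≡ es
removeF-absent [] h = refl
removeF-absent {e = e} (x ∷ xs) h with finEq e x in eq
... | true  = ⊥-elim (h (here (finEq⇒ eq)))
... | false = cong (x ∷_) (removeF-absent {e = e} xs (λ i → h (there i)))

Removal-removeF : ∀ {n} {e : Fin n} {es} → e ∈ es → Removal e (_∈ es) (_∈ removeF e es)
Removal-removeF {e = e} {es} i = record
  { present = i
  ; split = sp
  ; rest = λ k → proj₁ (∈-removeF⁻ e es k)
  ; absent = λ k → proj₂ (∈-removeF⁻ e es k) refl }
  where
  sp : ∀ {j} → j ∈ es → j ≡ e ⊎ j ∈ removeF e es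
  sp {j} k with j Fin.≟ e
  ... | yes p = inj₁ p
  ... | no h  = inj₂ (∈-removeF⁺ e k h)

GapWF-map : ∀ {n} {E N : Fin n → Set} {g} → (∀ {j} → E j → N j) → (∀ {j} → N j → E j) →
  GapWF E g → GapWF N g
GapWF-map i j w = record
  { gap-L = λ { (on l) → on (i (On.at (gap-L (on (j l))))) }
  ; gap-inv = λ { (on l) → gap-inv (on (j l)) }
  ; gap-≢ = λ { (on l) → gap-≢ (on (j l)) } }
  where open GapWF w

CoreEq-map : ∀ {a} {A : Set a} {n} {E N : Fin n → Set} {c c' : Core A n} → (∀ {j} → N j → E j) →
  CoreEq E c c' → CoreEq N c c'
CoreEq-map j q = record { abs≅ = ≅-⊂ (λ { (on l) → on (j l) }) abs≅ ; wt≡ = λ l → wt≡ (j l) }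
  where open CoreEq q

-- The state sum and the order of its edges

module StateSum {c ℓ} (R : CommutativeRing c ℓ)
                (α β γ : CommutativeRing.Carrier R) where
  open CommutativeRing R renaming (refl to ≈-refl; sym to ≈-sym; trans to ≈-trans; reflexive to ≈-reflexive)
  open Poly R
  open SetoidReasoning setoid
  open CommutativeSemigroup +-commutativeSemigroup using () renaming (interchange to +-interchange)
  open CommutativeSemigroup *-commutativeSemigroup using () renaming (x∙yz≈y∙xz to *-left-comm)

  value : ∀ {X} → Pres X → Carrier
  value A = pow α (len A) * pow β (countDistinct (emp A vert)) * pow γ (countDistinct (emp A bdry))

  abstract
    sum5 : Wt Carrier → (Op → Carrier) → Carrier
    sum5 w g = Wt.wa w * g del + Wt.wb w * g con + Wt.wc w * g pen + Wt.wx w * g mdel + Wt.wy w * g mcon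

    sum5-def : ∀ w g → sum5 w g
      ≡ Wt.wa w * g del + Wt.wb w * g con + Wt.wc w * g pen + Wt.wx w * g mdel + Wt.wy w * g mcon
    sum5-def w g = refl

    Qc : ∀ {n} → List (Fin n) → Core Carrier n → Carrier
    Qc = Qgo α β γ

    Qc-def : ∀ {n} (es : List (Fin n)) c → Qc es c ≡ Qgo α β γ es c
    Qc-def es c = refl

    Qc-[] : ∀ {n} (c : Core Carrier n) → Qc [] c ≡ value (abs c)
    Qc-[] c = refl

    Qc-∷ : ∀ {n} e (es : List (Fin n)) c → Qc (e ∷ es) c ≡ sum5 (wt c e) (λ o → Qc es (edgeOp o c e))
    Qc-∷ e es c = refl

    sum5-cong : ∀ w {g h} → (∀ o → g o ≈ h o) → sum5 w g ≈ sum5 w h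
    sum5-cong w h = +-cong (+-cong (+-cong (+-cong (*-congˡ (h del)) (*-congˡ (h con))) (*-congˡ (h pen)))
      (*-congˡ (h mdel))) (*-congˡ (h mcon))

    sum5-+ : ∀ w g h → sum5 w (λ o → g o + h o) ≈ sum5 w g + sum5 w h
    sum5-+ w g h = ≈-trans (+-cong (≈-trans (+-cong (≈-trans (+-cong (≈-trans (+-cong (d _ _ _) (d _ _ _))
      (+-interchange _ _ _ _)) (d _ _ _)) (+-interchange _ _ _ _)) (d _ _ _)) (+-interchange _ _ _ _))
      (d _ _ _)) (+-interchange _ _ _ _)
      where
      d : ∀ x y z → x * (y + z) ≈ x * y + x * z
      d = distribˡ

    sum5-* : ∀ w k g → sum5 w (λ o → k * g o) ≈ k * sum5 w g
    sum5-* w k g = ≈-sym (≈-trans (distribˡ k _ _) (+-cong (≈-trans (distribˡ k _ _) (+-cong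
      (≈-trans (distribˡ k _ _) (+-cong (≈-trans (distribˡ k _ _) (+-cong
      (*-left-comm k _ _) (*-left-comm k _ _))) (*-left-comm k _ _))) (*-left-comm k _ _)))
      (*-left-comm k _ _)))

    sum5-swap : ∀ w v (g : Op → Op → Carrier) →
      sum5 w (λ o → sum5 v (g o)) ≈ sum5 v (λ o' → sum5 w (λ o → g o o'))
    sum5-swap w v g = ≈-trans (sum5-+ w s₄ (t mcon)) (+-cong (≈-trans (sum5-+ w s₃ (t mdel)) (+-cong
      (≈-trans (sum5-+ w s₂ (t pen)) (+-cong (≈-trans (sum5-+ w (t del) (t con)) (+-cong
      (k del) (k con))) (k pen))) (k mdel))) (k mcon))
      where
      coef : Op → Carrier
      coef del  = Wt.wa v
      coef con  = Wt.wb v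
      coef pen  = Wt.wc v
      coef mdel = Wt.wx v
      coef mcon = Wt.wy v
      t : Op → Op → Carrier
      t o' o = coef o' * g o o'
      s₂ s₃ s₄ : Op → Carrier
      s₂ o = t del o + t con o
      s₃ o = s₂ o + t pen o
      s₄ o = s₃ o + t mdel o
      k : ∀ o' → sum5 w (t o') ≈ coef o' * sum5 w (λ o → g o o')
      k o' = sum5-* w (coef o') (λ o → g o o')

  value-cong : ∀ {X} {L : X → Set} {A B : Pres X} → A ≅[ L ] B → value A ≈ value B
  value-cong e = *-cong (*-cong (≈-reflexive (cong (pow α) (_≅[_]_.len≡ e)))
    (≈-reflexive (cong (pow β) (≅-countDistinct e vert))))
    (≈-reflexive (cong (pow γ) (≅-countDistinct e bdry)))

  Qc-cong : ∀ {n} es {c c' : Core Carrier n} → Unique es → GapWF (_∈ es) (Core.gap c) →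
    GapWF (_∈ es) (Core.gap c') → CoreEq (_∈ es) c c' → Qc es c ≈ Qc es c'
  Qc-cong [] {c} {c'} u w w' q rewrite Qc-[] c | Qc-[] c' = value-cong (CoreEq.abs≅ q)
  Qc-cong (e ∷ es) {c} {c'} (u ∷ us) w w' q rewrite Qc-∷ e es c | Qc-∷ e es c' | CoreEq.wt≡ q (here refl) =
    sum5-cong (wt c' e) λ o → Qc-cong es us (edgeOp-WF o r c w) (edgeOp-WF o r c' w')
      (edgeOp-cong o r w w' q)
    where r = Removal-here (u ∷ us)

  -- `Qgo` resolves the edges in the order of the list. The edge f passes the head g because the two
  -- sums of five terms can be exchanged and the operations at f and g commute.
  Qc-pull : ∀ {n} es {c : Core Carrier n} {f} → Unique es → f ∈ es → GapWF (_∈ es) (Core.gap c) →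
    Qc es c ≈ sum5 (wt c f) (λ o → Qc (removeF f es) (edgeOp o c f))
  Qc-pull (g ∷ es) {c} {f} (u ∷ us) f∈ w with finEq f g in eq
  ... | true rewrite finEq⇒ {i = f} eq | removeF-absent es (λ i → All.lookup u i refl) = ≈-reflexive (Qc-∷ g es c)
  Qc-pull (g ∷ es) {c} {f} (u ∷ us) (here p) w | false
    with () ← trans (sym eq) (⇒finEq p)
  Qc-pull (g ∷ es) {c} {f} (u ∷ us) (there i) w | false = begin
    Qc (g ∷ es) c ≈⟨ ≈-reflexive (Qc-∷ g es c) ⟩
    sum5 (wt c g) (λ o → Qc es (edgeOp o c g))
      ≈⟨ sum5-cong (wt c g) (λ o → ≈-trans (Qc-pull es us i (edgeOp-WF o rg c w))
           (≈-reflexive (cong (λ v → sum5 v (λ o' → Qc es' (edgeOp o' (edgeOp o c g) f)))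
             (edgeOp-wt o rg c w f)))) ⟩
    sum5 (wt c g) (λ o → sum5 (wt c f) (λ o' → Qc es' (edgeOp o' (edgeOp o c g) f)))
      ≈⟨ sum5-swap (wt c g) (wt c f) (λ o o' → Qc es' (edgeOp o' (edgeOp o c g) f)) ⟩
    sum5 (wt c f) (λ o' → sum5 (wt c g) (λ o → Qc es' (edgeOp o' (edgeOp o c g) f)))
      ≈⟨ sum5-cong (wt c f) (λ o' → ≈-trans
           (sum5-cong (wt c g) (λ o → Qc-cong es' (removeF-unique f us)
             (edgeOp-WF o' rf _ (edgeOp-WF o rg c w)) (edgeOp-WF o tg _ (edgeOp-WF o' tf c w))
             (edgeOp-comm o o' rg rf tf tg c w)))
           (≈-reflexive (trans (cong (λ v → sum5 v (λ o → Qc es' (edgeOp o (edgeOp o' c f) g)))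
             (sym (edgeOp-wt o' tf c w g))) (sym (Qc-∷ g es' (edgeOp o' c f)))))) ⟩
    sum5 (wt c f) (λ o' → Qc (g ∷ es') (edgeOp o' c f)) ∎
    where
    es' = removeF f es
    f≢g : f ≢ g
    f≢g p with () ← trans (sym eq) (⇒finEq p)
    rg = Removal-here (u ∷ us)
    rf = Removal-removeF i
    tf : Removal f (_∈ g ∷ es) (_∈ g ∷ es')
    tf = record
      { present = there i
      ; split = λ { (here p) → inj₂ (here p)
                  ; (there j) → [ inj₁ , (λ k → inj₂ (there k)) ]′ (Removal.split rf j) }
      ; rest = λ { (here p) → here p ; (there j) → there (Removal.rest rf j) }
      ; absent = λ { (here p) → f≢g p ; (there j) → Removal.absent rf j } }
    tg : Removal g (_∈ g ∷ es') (_∈ es')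
    tg = Removal-here (All.tabulate (λ j → All.lookup u (Removal.rest rf j)) ∷ removeF-unique f us)

-- Surgeries that remove all remaining points

module Final {X : Set} {L L' : X → Set} (K : Cut L L') {A A' : Pres X} (wf : WF L A)
             (S : Surg K A A') (empty : ∀ {x} → ¬ L' x) where
  open Cut K
  open Surg S
  private C = Conn (gap A) M

  cover-all : ∀ {x} → D x → Any (C x) ls
  cover-all d with ls-cover d
  ... | inj₁ i = i
  ... | inj₂ (_ , l , _) = ⊥-elim (empty l)

  -- Without remaining points all curves are closed, so every system of representatives has the
  -- length of `ls`. Thus the representatives chosen by the surgery need not be known.
  transversal-length : ∀ {zs} → All D zs → AllPairs (λ x y → ¬ C x y) zs →
    (∀ {x} → D x → Any (C x) zs) → length ls ≡ length zs
  transversal-length {zs} ds ap cov = ℕ.≤-antisym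
    (apart-length {R = λ x y → L x × C x y} join ls-apart
      (All.map (λ d → Any.map (λ q → D⊂L d , q) (cov d)) ls-D))
    (apart-length {R = λ x y → L x × C x y} join ap
      (All.map (λ d → Any.map (λ q → D⊂L d , q) (cover-all d)) ds))
    where
    join : ∀ {x x' y} → ¬ C x x' → L x × C x y → L x' × C x' y → ⊥
    join n (l , q) (l' , q') = n (Conn-trans q (Conn-sym K wf l' q'))

  -- Every removed point lies on a closed curve, along which F of the label is constant. So, as a
  -- set, the labels of the representatives may be replaced by those of all removed points, which
  -- are easier to list.
  emp-all : ∀ s pts → (∀ {x} → x ∈ pts → D x) → (∀ {x} → D x → x ∈ pts) →
    emp A' s ≐ map (F s) (emp A s ++ map (lab A s) pts)
  emp-all s pts pts-D D-pts = to , from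
    where
    to : ∀ {z} → z ∈ emp A' s → z ∈ map (F s) (emp A s ++ map (lab A s) pts)
    to i with ∈-map⁻ (F s) (proj₁ (emp-eq s) i)
    ... | w , j , refl with ∈-++⁻ (emp A s) j
    ... | inj₁ k = ∈-map⁺ (F s) (∈-++⁺ˡ k)
    ... | inj₂ k with ∈-map⁻ (lab A s) k
    ... | x , x∈ , refl =
      ∈-map⁺ (F s) (∈-++⁺ʳ (emp A s) (∈-map⁺ (lab A s) (D-pts (All.lookup ls-D x∈))))
    from : ∀ {z} → z ∈ map (F s) (emp A s ++ map (lab A s) pts) → z ∈ emp A' s
    from i with ∈-map⁻ (F s) i
    ... | w , j , refl with ∈-++⁻ (emp A s) j
    ... | inj₁ k = proj₂ (emp-eq s) (∈-map⁺ (F s) (∈-++⁺ˡ k))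
    ... | inj₂ k with ∈-map⁻ (lab A s) k
    ... | x , x∈ , refl with find (cover-all (pts-D x∈))
    ... | y , y∈ , q = ∈-resp (sym (Conn-lab K wf s (F s) (M-lab K wf S s) (D⊂L (pts-D x∈)) q))
            (proj₂ (emp-eq s) (∈-map⁺ (F s) (∈-++⁺ʳ (emp A s) (∈-map⁺ (lab A s) y∈))))

without : List ℕ → List ℕ → List ℕ
without ys xs = filterᵇ (λ l → not (any (l ≡ᵇ_) ys)) xs

∈-without⁻ : ∀ ys xs {l} → l ∈ without ys xs → l ∈ xs × (l ∈ ys → ⊥)
∈-without⁻ ys xs {l} i with ∈-filter⁻ (λ l → T? (not (any (l ≡ᵇ_) ys))) {xs = xs} i
... | j , t = j , λ k → contradiction (trans (sym (Equivalence.to T-≡ t)) (cong not (any-intro k (⇒≡ᵇ {l} refl)))) λ ()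

∈-without⁺ : ∀ ys {xs l} → l ∈ xs → l ∈ ys ⊎ l ∈ without ys xs
∈-without⁺ ys {xs} {l} i with any (l ≡ᵇ_) ys in eq
... | true with any-true ys eq
... | y , j , p = inj₁ (subst (_∈ ys) (sym (≡ᵇ⇒ {l} p)) j)
∈-without⁺ ys {xs} {l} i | false =
  inj₂ (∈-filter⁺ (λ l → T? (not (any (l ≡ᵇ_) ys))) i (Equivalence.from T-≡ (cong not eq)))

-- With e the only edge left, taking the 2-sum along e amounts to the
-- operation t on the other summand.
module _ {a} {A : Set a} {n} (c : Core A n) (e : Fin n) where
  private
    p₀₀ p₀₁ p₁₀ p₁₁ : Pt n
    p₀₀ = pt e false false
    p₀₁ = pt e false true
    p₁₀ = pt e true false
    p₁₁ = pt e true true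

  record HasType (t : Op) : Set where
    field
      gap-t : ∀ {x} → edge x ≡ e → Core.gap c x ≡ opM t x
      same  : ∀ s → mergesBlocks s t ≡ true → labC c s p₀₀ ≡ labC c s (corner s e)
      diff  : ∀ s → mergesBlocks s t ≡ false → labC c s p₀₀ ≢ labC c s (corner s e)

  module _ (wf : GapWF (_≡ e) (Core.gap c)) where
    private
      g = Core.gap c
      open GapWF wf
      inv : ∀ {x y} → edge x ≡ e → g x ≡ y → g y ≡ x
      inv l refl = gap-inv (on l)
      lg : ∀ s {x y} → edge x ≡ e → g x ≡ y → labC c s y ≡ labC c s x
      lg s l refl = WF.lab-gap (abs-WF c wf) s (on l)
      lm : ∀ s {x} → edge x ≡ e → labC c s (mS s x) ≡ labC c s x
      lm s l = labC-mS c wf s (on l)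

      four : ∀ {y} → edge y ≡ e → y ≡ p₀₀ ⊎ y ≡ p₀₁ ⊎ y ≡ p₁₀ ⊎ y ≡ p₁₁
      four {pt _ false false} refl = inj₁ refl
      four {pt _ false true}  refl = inj₂ (inj₁ refl)
      four {pt _ true false}  refl = inj₂ (inj₂ (inj₁ refl))
      four {pt _ true true}   refl = inj₂ (inj₂ (inj₂ refl))

      -- The gaps pair up the four ends, so one pair determines the other.
      other : ∀ {x y z w} → (∀ {v} → edge v ≡ e → v ≡ x ⊎ v ≡ y ⊎ v ≡ z ⊎ v ≡ w) →
        edge x ≡ e → edge z ≡ e → x ≢ z → y ≢ z → g x ≡ y → g z ≡ w
      other {x} {y} {z} h lx lz x≢z y≢z p with h {g z} (On.at (gap-L (on lz)))
      ... | inj₁ q = ⊥-elim (y≢z (trans (sym p) (inv lz q)))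
      ... | inj₂ (inj₁ q) = ⊥-elim (x≢z (trans (sym (inv lx p)) (inv lz q)))
      ... | inj₂ (inj₂ (inj₁ q)) = ⊥-elim (gap-≢ (on lz) q)
      ... | inj₂ (inj₂ (inj₂ q)) = q

      fourC : ∀ {y} → edge y ≡ e → y ≡ p₀₀ ⊎ y ≡ p₁₀ ⊎ y ≡ p₀₁ ⊎ y ≡ p₁₁
      fourC l = [ inj₁ , [ (λ q → inj₂ (inj₂ (inj₁ q))) , [ (λ q → inj₂ (inj₁ q)) ,
        (λ q → inj₂ (inj₂ (inj₂ q))) ]′ ]′ ]′ (four l)

      fourB : ∀ {y} → edge y ≡ e → y ≡ p₀₀ ⊎ y ≡ p₁₁ ⊎ y ≡ p₀₁ ⊎ y ≡ p₁₀
      fourB l = [ inj₁ , [ (λ q → inj₂ (inj₂ (inj₁ q))) , [ (λ q → inj₂ (inj₂ (inj₂ q))) ,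
        (λ q → inj₂ (inj₁ q)) ]′ ]′ ]′ (four l)

      gapA : g p₀₀ ≡ p₀₁ → ∀ {x} → edge x ≡ e → g x ≡ mA x
      gapA p {pt _ false false} refl = p
      gapA p {pt _ false true}  refl = inv refl p
      gapA p {pt _ true false}  refl = other four refl refl (λ ()) (λ ()) p
      gapA p {pt _ true true}   refl = inv refl (other four refl refl (λ ()) (λ ()) p)

      gapB : g p₀₀ ≡ p₁₁ → ∀ {x} → edge x ≡ e → g x ≡ mB x
      gapB p {pt _ false false} refl = p
      gapB p {pt _ true true}   refl = inv refl p
      gapB p {pt _ false true}  refl = other fourB refl refl (λ ()) (λ ()) p
      gapB p {pt _ true false}  refl = inv refl (other fourB refl refl (λ ()) (λ ()) p)

      gapC : g p₀₀ ≡ p₁₀ → ∀ {x} → edge x ≡ e → g x ≡ mC x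
      gapC p {pt _ false false} refl = p
      gapC p {pt _ true false}  refl = inv refl p
      gapC p {pt _ false true}  refl = other fourC refl refl (λ ()) (λ ()) p
      gapC p {pt _ true true}   refl = inv refl (other fourC refl refl (λ ()) (λ ()) p)

    -- The end that the gap joins to `p₀₀` determines the matching. With `mA` the two boundary
    -- components at e are then one curve, with `mB` the two vertices are one circle, with `mC` both
    -- hold; blocks have to be compared only on the other side of `mA` and `mB`.
    type : ∃ HasType
    type with four (On.at (gap-L {p₀₀} (on refl)))
    ... | inj₁ p = ⊥-elim (gap-≢ (on refl) p)
    ... | inj₂ (inj₁ p) with labC c vert p₀₀ ℕ.≟ labC c vert p₁₀
    ... | yes q = mdel , record
      { gap-t = gapA p
      ; same = λ { vert _ → q ; bdry _ → sym (lg bdry refl p) }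
      ; diff = λ { vert () ; bdry () } }
    ... | no q = del , record
      { gap-t = gapA p
      ; same = λ { vert () ; bdry _ → sym (lg bdry refl p) }
      ; diff = λ { vert _ → q ; bdry () } }
    type | inj₂ (inj₂ (inj₁ p)) = pen , record
      { gap-t = gapC p
      ; same = λ { vert _ → sym (lg vert refl p)
                 ; bdry _ → trans (sym (lm bdry {p₀₀} refl)) (sym (lg bdry refl (gapC p {p₁₁} refl))) }
      ; diff = λ { vert () ; bdry () } }
    type | inj₂ (inj₂ (inj₂ p)) with labC c bdry p₀₀ ℕ.≟ labC c bdry p₀₁
    ... | yes q = mcon , record
      { gap-t = gapB p
      ; same = λ { vert _ → trans (sym (lm vert {p₀₀} refl)) (sym (lg vert refl (gapB p {p₀₁} refl)))
                 ; bdry _ → q }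
      ; diff = λ { vert () ; bdry () } }
    ... | no q = con , record
      { gap-t = gapB p
      ; same = λ { vert _ → trans (sym (lm vert {p₀₀} refl)) (sym (lg vert refl (gapB p {p₀₁} refl)))
                 ; bdry () }
      ; diff = λ { vert () ; bdry _ → q } }

-- Operations at the only edge left

lone : ∀ {n} (e : Fin n) → Removal e (_≡ e) (λ _ → ⊥)
lone e = record { present = refl ; split = inj₁ ; rest = λ () ; absent = λ () }

On-⊥ : ∀ {n} {x : Pt n} → ¬ On (λ _ → ⊥) x
On-⊥ (on ())

sameKind : Kind → Kind → Bool
sameKind kA kA = true
sameKind kB kB = true
sameKind kC kC = true
sameKind _  _  = false

sameKind⇒ : ∀ {k l} → sameKind k l ≡ true → k ≡ l
sameKind⇒ {kA} {kA} _ = refl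
sameKind⇒ {kB} {kB} _ = refl
sameKind⇒ {kC} {kC} _ = refl

-- Two matchings of the four ends of e form two closed curves if they coincide and one otherwise.
-- The curve that is always present, like the first block on either side, belongs to the factor αβγ
-- in front of the matrix.
extraCircles : Op → Op → ℕ
extraCircles o t = b2n (sameKind (kind o) (kind t))

extraBlocks : Side → Op → Op → ℕ
extraBlocks s o t = b2n (not (mergesBlocks s o ∨ mergesBlocks s t))

module _ {n} (e : Fin n) where
  private
    p : Pt n
    p = pt e false false

  aside-≢ : ∀ k → aside k e ≢ p × aside k e ≢ kindM k p
  aside-≢ kA = (λ ()) , (λ ())
  aside-≢ kB = (λ ()) , (λ ())
  aside-≢ kC = (λ ()) , (λ ())

  two-orbits : ∀ k {x} → edge x ≡ e →
    (x ≡ p ⊎ x ≡ kindM k p) ⊎ (x ≡ aside k e ⊎ x ≡ kindM k (aside k e))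
  two-orbits kA {pt _ false false} refl = inj₁ (inj₁ refl)
  two-orbits kA {pt _ false true}  refl = inj₁ (inj₂ refl)
  two-orbits kA {pt _ true false}  refl = inj₂ (inj₁ refl)
  two-orbits kA {pt _ true true}   refl = inj₂ (inj₂ refl)
  two-orbits kB {pt _ false false} refl = inj₁ (inj₁ refl)
  two-orbits kB {pt _ false true}  refl = inj₂ (inj₁ refl)
  two-orbits kB {pt _ true false}  refl = inj₂ (inj₂ refl)
  two-orbits kB {pt _ true true}   refl = inj₁ (inj₂ refl)
  two-orbits kC {pt _ false false} refl = inj₁ (inj₁ refl)
  two-orbits kC {pt _ false true}  refl = inj₂ (inj₁ refl)
  two-orbits kC {pt _ true false}  refl = inj₁ (inj₂ refl)
  two-orbits kC {pt _ true true}   refl = inj₂ (inj₂ refl)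

  -- The reason why different matchings leave a single curve: a step of the second one from p,
  -- possibly followed by a step of the first, reaches the other orbit.
  reach-aside : ∀ k l → sameKind k l ≡ false → aside k e ≡ kindM l p ⊎ aside k e ≡ kindM k (kindM l p)
  reach-aside kA kB _ = inj₂ refl
  reach-aside kA kC _ = inj₁ refl
  reach-aside kB kA _ = inj₁ refl
  reach-aside kB kC _ = inj₂ refl
  reach-aside kC kA _ = inj₁ refl
  reach-aside kC kB _ = inj₂ refl

-- F represents the classes of an equivalence that only relates labels in P.
module Blocks (F : ℕ → ℕ) (E P : List ℕ) (x y : ℕ) (x∈ : x ∈ P) (y∈ : y ∈ P)
  (xy : ∀ {l} → l ∈ P → l ≡ x ⊎ l ≡ y)
  (least : (G : ℕ → ℕ) → (∀ {l l'} → l ∈ P → l' ∈ P → G l ≡ G l') → ∀ l → G (F l) ≡ G l) where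

  private
    -- The test function for `least`: it identifies the labels in P and no others, which shows that
    -- F moves labels only within P.
    collapse : ℕ → ℕ
    collapse l = if any (l ≡ᵇ_) P then x else l

    collapse-dec : ∀ l → ((l ∈ P → ⊥) × collapse l ≡ l) ⊎ (l ∈ P × collapse l ≡ x)
    collapse-dec l with any (l ≡ᵇ_) P in eq
    ... | false = inj₁ ((λ i → contradiction (trans (sym (any-intro i (⇒≡ᵇ {l} refl))) eq) λ ()) , refl)
    ... | true with any-true P eq
    ... | y , i , q = inj₂ (subst (_∈ P) (sym (≡ᵇ⇒ {l} q)) i , refl)

    collapse-in : ∀ {l} → l ∈ P → collapse l ≡ x
    collapse-in {l} i with collapse-dec l
    ... | inj₁ (h , _) = ⊥-elim (h i)
    ... | inj₂ (_ , q) = q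

    collapse-out : ∀ {l} → (l ∈ P → ⊥) → collapse l ≡ l
    collapse-out {l} h with collapse-dec l
    ... | inj₁ (_ , q) = q
    ... | inj₂ (i , _) = ⊥-elim (h i)

    collapse-F : ∀ l → collapse (F l) ≡ collapse l
    collapse-F = least collapse (λ i j → trans (collapse-in i) (sym (collapse-in j)))

    F-out : ∀ {l} → (l ∈ P → ⊥) → F l ≡ l
    F-out {l} h with collapse-dec (F l) | trans (collapse-F l) (collapse-out h)
    ... | inj₁ (_ , q) | r = trans (sym q) r
    ... | inj₂ (i , q) | r = ⊥-elim (h (subst (_∈ P) (trans (sym q) r) x∈))

    F-in : ∀ {l} → l ∈ P → F l ∈ P
    F-in {l} i with collapse-dec (F l)
    ... | inj₂ (j , _) = j
    ... | inj₁ (_ , q) = subst (_∈ P) (trans (sym (trans (collapse-F l) (collapse-in i))) q) x∈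

    split-≐ : map F (E ++ P) ≐ (without P E ++ map F P)
    split-≐ = to , from
      where
      to : ∀ {z} → z ∈ map F (E ++ P) → z ∈ without P E ++ map F P
      to i with ∈-map⁻ F i
      ... | w , j , refl with ∈-++⁻ E j
      ... | inj₂ k = ∈-++⁺ʳ (without P E) (∈-map⁺ F k)
      ... | inj₁ k with ∈-without⁺ P k
      ... | inj₁ m = ∈-++⁺ʳ (without P E) (∈-map⁺ F m)
      ... | inj₂ m = ∈-++⁺ˡ (∈-resp (sym (F-out (proj₂ (∈-without⁻ P E m)))) m)
      from : ∀ {z} → z ∈ without P E ++ map F P → z ∈ map F (E ++ P)
      from i with ∈-++⁻ (without P E) i
      ... | inj₁ m = ∈-resp (F-out (proj₂ (∈-without⁻ P E m)))
              (∈-map⁺ F (∈-++⁺ˡ (proj₁ (∈-without⁻ P E m))))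
      ... | inj₂ m with ∈-map⁻ F m
      ... | w , j , refl = ∈-map⁺ F (∈-++⁺ʳ E j)

    disjoint : ∀ {z} → z ∈ without P E → z ∈ map F P → ⊥
    disjoint i j with ∈-map⁻ F j
    ... | w , k , refl = proj₂ (∈-without⁻ P E i) (F-in k)

    pair-≐ : map F P ≐ (F x ∷ F y ∷ [])
    pair-≐ = to , from
      where
      to : ∀ {z} → z ∈ map F P → z ∈ F x ∷ F y ∷ []
      to i with ∈-map⁻ F i
      ... | w , j , refl = [ (λ r → here (cong F r)) , (λ r → there (here (cong F r))) ]′ (xy j)
      from : ∀ {z} → z ∈ F x ∷ F y ∷ [] → z ∈ map F P
      from (here refl) = ∈-map⁺ F x∈
      from (there (here refl)) = ∈-map⁺ F y∈

  countDistinct-blocks : countDistinct (map F (E ++ P))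
    ≡ countDistinct (without P E) +ℕ countDistinct (F x ∷ F y ∷ [])
  countDistinct-blocks = trans (countDistinct-≐ split-≐) (trans (countDistinct-++ (without P E) disjoint)
    (cong (countDistinct (without P E) +ℕ_) (countDistinct-≐ pair-≐)))

countDistinct-pair : ∀ {x y} b b' → (b ≡ true → x ≡ y) → (b' ≡ true → x ≡ y) →
  (b ≡ false → b' ≡ false → x ≢ y) → countDistinct (x ∷ y ∷ []) ≡ suc (b2n (not (b ∨ b')))
countDistinct-pair {x} {y} true b' h h' k rewrite ⇒≡ᵇ (h refl) = refl
countDistinct-pair {x} {y} false true h h' k rewrite ⇒≡ᵇ (h' refl) = refl
countDistinct-pair {x} {y} false false h h' k with x ≡ᵇ y in eq
... | true  = ⊥-elim (k refl refl (≡ᵇ⇒ eq))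
... | false = refl

module Lone {a} {A : Set a} {n} (c : Core A n) (e : Fin n) (wf : GapWF (_≡ e) (Core.gap c)) where

  labsAt : Side → List ℕ
  labsAt s = map (labC c s) (ptsOf e)

  rest : Side → List ℕ
  rest s = without (labsAt s) (emp (abs c) s)

  edge-ptsOf : ∀ {x : Pt n} → x ∈ ptsOf e → edge x ≡ e
  edge-ptsOf (here refl) = refl
  edge-ptsOf (there (here refl)) = refl
  edge-ptsOf (there (there (here refl))) = refl
  edge-ptsOf (there (there (there (here refl)))) = refl

  ∈-ptsOf-edge : ∀ {x : Pt n} → edge x ≡ e → x ∈ ptsOf e
  ∈-ptsOf-edge {pt _ false false} refl = here refl
  ∈-ptsOf-edge {pt _ false true}  refl = there (here refl)
  ∈-ptsOf-edge {pt _ true false}  refl = there (there (here refl))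
  ∈-ptsOf-edge {pt _ true true}   refl = there (there (there (here refl)))

  labs⁺ : ∀ s {x} → edge x ≡ e → labC c s x ∈ labsAt s
  labs⁺ s l = ∈-map⁺ (labC c s) (∈-ptsOf-edge l)

  labs⁻ : ∀ s {l} → l ∈ labsAt s → ∃ λ x → edge x ≡ e × l ≡ labC c s x
  labs⁻ s i = let x , x∈ , q = ∈-map⁻ (labC c s) i in x , edge-ptsOf x∈ , q

  private
    p : Pt n
    p = pt e false false
    wfA : WF (On (_≡ e)) (abs c)
    wfA = abs-WF c wf

  module Apply (o : Op) where

    K = edgeCut o e (lone e)

    S : Surg K (abs c) (abs (edgeOp o c e))
    S = edgeOp-Surg o (lone e) c wf

    module S = Surg S
    module FS = Final K wfA S On-⊥

    emp-≐ : ∀ s → emp (abs (edgeOp o c e)) s ≐ map (S.F s) (emp (abs c) s ++ labsAt s)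
    emp-≐ s = FS.emp-all s (ptsOf e) edge-ptsOf ∈-ptsOf-edge

    J-merged : ∀ s → mergesBlocks s o ≡ true → ∀ {x y} → edge x ≡ e → edge y ≡ e →
      S.F s (labC c s x) ≡ S.F s (labC c s y)
    J-merged s h lx ly = Merges.joins (S.merges s) (lx , ly , inj₁ h)

    module _ (t : Op) (ty : HasType c e t) where
      open HasType ty
      private
        C = Conn (Core.gap c) (Cut.M K)

        stepM : ∀ {x y} → edge y ≡ e → C x y → C x (kindM (kind o) y)
        stepM l q = stepᶜ q (l , refl)

        stepG : ∀ {x y} → edge y ≡ e → C x y → C x (kindM (kind t) y)
        stepG l q = subst (C _) (gap-t l) (gapᶜ q)

        from-p : sameKind (kind o) (kind t) ≡ false → ∀ {x} → edge x ≡ e → C p x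
        from-p h {x} l with two-orbits e (kind o) {x} l
        ... | inj₁ (inj₁ refl) = here
        ... | inj₁ (inj₂ refl) = stepM refl here
        ... | inj₂ q = on-aside q ([ (λ r → subst (C p) (sym r) (stepG refl here))
            , (λ r → subst (C p) (sym r) (stepM (edge-kindM (kind t) p) (stepG refl here))) ]′
              (reach-aside e (kind o) (kind t) h))
          where
          on-aside : ∀ {x} → x ≡ aside (kind o) e ⊎ x ≡ kindM (kind o) (aside (kind o) e) →
            C p (aside (kind o) e) → C p x
          on-aside (inj₁ refl) w = w
          on-aside (inj₂ refl) w = stepM (edge-aside (kind o) e) w

        small : sameKind (kind o) (kind t) ≡ true → ∀ {x y} → edge x ≡ e → C x y →
          y ≡ x ⊎ y ≡ kindM (kind o) x
        small h l here = inj₁ refl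
        small h {x} l (gapᶜ {y} q) = flip (small h l q)
          where
          ly : edge y ≡ e
          ly = On.at (Conn-L K wfA (on l) q)
          toM : Core.gap c y ≡ opM o y
          toM = trans (gap-t ly) (cong (λ k → kindM k y) (sym (sameKind⇒ h)))
          flip : y ≡ x ⊎ y ≡ kindM (kind o) x → Core.gap c y ≡ x ⊎ Core.gap c y ≡ kindM (kind o) x
          flip (inj₁ refl) = inj₂ toM
          flip (inj₂ r) = inj₁ (trans toM (trans (cong (opM o) r) (kindM-inv (kind o) x)))
        small h {x} l (stepᶜ {y} q (_ , refl)) with small h l q
        ... | inj₁ refl = inj₂ refl
        ... | inj₂ r = inj₁ (trans (cong (opM o) r) (kindM-inv (kind o) x))

      circles : length S.ls ≡ suc (extraCircles o t)
      circles = go (sameKind (kind o) (kind t)) refl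
        where
        q = aside (kind o) e
        lq = edge-aside (kind o) e
        cov : ∀ {x} → edge x ≡ e → Any (C x) (p ∷ q ∷ [])
        cov {x} l with two-orbits e (kind o) {x} l
        ... | inj₁ (inj₁ refl) = here here
        ... | inj₁ (inj₂ refl) = here (Conn-sym K wfA (on refl) (stepM refl here))
        ... | inj₂ (inj₁ refl) = there (here here)
        ... | inj₂ (inj₂ refl) = there (here (Conn-sym K wfA (on lq) (stepM lq here)))
        go : ∀ b → sameKind (kind o) (kind t) ≡ b → length S.ls ≡ suc (b2n b)
        go false eq = FS.transversal-length {p ∷ []} (refl ∷ []) ([] ∷ [])
          (λ d → here (Conn-sym K wfA (on refl) (from-p eq d)))
        go true eq = FS.transversal-length {p ∷ q ∷ []} (refl ∷ lq ∷ [])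
          (((λ r → [ proj₁ (aside-≢ e (kind o)) , proj₂ (aside-≢ e (kind o)) ]′ (small eq refl r)) ∷ [])
            ∷ [] ∷ []) cov

      circle-count : len (abs (edgeOp o c e)) ≡ len (abs c) +ℕ suc (extraCircles o t)
      circle-count = trans S.len-eq (cong (len (abs c) +ℕ_) circles)

      block-count : ∀ s → countDistinct (emp (abs (edgeOp o c e)) s)
        ≡ countDistinct (rest s) +ℕ suc (extraBlocks s o t)
      block-count s = trans (countDistinct-≐ (emp-≐ s)) (trans
        (Blocks.countDistinct-blocks (S.F s) (emp (abs c) s) (labsAt s) _ _
          (labs⁺ s refl) (labs⁺ s (edge-aside (kindS s) e))
          (λ i → let x , l , r = labs⁻ s i in
            [ (λ q → inj₁ (trans r q)) , (λ q → inj₂ (trans r q)) ]′ (lab-corner c wf refl s x l))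
          (λ G h → Merges.least (S.merges s) G (λ { (lx , ly , _) → h (labs⁺ s lx) (labs⁺ s ly) })))
        (cong (countDistinct (rest s) +ℕ_) (countDistinct-pair (mergesBlocks s o) (mergesBlocks s t)
          (λ h → J-merged s h refl (edge-aside (kindS s) e)) (λ h → cong (S.F s) (same s h))
          (λ h h' r → diff s h' (trans (sym (F-id s h _)) (trans r (F-id s h _)))))))
        where
        -- An operation that merges nothing on side s joins equal labels only, so the identity is an
        -- admissible test function and F fixes every label.
        F-id : ∀ s → mergesBlocks s o ≡ false → ∀ l → S.F s l ≡ l
        F-id s eo = Merges.least (S.merges s) (λ l → l) λ
          { (lx , ly , inj₁ h) → contradiction (trans (sym h) eo) λ ()
          ; (lx , ly , inj₂ refl) → sym (labC-mS c wf s (on lx)) }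

-- The 2-sum along the only edges left

lookupBy : {X : Set} → (X → ℕ) → (X → ℕ) → (ℕ → ℕ) → List X → ℕ → ℕ
lookupBy key val default []       l = default l
lookupBy key val default (x ∷ xs) l = if l ≡ᵇ key x then val x else lookupBy key val default xs l

lookupBy-in : {X : Set} (key val : X → ℕ) (default : ℕ → ℕ) (xs : List X) {x : X} → x ∈ xs →
  (∀ {y} → y ∈ xs → key x ≡ key y → val y ≡ val x) → lookupBy key val default xs (key x) ≡ val x
lookupBy-in key val default (y ∷ ys) {x} i h with key x ≡ᵇ key y in eq
... | true = h (here refl) (≡ᵇ⇒ eq)
lookupBy-in key val default (y ∷ ys) (here refl) h | false
  with () ← trans (sym (⇒≡ᵇ {key y} refl)) eq
lookupBy-in key val default (y ∷ ys) (there i) h | false =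
  lookupBy-in key val default ys i (λ j → h (there j))

lookupBy-out : {X : Set} (key val : X → ℕ) (default : ℕ → ℕ) (xs : List X) {l : ℕ} →
  (l ∈ map key xs → ⊥) → lookupBy key val default xs l ≡ default l
lookupBy-out key val default [] h = refl
lookupBy-out key val default (y ∷ ys) {l} h with l ≡ᵇ key y in eq
... | true  = ⊥-elim (h (here (≡ᵇ⇒ eq)))
... | false = lookupBy-out key val default ys (λ i → h (there i))

-- The coupling on the ends of the two edges. The inverse coupling has the same s, so one formula
-- serves in both directions.
moveTo : ∀ {n₁ n₂} → Fin n₂ → Bool → Pt n₁ → Pt n₂
moveTo e s (pt _ x h) = pt e (x xor s) h

not-xor : ∀ x s → not x xor s ≡ not (x xor s)
not-xor true  s = sym (not-involutive s)
not-xor false s = refl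

moveTo-kindM : ∀ {n₁ n₂} (e : Fin n₂) s k (x : Pt n₁) → moveTo e s (kindM k x) ≡ kindM k (moveTo e s x)
moveTo-kindM e s kA x = refl
moveTo-kindM e s kB (pt _ x h) = cong (λ z → pt e z (not h)) (not-xor x s)
moveTo-kindM e s kC (pt _ x h) = cong (λ z → pt e z h) (not-xor x s)

moveTo-back : ∀ {n₁ n₂} (e : Fin n₂) (f : Fin n₁) s {x : Pt n₁} → edge x ≡ f →
  moveTo f s (moveTo e s x) ≡ x
moveTo-back e f s {pt _ x h} refl = cong (λ z → pt f z h) (xor-twice f e s x)

module LoneSum {a} {A : Set a} (P : PAP A) (f : Fin (n P)) (H : PAP A) (e : Fin (n H)) (s : Bool)
  (wf₁ : GapWF (_≡ f) (Core.gap (core P))) (wf₂ : GapWF (_≡ e) (Core.gap (core H)))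
  (t : Op) (ty : HasType (core H) e t) where

  private
    n₁ = n P
    n₂ = n H
    c₁ = core P
    c₂ = core H
    U = core (union P H)
    wfU : GapWF ((_≡ f) ⊕ (_≡ e)) (Core.gap U)
    wfU = union-WF P H wf₁ wf₂
    wfA : WF (On ((_≡ f) ⊕ (_≡ e))) (abs U)
    wfA = abs-WF U wfU
    K = sumCut f e s (lone f) (lone e)

    S : Surg K (abs U) (abs (sumCore P f H e s))
    S = twoSum-Surg P f H e s (lone f) (lone e) wf₁ wf₂

    none : ∀ {x} → ¬ On ((λ (_ : Fin n₁) → ⊥) ⊕ (λ (_ : Fin n₂) → ⊥)) x
    none (on (inˡ ()))
    none (on (inʳ ()))

    module S = Surg S
    module FS = Final K wfA S none
    module LP = Lone c₁ f wf₁
    module LH = Lone c₂ e wf₂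
    module T = LP.Apply t
    module TS = Surg T.S
    open HasType ty

    τ : Pt n₁ → Pt n₂
    τ = moveTo e s
    σ : Pt n₂ → Pt n₁
    σ = moveTo f s

    gl : Pt (n₁ +ℕ n₂) → Pt (n₁ +ℕ n₂)
    gl = glue f e s

    C₁ = Conn (Core.gap c₁) (Cut.M T.K)
    C = Conn (Core.gap U) (Cut.M K)

    gl-inL : ∀ {x} → edge x ≡ f → gl (inL n₂ x) ≡ inR n₁ (τ x)
    gl-inL {pt _ x h} refl = glue-F f e s x h

    gl-inR : ∀ {y} → edge y ≡ e → gl (inR n₁ y) ≡ inL n₂ (σ y)
    gl-inR {pt _ x h} refl = glue-E f e s x h

    gluedL : ∀ {x} → edge x ≡ f → glued f e s (inL n₂ x)
    gluedL p = inj₁ (cong (_↑ˡ n₂) p)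

    gluedR : ∀ {y} → edge y ≡ e → glued f e s (inR n₁ y)
    gluedR p = inj₂ (cong (n₁ ↑ʳ_) p)

    gapH-τ : ∀ x → Core.gap c₂ (τ x) ≡ τ (opM t x)
    gapH-τ x = trans (gap-t {τ x} refl) (sym (moveTo-kindM e s (kind t) x))

    on-f : ∀ {x y} → edge x ≡ f → C₁ x y → edge y ≡ f
    on-f l q = On.at (Conn-L T.K (abs-WF c₁ wf₁) (on l) q)

    fore : ∀ {x y} → edge x ≡ f → C₁ x y → C (inL n₂ x) (inL n₂ y)
    fore l here = here
    fore l (gapᶜ {y} q) = subst (C _) (gap-inL P H y) (gapᶜ (fore l q))
    -- One identification by `opM t` is a detour through H: over to e, along the gap of H, which has
    -- type t, and back to f.
    fore l (stepᶜ {y} q (ly , refl)) =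
      stepᶜ (subst (C _) (trans (gap-inR P H (τ y)) (cong (inR n₁) (gapH-τ y)))
              (gapᶜ (stepᶜ (fore l q) (gluedL {y} ly , sym (gl-inL ly)))))
        (gluedR {τ (opM t y)} refl , sym (trans (gl-inR {τ (opM t y)} refl)
          (cong (inL n₂) (moveTo-back e f s (trans (edge-kindM (kind t) y) ly)))))

    -- A path in the union projects to P: a point of H is read as its partner at f, gluing steps
    -- then stay in place, and the gap of H acts as `opM t`.
    back : ∀ {x z} → edge x ≡ f → C (inL n₂ x) z →
      ∃ λ y → C₁ x y × (z ≡ inL n₂ y ⊎ z ≡ inR n₁ (τ y))
    back l here = _ , here , inj₁ refl
    back l (gapᶜ q) with back l q
    ... | y , r , inj₁ refl = _ , gapᶜ r , inj₁ (gap-inL P H y)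
    ... | y , r , inj₂ refl = opM t y , stepᶜ r (on-f l r , refl) ,
            inj₂ (trans (gap-inR P H (τ y)) (cong (inR n₁) (gapH-τ y)))
    back l (stepᶜ q (d , refl)) with back l q
    ... | y , r , inj₁ refl = y , r , inj₂ (gl-inL (on-f l r))
    ... | y , r , inj₂ refl = y , r , inj₁ (trans (gl-inR {τ y} refl)
            (cong (inL n₂) (moveTo-back e f s (on-f l r))))

    back-L : ∀ {x y} → edge x ≡ f → C (inL n₂ x) (inL n₂ y) → C₁ x y
    back-L l q with back l q
    ... | y , r , inj₁ p = subst (C₁ _) (sym (inL-injective n₂ p)) r
    ... | y , r , inj₂ p = ⊥-elim (inL≢inR p)

    apart : ∀ {xs} → All (λ x → edge x ≡ f) xs → AllPairs (λ x y → ¬ C₁ x y) xs →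
      AllPairs (λ x y → ¬ C (inL n₂ x) (inL n₂ y)) xs
    apart [] [] = []
    apart (l ∷ ls) (n ∷ ns) = All.map (λ n c → n (back-L l c)) n ∷ apart ls ns

    coverL : ∀ {x} → edge x ≡ f → Any (C (inL n₂ x)) (map (inL n₂) TS.ls)
    coverL l = Any.map⁺ (Any.map (fore l) (T.FS.cover-all l))

    coverR : ∀ {y} → edge y ≡ e → Any (C (inR n₁ y)) (map (inL n₂) TS.ls)
    coverR {y} l = Any.map (Conn-trans (stepᶜ here (gluedR {y} l , sym (gl-inR l)))) (coverL {σ y} refl)

    cover : ∀ {z} → glued f e s z → Any (C z) (map (inL n₂) TS.ls)
    cover {pt _ x h} (inj₁ refl) = coverL {pt f x h} refl
    cover {pt _ x h} (inj₂ refl) = coverR {pt e x h} refl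

    circles : length S.ls ≡ length TS.ls
    circles = trans (FS.transversal-length {map (inL n₂) TS.ls}
      (All.map⁺ (All.map (λ {x} → gluedL {x}) TS.ls-D)) (AllPairs.map⁺ (apart TS.ls-D TS.ls-apart)) cover)
      (length-map (inL n₂) TS.ls)

  sum-circles : len (abs (sumCore P f H e s)) ≡ len (abs c₂) +ℕ len (abs (edgeOp t c₁ f))
  sum-circles = trans S.len-eq (trans (cong₂ _+ℕ_ (trans (len-union P H wf₁ wf₂)
      (ℕ.+-comm (len (abs c₁)) (len (abs c₂)))) circles)
    (trans (ℕ.+-assoc (len (abs c₂)) (len (abs c₁)) (length TS.ls))
      (cong (len (abs c₂) +ℕ_) (sym TS.len-eq))))

  module _ (side : Side) where
    private
      labP = labC c₁ side
      labH = labC c₂ side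
      labU = labC U side
      F = S.F side
      Ft = TS.F side
      W = emp (abs c₁) side ++ LP.labsAt side
      rest = LH.rest side

      labU-L : ∀ {x} → edge x ≡ f → labU (inL n₂ x) ≡ even (labP x)
      labU-L l = labC-inL P H wf₁ wf₂ side (on l)

      labU-R : ∀ {y} → edge y ≡ e → labU (inR n₁ y) ≡ odd (labH y)
      labU-R l = labC-inR P H wf₁ wf₂ side (on l)

      F-glue : ∀ {x} → edge x ≡ f → F (even (labP x)) ≡ F (odd (labH (τ x)))
      F-glue {x} l = trans (cong F (sym (labU-L l))) (trans
        (Merges.joins (S.merges side) (gluedL {x} l , refl))
        (trans (cong (λ z → F (labU z)) (gl-inL l)) (cong F (labU-R {τ x} refl))))

      F-glue′ : ∀ {y} → edge y ≡ e → F (odd (labH y)) ≡ F (even (labP (σ y)))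
      F-glue′ {y} l = trans (cong (λ z → F (odd (labH z))) (sym (moveTo-back f e s l)))
        (sym (F-glue {σ y} refl))

      labH-merged : mergesBlocks side t ≡ true → ∀ {x y} → edge x ≡ e → edge y ≡ e → labH x ≡ labH y
      labH-merged h {x} {y} lx ly = trans (to-p lx) (sym (to-p ly))
        where
        to-p : ∀ {x} → edge x ≡ e → labH x ≡ labH (pt e false false)
        to-p {x} l = [ (λ q → q) , (λ q → trans q (sym (same side h))) ]′ (lab-corner c₂ wf₂ refl side x l)

      -- Whatever t merges in P is merged by the 2-sum too: if t merges blocks, all ends of e carry
      -- one label in H, and gluing joins the blocks of P at f through it.
      F-Ft : ∀ l → F (even (Ft l)) ≡ F (even l)
      F-Ft = Merges.least (TS.merges side) (λ l → F (even l)) λ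
        { {x} {y} (lx , ly , inj₁ h) → trans (F-glue lx) (trans
            (cong (λ z → F (odd z)) (labH-merged h {τ x} {τ y} refl refl)) (sym (F-glue ly)))
        ; {x} (lx , ly , inj₂ refl) → cong (λ z → F (even z)) (sym (labC-mS c₁ wf₁ side (on lx))) }

      Ft-idem : ∀ l → Ft (Ft l) ≡ Ft l
      Ft-idem = Merges.least (TS.merges side) Ft (Merges.joins (TS.merges side))

      val : Pt n₂ → ℕ
      val y = even (Ft (labP (σ y)))

      InClass : Pt n₂ → Pt n₂ → Set
      InClass b x = x ≡ b ⊎ x ≡ mS side b

      class-lab : ∀ {b x} → edge b ≡ e → InClass b x → labH x ≡ labH b × labP (σ x) ≡ labP (σ b)
      class-lab l (inj₁ refl) = refl , refl
      class-lab {b} l (inj₂ refl) = labC-mS c₂ wf₂ side (on l)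
        , trans (cong labP (moveTo-kindM f s (kindS side) b)) (labC-mS c₁ wf₁ side (on refl))

      classes : ∀ {x} → edge x ≡ e → InClass (pt e false false) x ⊎ InClass (corner side e) x
      classes {x} l = two-orbits e (kindS side) {x} l

      separate : mergesBlocks side t ≡ false → ∀ {x y} → edge x ≡ e → edge y ≡ e → labH x ≡ labH y →
        labP (σ x) ≡ labP (σ y)
      separate h {x} {y} lx ly q = go (classes {x} lx) (classes {y} ly)
        where
        p₀ : Pt n₂
        p₀ = pt e false false
        go : InClass p₀ x ⊎ InClass (corner side e) x → InClass p₀ y ⊎ InClass (corner side e) y →
          labP (σ x) ≡ labP (σ y)
        go (inj₁ i) (inj₁ j) = trans (proj₂ (class-lab refl i)) (sym (proj₂ (class-lab refl j)))
        go (inj₂ i) (inj₂ j) = trans (proj₂ (class-lab (edge-aside (kindS side) e) i))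
          (sym (proj₂ (class-lab (edge-aside (kindS side) e) j)))
        go (inj₁ i) (inj₂ j) = ⊥-elim (diff side h (trans (sym (proj₁ (class-lab refl i)))
          (trans q (proj₁ (class-lab (edge-aside (kindS side) e) j)))))
        go (inj₂ i) (inj₁ j) = ⊥-elim (diff side h (trans (sym (proj₁ (class-lab refl j)))
          (trans (sym q) (proj₁ (class-lab (edge-aside (kindS side) e) i)))))

      -- Makes `val` well defined on labels. If t merges blocks, all labels of P at f have one image
      -- under `Ft`; otherwise the two blocks of H at e differ, so ends of e with equal labels have
      -- partners in one block of P.
      consistent : ∀ b → mergesBlocks side t ≡ b → ∀ {x y} → edge x ≡ e → edge y ≡ e →
        labH x ≡ labH y → val y ≡ val x
      consistent true h lx ly q = cong even (T.J-merged side h refl refl)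
      consistent false h lx ly q = cong (λ z → even (Ft z)) (sym (separate h lx ly q))

      kO : ℕ → ℕ
      -- The default `odd` lets the blocks of H away from e keep their names.
      kO = lookupBy labH val odd (ptsOf e)

      kO-in : ∀ {y} → edge y ≡ e → kO (labH y) ≡ val y
      kO-in l = lookupBy-in labH val odd (ptsOf e) (LH.∈-ptsOf-edge l)
        (λ i → consistent (mergesBlocks side t) refl l (LH.edge-ptsOf i))

      -- An explicit F: blocks of H at e are named after the blocks of P they join.
      κ : ℕ → ℕ
      κ l = [ (λ k → even (Ft k)) , kO ]′ (parity l)

      κ-even : ∀ l → κ (even l) ≡ even (Ft l)
      κ-even l = cong [ (λ k → even (Ft k)) , kO ]′ (parity-even l)

      κ-odd : ∀ l → κ (odd l) ≡ kO l
      κ-odd l = cong [ (λ k → even (Ft k)) , kO ]′ (parity-odd l)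

      κ-rest : ∀ {l} → l ∈ rest → κ (odd l) ≡ odd l
      κ-rest {l} i = trans (κ-odd l) (lookupBy-out labH val odd (ptsOf e)
        (proj₂ (∈-without⁻ (LH.labsAt side) (emp (abs c₂) side) i)))

      κ-glue : ∀ {x} → edge x ≡ f → κ (labU (inL n₂ x)) ≡ κ (labU (inR n₁ (τ x)))
      κ-glue {x} l = trans (cong κ (labU-L l)) (trans (κ-even (labP x)) (sym (trans
        (cong κ (labU-R {τ x} refl)) (trans (κ-odd (labH (τ x))) (trans (kO-in {τ x} refl)
          (cong (λ z → even (Ft (labP z))) (moveTo-back e f s l)))))))

      κ-J : ∀ {z} → glued f e s z → κ (labU z) ≡ κ (labU (gl z))
      κ-J {pt _ x h} (inj₁ refl) = trans (κ-glue {pt f x h} refl)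
        (cong (λ z → κ (labU z)) (sym (gl-inL {pt f x h} refl)))
      κ-J {pt _ x h} (inj₂ refl) = trans
        (cong (λ z → κ (labU (inR n₁ z))) (sym (moveTo-back f e s {pt e x h} refl)))
        (trans (sym (κ-glue {σ (pt e x h)} refl))
          (cong (λ z → κ (labU z)) (sym (gl-inR {pt e x h} refl))))

      κ-F : ∀ l → κ (F l) ≡ κ l
      κ-F = Merges.least (S.merges side) κ (λ { (d , refl) → κ-J d })

      -- Labels of H at e are left out, since gluing identifies them with labels of P at f.
      Z = map even W ++ map odd rest
      Z' = map even (map Ft W) ++ map odd rest

      Z-cases : ∀ {w} → w ∈ Z → κ w ∈ Z' × F (κ w) ≡ F w
      Z-cases i with ∈-++⁻ (map even W) i
      ... | inj₁ j with ∈-map⁻ even j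
      ... | l , l∈ , refl = ∈-resp (sym (κ-even l)) (∈-++⁺ˡ (∈-map⁺ even (∈-map⁺ Ft l∈)))
                          , trans (cong F (κ-even l)) (F-Ft l)
      Z-cases i | inj₂ j with ∈-map⁻ odd j
      ... | l , l∈ , refl = ∈-resp (sym (κ-rest l∈)) (∈-++⁺ʳ (map even (map Ft W)) (∈-map⁺ odd l∈))
                          , cong F (κ-rest l∈)

      Z'-cases : ∀ {z} → z ∈ Z' → F z ∈ map F Z × κ z ≡ z
      Z'-cases i with ∈-++⁻ (map even (map Ft W)) i
      ... | inj₂ j with ∈-map⁻ odd j
      ... | l , l∈ , refl = ∈-map⁺ F (∈-++⁺ʳ (map even W) (∈-map⁺ odd l∈)) , κ-rest l∈
      Z'-cases i | inj₁ j with ∈-map⁻ even j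
      ... | l' , l'∈ , refl with ∈-map⁻ Ft l'∈
      ... | l , l∈ , refl = ∈-resp (sym (F-Ft l)) (∈-map⁺ F (∈-++⁺ˡ (∈-map⁺ even l∈)))
                          , trans (κ-even (Ft l)) (cong even (Ft-idem l))

      -- F and κ are mutually inverse between the two sets: κ takes equal values at l and `F l`, F
      -- takes equal values at w and `κ w` for w in Z, and κ fixes Z' pointwise.
      count-Z : countDistinct (map F Z) ≡ countDistinct Z'
      count-Z = ℕ.≤-antisym
        (countDistinct-≤ {map F Z} {Z'} κ F λ i → let w , w∈ , p = ∈-map⁻ F i in
          ∈-resp (sym (trans (cong κ p) (κ-F w))) (proj₁ (Z-cases w∈))
          , trans (cong F (trans (cong κ p) (κ-F w))) (trans (proj₂ (Z-cases w∈)) (sym p)))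
        (countDistinct-≤ {Z'} {map F Z} F κ λ {z} i →
          proj₁ (Z'-cases i) , trans (κ-F z) (proj₂ (Z'-cases i)))

      even≢odd : ∀ {k l} → even k ≢ odd l
      even≢odd {k} {l} p with () ← trans (sym (parity-even k)) (trans (cong parity p) (parity-odd l))

      count-Z' : countDistinct Z' ≡ countDistinct rest +ℕ countDistinct (map Ft W)
      count-Z' = trans (countDistinct-++ (map even (map Ft W)) (λ i j →
          let k , _ , p = ∈-map⁻ even i ; l , _ , q = ∈-map⁻ odd j in even≢odd {k} {l} (trans (sym p) q)))
        (trans (cong₂ _+ℕ_
          (countDistinct-map even (λ l → [ (λ k → k) , (λ k → k) ]′ (parity l))
            (λ l → cong [ (λ k → k) , (λ k → k) ]′ (parity-even l)) (map Ft W))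
          (countDistinct-map odd (λ l → [ (λ k → k) , (λ k → k) ]′ (parity l))
            (λ l → cong [ (λ k → k) , (λ k → k) ]′ (parity-odd l)) rest))
          (ℕ.+-comm (countDistinct (map Ft W)) (countDistinct rest)))

      ends : List (Pt (n₁ +ℕ n₂))
      ends = map (inL n₂) (ptsOf f) ++ map (inR n₁) (ptsOf e)

      ends-glued : ∀ {x} → x ∈ ends → glued f e s x
      ends-glued i with ∈-++⁻ (map (inL n₂) (ptsOf f)) i
      ... | inj₁ j = let x , x∈ , p = ∈-map⁻ (inL n₂) j in
              subst (glued f e s) (sym p) (gluedL {x} (LP.edge-ptsOf x∈))
      ... | inj₂ j = let x , x∈ , p = ∈-map⁻ (inR n₁) j in
              subst (glued f e s) (sym p) (gluedR {x} (LH.edge-ptsOf x∈))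

      glued-ends : ∀ {x} → glued f e s x → x ∈ ends
      glued-ends {pt _ x h} (inj₁ refl) =
        ∈-++⁺ˡ (∈-map⁺ (inL n₂) (LP.∈-ptsOf-edge {pt f x h} refl))
      glued-ends {pt _ x h} (inj₂ refl) =
        ∈-++⁺ʳ (map (inL n₂) (ptsOf f)) (∈-map⁺ (inR n₁) (LH.∈-ptsOf-edge {pt e x h} refl))

      source : ∀ {w} → w ∈ emp (abs U) side ++ map labU ends → F w ∈ map F Z
      source i with ∈-++⁻ (emp (abs U) side) i
      ... | inj₂ j with ∈-map⁻ labU j
      ... | z , z∈ , refl = atEnd (∈-++⁻ (map (inL n₂) (ptsOf f)) z∈)
        where
        atP : ∀ {x} → edge x ≡ f → F (even (labP x)) ∈ map F Z
        atP l = ∈-map⁺ F (∈-++⁺ˡ (∈-map⁺ even (∈-++⁺ʳ (emp (abs c₁) side) (LP.labs⁺ side l))))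
        atEnd : ∀ {z} → z ∈ map (inL n₂) (ptsOf f) ⊎ z ∈ map (inR n₁) (ptsOf e) → F (labU z) ∈ map F Z
        atEnd (inj₁ k) = let x , x∈ , p = ∈-map⁻ (inL n₂) k ; l = LP.edge-ptsOf x∈ in
          ∈-resp (sym (trans (cong (λ z → F (labU z)) p) (cong F (labU-L l)))) (atP l)
        atEnd (inj₂ k) = let y , y∈ , p = ∈-map⁻ (inR n₁) k ; l = LH.edge-ptsOf y∈ in
          ∈-resp (sym (trans (cong (λ z → F (labU z)) p) (trans (cong F (labU-R l)) (F-glue′ l))))
            (atP {σ y} refl)
      source i | inj₁ j with ∈-++⁻ (map even (emp (abs c₁) side))
                          (subst (_ ∈_) (emp-union P H wf₁ wf₂ side) j)
      ... | inj₁ k with ∈-map⁻ even k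
      ... | l , l∈ , refl = ∈-map⁺ F (∈-++⁺ˡ (∈-map⁺ even (∈-++⁺ˡ l∈)))
      source i | inj₁ j | inj₂ k with ∈-map⁻ odd k
      ... | l , l∈ , refl with ∈-without⁺ (LH.labsAt side) l∈
      ... | inj₂ m = ∈-map⁺ F (∈-++⁺ʳ (map even W) (∈-map⁺ odd m))
      ... | inj₁ m with LH.labs⁻ side m
      ... | y , ly , refl = ∈-resp (sym (F-glue′ ly))
              (∈-map⁺ F (∈-++⁺ˡ (∈-map⁺ even (∈-++⁺ʳ (emp (abs c₁) side) (LP.labs⁺ side {σ y} refl)))))

      target : ∀ {w} → w ∈ Z → F w ∈ map F (emp (abs U) side ++ map labU ends)
      target i with ∈-++⁻ (map even W) i
      ... | inj₂ j with ∈-map⁻ odd j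
      ... | l , l∈ , refl = ∈-map⁺ F (∈-++⁺ˡ (subst (_ ∈_) (sym (emp-union P H wf₁ wf₂ side))
              (∈-++⁺ʳ (map even (emp (abs c₁) side)) (∈-map⁺ odd
                (proj₁ (∈-without⁻ (LH.labsAt side) (emp (abs c₂) side) l∈))))))
      target i | inj₁ j with ∈-map⁻ even j
      ... | l , l∈ , refl with ∈-++⁻ (emp (abs c₁) side) l∈
      ... | inj₁ k = ∈-map⁺ F (∈-++⁺ˡ (subst (_ ∈_) (sym (emp-union P H wf₁ wf₂ side))
              (∈-++⁺ˡ (∈-map⁺ even k))))
      ... | inj₂ k with LP.labs⁻ side k
      ... | x , lx , refl = ∈-map⁺ F (∈-++⁺ʳ (emp (abs U) side)
              (∈-resp (labU-L lx) (∈-map⁺ labU (glued-ends (gluedL {x} lx)))))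

      image-⊆ : ∀ {X Y : List ℕ} → (∀ {w} → w ∈ X → F w ∈ map F Y) → ∀ {z} → z ∈ map F X → z ∈ map F Y
      image-⊆ h i = let w , w∈ , p = ∈-map⁻ F i in ∈-resp (sym p) (h w∈)

    sum-blocks : countDistinct (emp (abs (sumCore P f H e s)) side)
      ≡ countDistinct (LH.rest side) +ℕ countDistinct (emp (abs (edgeOp t c₁ f)) side)
    sum-blocks = trans (countDistinct-≐ (FS.emp-all side ends ends-glued glued-ends))
      (trans (countDistinct-≐ (image-⊆ source , image-⊆ target))
      (trans count-Z (trans count-Z'
        (cong (countDistinct rest +ℕ_) (sym (countDistinct-≐ (T.emp-≐ side)))))))

-- Edge lists of 2-sums

Removal-second : ∀ {n} {f g : Fin n} {es} → Unique (f ∷ g ∷ es) → Removal g (_∈ f ∷ g ∷ es) (_∈ f ∷ es)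
Removal-second ((f≢g ∷ _) ∷ u ∷ _) = record
  { present = there (here refl)
  ; split = λ { (here p) → inj₂ (here p) ; (there (here p)) → inj₁ p ; (there (there i)) → inj₂ (there i) }
  ; rest = λ { (here p) → here p ; (there i) → there (there i) }
  ; absent = λ { (here p) → f≢g (sym p) ; (there i) → All.lookup u i refl } }

Unique-second : ∀ {n} {f g : Fin n} {es} → Unique (f ∷ g ∷ es) → Unique (f ∷ es)
Unique-second ((_ ∷ u) ∷ _ ∷ us) = u ∷ us

module _ {n₁ n₂ : ℕ} where

  sumList : List (Fin n₁) → List (Fin n₂) → List (Fin (n₁ +ℕ n₂))
  sumList l₁ l₂ = map (_↑ˡ n₂) l₁ ++ map (n₁ ↑ʳ_) l₂

  ∈-sumList⁺ : ∀ {l₁ l₂ j} → ((_∈ l₁) ⊕ (_∈ l₂)) j → j ∈ sumList l₁ l₂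
  ∈-sumList⁺ (inˡ i) = ∈-++⁺ˡ (∈-map⁺ (_↑ˡ n₂) i)
  ∈-sumList⁺ {l₁} (inʳ i) = ∈-++⁺ʳ (map (_↑ˡ n₂) l₁) (∈-map⁺ (n₁ ↑ʳ_) i)

  ∈-sumList⁻ : ∀ l₁ {l₂ j} → j ∈ sumList l₁ l₂ → ((_∈ l₁) ⊕ (_∈ l₂)) j
  ∈-sumList⁻ l₁ i with ∈-++⁻ (map (_↑ˡ n₂) l₁) i
  ... | inj₁ k with ∈-map⁻ (_↑ˡ n₂) k
  ... | x , x∈ , refl = inˡ x∈
  ∈-sumList⁻ l₁ i | inj₂ k with ∈-map⁻ (n₁ ↑ʳ_) k
  ... | x , x∈ , refl = inʳ x∈

  sumList-unique : ∀ {l₁ l₂} → Unique l₁ → Unique l₂ → Unique (sumList l₁ l₂)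
  sumList-unique u₁ u₂ = AllPairs.++⁺
    (AllPairs.map⁺ (AllPairs.map (λ h p → h (Fin.↑ˡ-injective n₂ _ _ p)) u₁))
    (AllPairs.map⁺ (AllPairs.map (λ h p → h (Fin.↑ʳ-injective n₁ _ _ p)) u₂))
    (All.map⁺ (All.tabulate λ _ → All.map⁺ (All.tabulate λ _ → ↑ˡ≢↑ʳ n₂ _ _)))

removeF-++ : ∀ {n} (e : Fin n) xs ys → removeF e (xs ++ ys) ≡ removeF e xs ++ removeF e ys
removeF-++ e xs ys = filter-++ (λ j → T? (not (finEq e j))) xs ys

removeF-map : ∀ {n m} (h : Fin n → Fin m) → (∀ {i j} → h i ≡ h j → i ≡ j) → ∀ e xs →
  removeF (h e) (map h xs) ≡ map h (removeF e xs)
removeF-map h inj e [] = refl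
removeF-map h inj e (x ∷ xs) with finEq e x in p | finEq (h e) (h x) in q
... | true  | true  = removeF-map h inj e xs
... | false | false = cong (h x ∷_) (removeF-map h inj e xs)
... | true  | false with () ← trans (sym (⇒finEq (cong h (finEq⇒ {i = e} p)))) q
... | false | true  with () ← trans (sym (⇒finEq (inj (finEq⇒ {i = h e} q)))) p

removeF-sumList : ∀ {n₁ n₂} (f : Fin n₁) (e : Fin n₂) l₁ l₂ →
  removeF (f ↑ˡ n₂) (removeF (n₁ ↑ʳ e) (sumList l₁ l₂)) ≡ sumList (removeF f l₁) (removeF e l₂)
removeF-sumList {n₁} {n₂} f e l₁ l₂ = trans (cong (removeF (f ↑ˡ n₂)) (trans
    (removeF-++ (n₁ ↑ʳ e) (map (_↑ˡ n₂) l₁) (map (n₁ ↑ʳ_) l₂))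
    (cong₂ _++_ (removeF-absent {e = n₁ ↑ʳ e} (map (_↑ˡ n₂) l₁)
        (λ i → let x , _ , p = ∈-map⁻ (_↑ˡ n₂) i in ↑ˡ≢↑ʳ n₂ x e (sym p)))
      (removeF-map (n₁ ↑ʳ_) (Fin.↑ʳ-injective n₁ _ _) e l₂))))
  (trans (removeF-++ (f ↑ˡ n₂) (map (_↑ˡ n₂) l₁) (map (n₁ ↑ʳ_) (removeF e l₂)))
    (cong₂ _++_ (removeF-map (_↑ˡ n₂) (Fin.↑ˡ-injective n₂ _ _) f l₁)
      (removeF-absent {e = f ↑ˡ n₂} (map (n₁ ↑ʳ_) (removeF e l₂))
        (λ i → let x , _ , p = ∈-map⁻ (n₁ ↑ʳ_) i in ↑ˡ≢↑ʳ n₂ f x p))))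

removeF-head : ∀ {n} {e : Fin n} {es} → Unique (e ∷ es) → removeF e (e ∷ es) ≡ es
removeF-head {e = e} {es} (u ∷ _) with finEq e e in p
... | true  = removeF-absent es (λ i → All.lookup u i refl)
... | false with () ← trans (sym (⇒finEq {i = e} refl)) p

removeF-sumList-right : ∀ {n₁ n₂} (g : Fin n₂) (l₁ : List (Fin n₁)) l₂ → Unique (g ∷ l₂) →
  removeF (n₁ ↑ʳ g) (sumList l₁ (g ∷ l₂)) ≡ sumList l₁ l₂
removeF-sumList-right {n₁} {n₂} g l₁ l₂ u = trans
  (removeF-++ (n₁ ↑ʳ g) (map (_↑ˡ n₂) l₁) (map (n₁ ↑ʳ_) (g ∷ l₂)))
  (cong₂ _++_ (removeF-absent {e = n₁ ↑ʳ g} (map (_↑ˡ n₂) l₁)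
      (λ i → let x , _ , p = ∈-map⁻ (_↑ˡ n₂) i in ↑ˡ≢↑ʳ n₂ x g (sym p)))
    (trans (removeF-map (n₁ ↑ʳ_) (Fin.↑ʳ-injective n₁ _ _) g (g ∷ l₂))
      (cong (map (n₁ ↑ʳ_)) (removeF-head u))))

-- The solution of the linear system

module TwoSumFormula {c ℓ} (R : CommutativeRing c ℓ) (α β γ : CommutativeRing.Carrier R) where
  open CommutativeRing R renaming (refl to ≈-refl; sym to ≈-sym; trans to ≈-trans; reflexive to ≈-reflexive)
  open Poly R
  open StateSum R α β γ
  open SetoidReasoning setoid
  open CommutativeSemigroup *-commutativeSemigroup using (interchange; x∙yz≈y∙xz)
  open CommutativeSemigroup +-commutativeSemigroup using () renaming (interchange to +-interchange)

  k : Carrier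
  k = α * β * γ

  -- k times this is the matrix of the linear system.
  mat : Op → Op → Carrier
  mat o t = pow α (extraCircles o t) * pow β (extraBlocks vert o t) * pow γ (extraBlocks bdry o t)

  single : Op → Carrier → Wt Carrier
  single del  x = wt5 x 0# 0# 0# 0#
  single con  x = wt5 0# x 0# 0# 0#
  single pen  x = wt5 0# 0# x 0# 0#
  single mdel x = wt5 0# 0# 0# x 0#
  single mcon x = wt5 0# 0# 0# 0# x

  sum5-single : ∀ t x g → sum5 (single t x) g ≈ x * g t
  sum5-single t x g = ≈-trans (≈-reflexive (sum5-def (single t x) g)) (go t)
    where
    _⊹_ : ∀ {a b y} → a ≈ y → b ≈ 0# → a + b ≈ y
    p ⊹ q = ≈-trans (+-cong p q) (+-identityʳ _)
    _⊰_ : ∀ {a b y} → a ≈ 0# → b ≈ y → a + b ≈ y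
    p ⊰ q = ≈-trans (+-cong p q) (+-identityˡ _)
    infixl 5 _⊹_ _⊰_
    z : ∀ y → 0# * y ≈ 0#
    z = zeroˡ
    go : ∀ t → Wt.wa (single t x) * g del + Wt.wb (single t x) * g con + Wt.wc (single t x) * g pen
      + Wt.wx (single t x) * g mdel + Wt.wy (single t x) * g mcon ≈ x * g t
    go del  = ≈-refl ⊹ z _ ⊹ z _ ⊹ z _ ⊹ z _
    go con  = z _ ⊰ ≈-refl ⊹ z _ ⊹ z _ ⊹ z _
    go pen  = z _ ⊹ z _ ⊰ ≈-refl ⊹ z _ ⊹ z _
    go mdel = z _ ⊹ z _ ⊹ z _ ⊰ ≈-refl ⊹ z _
    go mcon = z _ ⊹ z _ ⊹ z _ ⊹ z _ ⊰ ≈-refl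

  -- A linear combination of five weight tuples with coefficients from w: this is how the solutions
  -- for the five resolutions of an edge of H combine.
  mix : Wt Carrier → (Op → Wt Carrier) → Wt Carrier
  mix w φ = wt5 (sum5 w (λ o → Wt.wa (φ o))) (sum5 w (λ o → Wt.wb (φ o))) (sum5 w (λ o → Wt.wc (φ o)))
                (sum5 w (λ o → Wt.wx (φ o))) (sum5 w (λ o → Wt.wy (φ o)))

  sum5-mix : ∀ w φ g → sum5 (mix w φ) g ≈ sum5 w (λ o → sum5 (φ o) g)
  sum5-mix w φ g = ≈-trans (≈-reflexive (sum5-def (mix w φ) g)) (≈-sym (≈-trans
    (sum5-cong w {λ o → sum5 (φ o) g} {s₅} (λ o → ≈-reflexive (sum5-def (φ o) g)))
    (≈-trans (sum5-+ w s₄ (t Wt.wy mcon)) (+-cong (≈-trans (sum5-+ w s₃ (t Wt.wx mdel)) (+-cong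
      (≈-trans (sum5-+ w s₂ (t Wt.wc pen)) (+-cong (≈-trans (sum5-+ w (t Wt.wa del) (t Wt.wb con))
      (+-cong (m Wt.wa del) (m Wt.wb con))) (m Wt.wc pen))) (m Wt.wx mdel))) (m Wt.wy mcon)))))
    where
    t : (Wt Carrier → Carrier) → Op → Op → Carrier
    t f o' o = f (φ o) * g o'
    s₂ s₃ s₄ s₅ : Op → Carrier
    s₂ o = t Wt.wa del o + t Wt.wb con o
    s₃ o = s₂ o + t Wt.wc pen o
    s₄ o = s₃ o + t Wt.wx mdel o
    s₅ o = s₄ o + t Wt.wy mcon o
    m : ∀ f o' → sum5 w (t f o') ≈ sum5 w (λ o → f (φ o)) * g o'
    m f o' = ≈-trans (sum5-cong w {t f o'} {λ o → g o' * f (φ o)} (λ o → *-comm _ _))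
      (≈-trans (sum5-* w (g o') (λ o → f (φ o))) (*-comm _ _))

  pow-+ : ∀ x i j → pow x (i +ℕ j) ≈ pow x i * pow x j
  pow-+ x zero j = ≈-sym (*-identityˡ _)
  pow-+ x (suc i) j = ≈-trans (*-congˡ (pow-+ x i j)) (≈-sym (*-assoc _ _ _))

  sum5-coef : ∀ {v w} → v ≈W w → ∀ g → sum5 v g ≈ sum5 w g
  sum5-coef {v} {w} (p , q , r , s , t) g = ≈-trans (≈-reflexive (sum5-def v g)) (≈-trans
    (+-cong (+-cong (+-cong (+-cong (*-congʳ p) (*-congʳ q)) (*-congʳ r)) (*-congʳ s)) (*-congʳ t))
    (≈-reflexive (sym (sum5-def w g))))

  -- Each row compares the matrix of the statement with the normal forms of `mat`, in which powers
  -- with exponent 0 or 1 leave factors `1#`.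
  mat-solves : ∀ (r : Op → Carrier) (φ : Wt Carrier) → (∀ o → k * sum5 φ (mat o) ≈ r o) →
    Solves α β γ (wt5 (r del) (r con) (r pen) (r mdel) (r mcon)) φ
  mat-solves r φ h =
      row del  (αβ ⊞ one ⊞ one ⊞ αα ⊞ one)
    , row con  (one ⊞ αγ ⊞ one ⊞ one ⊞ αα)
    , row pen  (one ⊞ one ⊞ αα ⊞ one ⊞ one)
    , row mdel (αα ⊞ one ⊞ one ⊞ αα ⊞ one)
    , row mcon (one ⊞ αα ⊞ one ⊞ one ⊞ αα)
    where
    row : ∀ o {x} → x ≈ Wt.wa φ * mat o del + Wt.wb φ * mat o con + Wt.wc φ * mat o pen
      + Wt.wx φ * mat o mdel + Wt.wy φ * mat o mcon → k * x ≈ r o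
    row o p = ≈-trans (*-congˡ (≈-trans p (≈-reflexive (sym (sum5-def φ (mat o)))))) (h o)
    _⊞_ : ∀ {u v x y} → u ≈ v → x ≈ y → u + x ≈ v + y
    _⊞_ = +-cong
    infixl 5 _⊞_
    one : ∀ {p} → p ≈ p * (1# * 1# * 1#)
    one = ≈-sym (≈-trans (*-congˡ (≈-trans (*-identityʳ _) (*-identityʳ _))) (*-identityʳ _))
    αα : ∀ {p} → α * p ≈ p * (α * 1# * 1# * 1#)
    αα = ≈-trans (*-comm _ _) (*-congˡ (≈-sym (≈-trans (*-identityʳ _) (≈-trans (*-identityʳ _) (*-identityʳ _)))))
    αβ : ∀ {p} → α * β * p ≈ p * (α * 1# * (β * 1#) * 1#)
    αβ = ≈-trans (*-comm _ _) (*-congˡ (≈-sym (≈-trans (*-identityʳ _) (*-cong (*-identityʳ _) (*-identityʳ _)))))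
    αγ : ∀ {p} → α * γ * p ≈ p * (α * 1# * 1# * (γ * 1#))
    αγ = ≈-trans (*-comm _ _) (*-congˡ (≈-sym (*-cong (≈-trans (*-identityʳ _) (*-identityʳ _)) (*-identityʳ _))))

  open PAP

  -- The solution attached to the edge e of H, computed over the edges lH
  record Reduces (H : PAP Carrier) (e : Fin (n H)) (s : Bool) (lH : List (Fin (n H))) : Set (c Level.⊔ ℓ) where
    field
      φ       : Wt Carrier
      system  : ∀ o → k * sum5 φ (mat o) ≈ Qc lH (edgeOp o (core H) e)
      replace : ∀ (P : PAP Carrier) f lP → Unique (f ∷ lP) → GapWF (_∈ f ∷ lP) (Core.gap (core P)) →
        Qc (sumList lP lH) (sumCore P f H e s) ≈ sum5 φ (λ o → Qc lP (edgeOp o (core P) f))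

  -- A single state of H. `scale` collects the arrowless circles of H and those of their blocks that
  -- do not occur at e; this factor is common to the results of all five operations at e and to the
  -- 2-sum.
  module Base (H : PAP Carrier) (e : Fin (n H)) (s : Bool) (wf₂ : GapWF (_≡ e) (Core.gap (core H)))
              (t : Op) (ty : HasType (core H) e t) where
    private
      c₂ = core H
      module LH = Lone c₂ e wf₂
      αᴱ βᴱ γᴱ : Carrier
      αᴱ = pow α (len (abs c₂))
      βᴱ = pow β (countDistinct (LH.rest vert))
      γᴱ = pow γ (countDistinct (LH.rest bdry))

    scale : Carrier
    scale = αᴱ * βᴱ * γᴱ

    state : ∀ o → k * (scale * mat o t) ≈ Qc [] (edgeOp o c₂ e)
    state o = ≈-sym (begin
      Qc [] (edgeOp o c₂ e) ≈⟨ ≈-reflexive (Qc-[] (edgeOp o c₂ e)) ⟩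
      value (abs (edgeOp o c₂ e))
        ≈⟨ *-cong (*-cong (expand α (len (abs c₂)) (extraCircles o t) (LH.Apply.circle-count o t ty))
             (expand β (countDistinct (LH.rest vert)) (extraBlocks vert o t) (LH.Apply.block-count o t ty vert)))
             (expand γ (countDistinct (LH.rest bdry)) (extraBlocks bdry o t) (LH.Apply.block-count o t ty bdry)) ⟩
      α * (αᴱ * x) * (β * (βᴱ * y)) * (γ * (γᴱ * z))
        ≈⟨ *-congʳ (≈-trans (interchange _ _ _ _) (*-congˡ (interchange _ _ _ _))) ⟩
      α * β * (αᴱ * βᴱ * (x * y)) * (γ * (γᴱ * z))
        ≈⟨ ≈-trans (interchange _ _ _ _) (*-congˡ (interchange _ _ _ _)) ⟩
      k * (scale * mat o t) ∎)
      where
      x = pow α (extraCircles o t)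
      y = pow β (extraBlocks vert o t)
      z = pow γ (extraBlocks bdry o t)
      -- The `suc` splits off one factor α, β or γ; together these make up k.
      expand : ∀ u {i} j l → i ≡ j +ℕ suc l → pow u i ≈ u * (pow u j * pow u l)
      expand u j l refl = ≈-trans (pow-+ u j (suc l)) (x∙yz≈y∙xz _ _ _)

    sum : ∀ (P : PAP Carrier) f → GapWF (_≡ f) (Core.gap (core P)) →
      Qc [] (sumCore P f H e s) ≈ scale * Qc [] (edgeOp t (core P) f)
    sum P f wf₁ = begin
      Qc [] (sumCore P f H e s) ≈⟨ ≈-reflexive (Qc-[] (sumCore P f H e s)) ⟩
      value (abs (sumCore P f H e s))
        ≈⟨ *-cong (*-cong (expand α (len (abs c₂)) (len A') LS.sum-circles)
             (expand β (countDistinct (LH.rest vert)) (countDistinct (emp A' vert)) (LS.sum-blocks vert)))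
             (expand γ (countDistinct (LH.rest bdry)) (countDistinct (emp A' bdry)) (LS.sum-blocks bdry)) ⟩
      αᴱ * x * (βᴱ * y) * (γᴱ * z) ≈⟨ *-congʳ (interchange _ _ _ _) ⟩
      αᴱ * βᴱ * (x * y) * (γᴱ * z) ≈⟨ interchange _ _ _ _ ⟩
      scale * (x * y * z) ≈⟨ *-congˡ (≈-reflexive (sym (Qc-[] (edgeOp t (core P) f)))) ⟩
      scale * Qc [] (edgeOp t (core P) f) ∎
      where
      module LS = LoneSum P f H e s wf₁ wf₂ t ty
      A' = abs (edgeOp t (core P) f)
      x = pow α (len A')
      y = pow β (countDistinct (emp A' vert))
      z = pow γ (countDistinct (emp A' bdry))
      expand : ∀ u {i} j l → i ≡ j +ℕ l → pow u i ≈ pow u j * pow u l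
      expand u j l refl = pow-+ u j l

  ∈-singleton : ∀ {n} {i e : Fin n} → i ∈ e ∷ [] → i ≡ e
  ∈-singleton (here p) = p

  module _ (H : PAP Carrier) {e : Fin (n H)} {s : Bool} {lH : List (Fin (n H))}
           (uH : Unique (e ∷ lH)) (wf₂ : GapWF (_∈ e ∷ lH) (Core.gap (core H))) where

    sum-WF : ∀ (P : PAP Carrier) {f lP} → Unique (f ∷ lP) → GapWF (_∈ f ∷ lP) (Core.gap (core P)) →
      GapWF (_∈ sumList lP lH) (Core.gap (sumCore P f H e s))
    sum-WF P {f} {lP} uP wf₁ = GapWF-map ∈-sumList⁺ (∈-sumList⁻ lP)
      (twoSum-WF P f H e s (Removal-here uP) (Removal-here uH) wf₁ wf₂)

  swap-states : ∀ {n} {e g : Fin n} {es} {c : Core Carrier n} → Unique (e ∷ g ∷ es) →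
    GapWF (_∈ e ∷ g ∷ es) (Core.gap c) → ∀ o →
    Qc (g ∷ es) (edgeOp o c e) ≈ sum5 (wt c g) (λ o' → Qc es (edgeOp o (edgeOp o' c g) e))
  swap-states {e = e} {g} {es} {c} (u ∷ us) wf o = ≈-trans (≈-reflexive (trans (Qc-∷ g es (edgeOp o c e))
      (cong (λ w → sum5 w (λ o' → Qc es (edgeOp o' (edgeOp o c e) g))) (edgeOp-wt o re c wf g))))
    (sum5-cong (wt c g) λ o' → Qc-cong es (AllPairs.tail us)
      (edgeOp-WF o' rg _ (edgeOp-WF o re c wf)) (edgeOp-WF o te _ (edgeOp-WF o' tg c wf))
      (edgeOp-comm o o' re rg tg te c wf))
    where
    re = Removal-here (u ∷ us)
    rg = Removal-here us
    tg = Removal-second (u ∷ us)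
    te = Removal-here (Unique-second (u ∷ us))

  module _ (H : PAP Carrier) (e : Fin (n H)) (s : Bool) (wf₂ : GapWF (_∈ e ∷ []) (Core.gap (core H)))
           (φ : Wt Carrier)
           (single-edge : ∀ (P : PAP Carrier) f → GapWF (_≡ f) (Core.gap (core P)) →
              Qc [] (sumCore P f H e s) ≈ sum5 φ (λ o → Qc [] (edgeOp o (core P) f))) where
    private
      uH : Unique (e ∷ [])
      uH = [] ∷ []

    -- Induction on the edges of P with φ fixed. With no other edges of H left, the head of the edge
    -- list comes from P and can be resolved at once; then the sums over its resolutions and over φ
    -- are exchanged.
    replace-edges : ∀ (P : PAP Carrier) f lP → Unique (f ∷ lP) → GapWF (_∈ f ∷ lP) (Core.gap (core P)) →
      Qc (sumList lP []) (sumCore P f H e s) ≈ sum5 φ (λ o → Qc lP (edgeOp o (core P) f))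
    replace-edges P f [] uP wf₁ = single-edge P f (GapWF-map ∈-singleton (λ { refl → here refl }) wf₁)
    replace-edges P f (g ∷ lP) uP@(u ∷ us) wf₁ = begin
      Qc (sumList (g ∷ lP) []) (sumCore P f H e s)
        ≈⟨ ≈-reflexive (trans (Qc-∷ (g ↑ˡ n H) (sumList lP []) (sumCore P f H e s))
             (cong (λ w → sum5 w (λ o → Qc (sumList lP []) (edgeOp o (sumCore P f H e s) (g ↑ˡ n H))))
               (trans (sumCore-wt P f H e s (g ↑ˡ n H)) (wt-inL P H g)))) ⟩
      sum5 w (λ o → Qc (sumList lP []) (edgeOp o (sumCore P f H e s) (g ↑ˡ n H)))
        ≈⟨ sum5-cong w (λ o → ≈-trans
             (Qc-cong (sumList lP []) (sumList-unique (AllPairs.tail us) [])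
               (GapWF-map ∈-sumList⁺ (∈-sumList⁻ lP) (edgeOp-WF o (Removalˡ rg) _
                 (twoSum-WF P f H e s rf re wf₁ wf₂)))
               (sum-WF H uH wf₂ (P' o) (Unique-second uP) (edgeOp-WF o tg (core P) wf₁))
               (CoreEq-map (∈-sumList⁻ lP) (twoSum-edgeOpˡ P f H e s o {g} rf rg tg tf re wf₁ wf₂ [])))
             (replace-edges (P' o) f lP (Unique-second uP) (edgeOp-WF o tg (core P) wf₁))) ⟩
      sum5 w (λ o → sum5 φ (λ o' → Qc lP (edgeOp o' (edgeOp o (core P) g) f)))
        ≈⟨ sum5-swap w φ (λ o o' → Qc lP (edgeOp o' (edgeOp o (core P) g) f)) ⟩
      sum5 φ (λ o' → sum5 w (λ o → Qc lP (edgeOp o' (edgeOp o (core P) g) f)))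
        ≈⟨ sum5-cong φ (λ o' → ≈-sym (swap-states uP wf₁ o')) ⟩
      sum5 φ (λ o' → Qc (g ∷ lP) (edgeOp o' (core P) f)) ∎
      where
      w = wt (core P) g
      P' : Op → PAP Carrier
      P' o = pap (n P) [] (edgeOp o (core P) g)
      rf = Removal-here uP
      rg = Removal-here us
      tg = Removal-second uP
      tf = Removal-here (Unique-second uP)
      re = Removal-here uH

  -- Induction on the edges of H other than e. For a single state φ is concentrated at the type of
  -- the state. At an edge g the solutions for its five resolutions are combined by `mix`, which is
  -- legitimate because the system and the replacement formula are both linear in φ.
  reduce : ∀ (H : PAP Carrier) e s lH → Unique (e ∷ lH) → GapWF (_∈ e ∷ lH) (Core.gap (core H)) →
    Reduces H e s lH
  reduce H e s [] uH wf₂ = record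
    { φ = single t B.scale
    ; system = λ o → ≈-trans (*-congˡ (sum5-single t B.scale (mat o))) (B.state o)
    ; replace = replace-edges H e s wf₂ (single t B.scale) λ P f wf₁ →
        ≈-trans (B.sum P f wf₁) (≈-sym (sum5-single t B.scale (λ o → Qc [] (edgeOp o (core P) f)))) }
    where
    wf′ = GapWF-map ∈-singleton (λ { refl → here refl }) wf₂
    t = proj₁ (type (core H) e wf′)
    module B = Base H e s wf′ t (proj₂ (type (core H) e wf′))
  reduce H e s (g ∷ lH) uH@(u ∷ us) wf₂ = record
    { φ = mix w φ
    ; system = λ o → begin
        k * sum5 (mix w φ) (mat o) ≈⟨ *-congˡ (sum5-mix w φ (mat o)) ⟩
        k * sum5 w (λ o' → sum5 (φ o') (mat o)) ≈⟨ ≈-sym (sum5-* w k (λ o' → sum5 (φ o') (mat o))) ⟩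
        sum5 w (λ o' → k * sum5 (φ o') (mat o)) ≈⟨ sum5-cong w (λ o' → Reduces.system (IH o') o) ⟩
        sum5 w (λ o' → Qc lH (edgeOp o (edgeOp o' (core H) g) e)) ≈⟨ ≈-sym (swap-states uH wf₂ o) ⟩
        Qc (g ∷ lH) (edgeOp o (core H) e) ∎
    ; replace = repl }
    where
    w = wt (core H) g
    H' : Op → PAP Carrier
    H' o = pap (n H) [] (edgeOp o (core H) g)
    re = Removal-here uH
    rg = Removal-here us
    tg = Removal-second uH
    te = Removal-here (Unique-second uH)
    IH : ∀ o → Reduces (H' o) e s lH
    IH o = reduce (H' o) e s lH (Unique-second uH) (edgeOp-WF o tg (core H) wf₂)
    φ : Op → Wt Carrier
    φ o = Reduces.φ (IH o)
    repl : ∀ (P : PAP Carrier) f lP → Unique (f ∷ lP) → GapWF (_∈ f ∷ lP) (Core.gap (core P)) →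
      Qc (sumList lP (g ∷ lH)) (sumCore P f H e s) ≈ sum5 (mix w φ) (λ o → Qc lP (edgeOp o (core P) f))
    repl P f lP uP@(_ ∷ usP) wf₁ = begin
      Qc (sumList lP (g ∷ lH)) S
        -- In the edge list g stands behind the edges of P, so it has to be brought to the front.
        ≈⟨ Qc-pull (sumList lP (g ∷ lH)) {S} {n P ↑ʳ g} (sumList-unique usP us)
             (∈-sumList⁺ {l₁ = lP} (inʳ (here refl))) (sum-WF H uH wf₂ P uP wf₁) ⟩
      sum5 (wt S (n P ↑ʳ g)) (λ o → Qc (removeF (n P ↑ʳ g) (sumList lP (g ∷ lH))) (edgeOp o S (n P ↑ʳ g)))
        ≈⟨ ≈-reflexive (cong₂ (λ v l → sum5 v (λ o → Qc l (edgeOp o S (n P ↑ʳ g))))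
             (trans (sumCore-wt P f H e s (n P ↑ʳ g)) (wt-inR P H g)) (removeF-sumList-right g lP lH us)) ⟩
      sum5 w (λ o → Qc (sumList lP lH) (edgeOp o S (n P ↑ʳ g)))
        ≈⟨ sum5-cong w (λ o → ≈-trans
             (Qc-cong (sumList lP lH) (sumList-unique usP (AllPairs.tail us))
               (GapWF-map ∈-sumList⁺ (∈-sumList⁻ lP) (edgeOp-WF o (Removalʳ rg) S
                 (twoSum-WF P f H e s rf re wf₁ wf₂)))
               (sum-WF (H' o) (Unique-second uH) (edgeOp-WF o tg (core H) wf₂) P uP wf₁)
               (CoreEq-map (∈-sumList⁻ lP) (twoSum-edgeOpʳ P f H e s o {g} re rg tg te rf wf₁ wf₂ [])))
             (Reduces.replace (IH o) P f lP uP wf₁)) ⟩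
      sum5 w (λ o → sum5 (φ o) (λ o' → Qc lP (edgeOp o' (core P) f)))
        ≈⟨ ≈-sym (sum5-mix w φ (λ o' → Qc lP (edgeOp o' (core P) f))) ⟩
      sum5 (mix w φ) (λ o → Qc lP (edgeOp o (core P) f)) ∎
      where
      S = sumCore P f H e s
      rf = Removal-here uP

LabEq-trans : ∀ {X : Set} {L : X → Set} {l₁ l₂ l₃ : X → ℕ} {e₁ e₂ e₃ : List ℕ} →
  LabEq L l₁ l₂ e₁ e₂ → LabEq L l₂ l₃ e₂ e₃ → LabEq L l₁ l₃ e₁ e₃
LabEq-trans d e = record
  { ρ = λ l → e.ρ (d.ρ l)
  ; ρ' = λ l → d.ρ' (e.ρ' l)
  ; ρ-lab = λ l → trans (e.ρ-lab l) (cong e.ρ (d.ρ-lab l))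
  ; ρ'-lab = λ l → trans (d.ρ'-lab l) (cong d.ρ' (e.ρ'-lab l))
  ; ρ-emp = λ i → let j , p = d.ρ-emp i ; k , q = e.ρ-emp j in k , trans (cong d.ρ' q) p
  ; ρ'-emp = λ i → let j , p = e.ρ'-emp i ; k , q = d.ρ'-emp j in k , trans (cong e.ρ q) p }
  where
  module d = LabEq d
  module e = LabEq e

≅-trans : ∀ {X : Set} {L : X → Set} {A B C : Pres X} → A ≅[ L ] B → B ≅[ L ] C → A ≅[ L ] C
≅-trans d e = record
  { gap≡ = λ l → trans (_≅[_]_.gap≡ d l) (_≅[_]_.gap≡ e l)
  ; len≡ = trans (_≅[_]_.len≡ d) (_≅[_]_.len≡ e)
  ; lab≡ = λ s → LabEq-trans (_≅[_]_.lab≡ d s) (_≅[_]_.lab≡ e s) }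

-- Changing weights

module _ {a} {A : Set a} where

  reweight : ∀ {n} → Core A n → (Fin n → Wt A) → Core A n
  reweight c w = record c { wt = w }

  same-presentation : ∀ {X : Set} {L : X → Set} {B C : Pres X} → (∀ {x} → L x → gap B x ≡ gap C x) →
    len B ≡ len C → (∀ s {x} → L x → lab B s x ≡ lab C s x) → (∀ s → emp B s ≡ emp C s) → B ≅[ L ] C
  same-presentation {B = B} g l h m = record { gap≡ = g ; len≡ = l ; lab≡ = λ s → record
    { ρ = λ z → z ; ρ' = λ z → z ; ρ-lab = λ k → sym (h s k) ; ρ'-lab = λ k → h s k
    ; ρ-emp = λ i → subst (_ ∈_) (m s) i , refl ; ρ'-emp = λ i → subst (_ ∈_) (sym (m s)) i , refl } }

  labC-reweight : ∀ {n} (c : Core A n) w s x → labC (reweight c w) s x ≡ labC c s x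
  labC-reweight c w vert x = refl
  labC-reweight c w bdry x = refl

  reweight-≅ : ∀ {n} {E : Fin n → Set} (c : Core A n) w → abs (reweight c w) ≅[ On E ] abs c
  reweight-≅ c w = same-presentation (λ _ → refl) refl (λ s {x} _ → labC-reweight c w s x) (λ s → refl)

  module _ (P H : PAP A) (w : Fin (n P) → Wt A) {E₁ : Fin (n P) → Set} {E₂ : Fin (n H) → Set}
           (wf₁ : GapWF E₁ (Core.gap (core P))) (wf₂ : GapWF E₂ (Core.gap (core H))) where
    private
      P' = withWt P w

    union-reweight : abs (core (union P H)) ≅[ On (E₁ ⊕ E₂) ] abs (core (union P' H))
    union-reweight = same-presentation gaps
      (trans (len-union P H wf₁ wf₂) (sym (len-union P' H wf₁ wf₂)))
      labs (λ s → trans (emp-union P H wf₁ wf₂ s) (sym (emp-union P' H wf₁ wf₂ s)))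
      where
      gaps : ∀ {x} → On (E₁ ⊕ E₂) x → Core.gap (core (union P H)) x ≡ Core.gap (core (union P' H)) x
      gaps l with ⊕-view l
      ... | inj₁ (x , _ , refl) = trans (gap-inL P H x) (sym (gap-inL P' H x))
      ... | inj₂ (x , _ , refl) = trans (gap-inR P H x) (sym (gap-inR P' H x))
      labs : ∀ s {x} → On (E₁ ⊕ E₂) x → labC (core (union P H)) s x ≡ labC (core (union P' H)) s x
      labs s l with ⊕-view l
      ... | inj₁ (x , k , refl) = trans (labC-inL P H wf₁ wf₂ s k)
              (sym (trans (labC-inL P' H wf₁ wf₂ s k) (cong even (labC-reweight (core P) w s x))))
      ... | inj₂ (x , k , refl) = trans (labC-inR P H wf₁ wf₂ s k) (sym (labC-inR P' H wf₁ wf₂ s k))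

    -- In the iteration P receives the weights that stand for the later summands, whereas the 2-sum
    -- was formed with the original ones. Gaps, labels and circles do not see the difference.
    twoSum-reweight : ∀ {f e E₁' E₂'} s (r₁ : Removal f E₁ E₁') (r₂ : Removal e E₂ E₂') →
      abs (sumCore P f H e s) ≅[ On (E₁' ⊕ E₂') ] abs (sumCore P' f H e s)
    twoSum-reweight {f} {e} s r₁ r₂ = Surg-cong {K = K} {K' = K}
      (abs-WF (core (union P H)) (union-WF P H wf₁ wf₂))
      (abs-WF (core (union P' H)) (union-WF P' H wf₁ wf₂)) same same union-reweight
      (twoSum-Surg P f H e s r₁ r₂ wf₁ wf₂) (twoSum-Surg P' f H e s r₁ r₂ wf₁ wf₂)
      where
      K = sumCut f e s r₁ r₂
      same : K ⊑ K
      same = record { D⊑ = λ d → d ; M⊑ = λ m → m ; J⊑ = λ _ j → j }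

replaceW-map : ∀ {a} {A : Set a} {n m} (h : Fin n → Fin m) → (∀ {i j} → h i ≡ h j → i ≡ j) →
  ∀ {k} (f : Fin k → Fin n) φ (w : Fin n → Wt A) (v : Fin m → Wt A) → (∀ j → v (h j) ≡ w j) →
  ∀ j → replaceW (λ i → h (f i)) φ v (h j) ≡ replaceW f φ w j
replaceW-map h inj {zero} f φ w v q j = q j
replaceW-map h inj {suc k} f φ w v q j
  with finEq (f Fin.zero) j in p | finEq (h (f Fin.zero)) (h j) in p'
... | true  | true  = refl
... | false | false = replaceW-map h inj (λ i → f (Fin.suc i)) (λ i → φ (Fin.suc i)) w v q j
... | true  | false with () ← trans (sym (⇒finEq (cong h (finEq⇒ {i = f Fin.zero} p)))) p'
replaceW-map h inj {suc k} f φ w v q j | false | true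
  with () ← trans (sym (⇒finEq (inj (finEq⇒ {i = h (f Fin.zero)} p')))) p

replaceW-miss : ∀ {a} {A : Set a} {m k} (f : Fin k → Fin m) φ (w : Fin m → Wt A) {j} →
  (∀ i → f i ≢ j) → replaceW f φ w j ≡ w j
replaceW-miss {k = zero}  f φ w h = refl
replaceW-miss {k = suc k} f φ w {j} h with finEq (f Fin.zero) j in p
... | true  = ⊥-elim (h Fin.zero (finEq⇒ p))
... | false = replaceW-miss (λ i → f (Fin.suc i)) (λ i → φ (Fin.suc i)) w (λ i → h (Fin.suc i))

-- Replaces `Valid` in the iteration, because a 2-sum keeps the slots of removed edges: `live` no
-- longer lists all slots, and gaps are controlled on live edges only.
record Proper {a} {A : Set a} (P : PAP A) : Set where
  field
    unique : Unique (live P)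
    gaps   : GapWF (_∈ live P) (Core.gap (core P))

module _ {a} {A : Set a} where

  Valid-live : ∀ (P : PAP A) → Valid P → ∀ e → e ∈ live P
  Valid-live P (eq , _) e = subst (e ∈_) (sym eq) (∈-allFin e)

  Valid-Proper : ∀ (P : PAP A) → Valid P → Proper P
  Valid-Proper P (eq , inv , nofix) = record
    { unique = subst Unique (sym eq) (Unique.allFin⁺ (n P))
    ; gaps = record { gap-L = λ _ → on (Valid-live P (eq , inv , nofix) _)
                    ; gap-inv = λ {x} _ → inv x ; gap-≢ = λ {x} _ → nofix x } }

  focus : ∀ {P : PAP A} {f} → Proper P → f ∈ live P →
    Unique (f ∷ removeF f (live P)) × GapWF (_∈ f ∷ removeF f (live P)) (Core.gap (core P))
  focus {P} {f} pr i =
      All.tabulate (λ j p → proj₂ (∈-removeF⁻ f (live P) j) (sym p)) ∷ removeF-unique f (Proper.unique pr)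
    , GapWF-map (λ j → [ here , there ]′ (Removal.split r j))
        (λ { (here refl) → i ; (there j) → Removal.rest r j }) (Proper.gaps pr)
    where r = Removal-removeF i

  live-twoSum : ∀ (P : PAP A) f H e s →
    live (twoSum P f H e s) ≡ sumList (removeF f (live P)) (removeF e (live H))
  live-twoSum P f H e s = removeF-sumList f e (live P) (live H)

  sumEdges : ∀ (P : PAP A) f (H : PAP A) e → List (Fin (n P +ℕ n H))
  sumEdges P f H e = sumList (removeF f (live P)) (removeF e (live H))

  module _ (P : PAP A) (f : Fin (n P)) (H : PAP A) (e : Fin (n H)) (s : Bool)
           (pP : Proper P) (i : f ∈ live P) (pH : Proper H) (j : e ∈ live H) where

    sumEdges-unique : Unique (sumEdges P f H e)
    sumEdges-unique = sumList-unique (removeF-unique f (Proper.unique pP)) (removeF-unique e (Proper.unique pH))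

    sumCore-WF : GapWF (_∈ sumEdges P f H e) (Core.gap (sumCore P f H e s))
    sumCore-WF = GapWF-map ∈-sumList⁺ (∈-sumList⁻ (removeF f (live P)))
      (twoSum-WF P f H e s (Removal-removeF i) (Removal-removeF j) (Proper.gaps pP) (Proper.gaps pH))

    twoSum-Proper : Proper (twoSum P f H e s)
    twoSum-Proper = record
      { unique = subst Unique (sym (live-twoSum P f H e s)) sumEdges-unique
      ; gaps = subst (λ l → GapWF (_∈ l) (Core.gap (core (twoSum P f H e s)))) (sym (live-twoSum P f H e s))
          (subst (λ c → GapWF (_∈ sumEdges P f H e) (Core.gap c)) (sumCore-def P f H e s) sumCore-WF) }

-- Absorbing the summands one by one

module Substitution {c ℓ} (R : CommutativeRing c ℓ) (α β γ : CommutativeRing.Carrier R) where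
  open CommutativeRing R renaming (refl to ≈-refl; sym to ≈-sym; trans to ≈-trans; reflexive to ≈-reflexive)
  open Poly R
  open StateSum R α β γ
  open TwoSumFormula R α β γ
  open SetoidReasoning setoid

  abstract
    Qₚ : PAP Carrier → Carrier
    Qₚ P = Q P α β γ

    Qₚ-def : ∀ P → Qₚ P ≡ Q P α β γ
    Qₚ-def P = refl

    Qₚ-Qc : ∀ P → Qₚ P ≈ Qc (live P) (core P)
    Qₚ-Qc P = ≈-reflexive (sym (Qc-def (live P) (core P)))

  -- The new weights are described by their values, φ at f and the old tuples elsewhere, because the
  -- iteration supplies them as one `replaceW` over all summands.
  twoSum-replace : ∀ (P H : PAP Carrier) f e s φ (w : Fin (n P) → Wt Carrier) →
    Proper P → f ∈ live P → Proper H → e ∈ live H →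
    IsUniqueSolution α β γ (rhs H e α β γ) φ →
    w f ≡ φ → (∀ {j} → j ≢ f → w j ≡ wt (core P) j) →
    Qc (sumEdges P f H e) (sumCore P f H e s) ≈ Qₚ (withWt P w)
  twoSum-replace P H f e s φ w pP i pH j (_ , unique) wf w≢ = begin
    Qc (sumList lP lH) (sumCore P f H e s) ≈⟨ red.replace P f lP uP wfP ⟩
    sum5 red.φ (λ o → Qc lP (edgeOp o (core P) f))
      ≈⟨ sum5-coef {red.φ} {φ} (unique red.φ (mat-solves r red.φ solves)) (λ o → Qc lP (edgeOp o (core P) f)) ⟩
    sum5 φ (λ o → Qc lP (edgeOp o (core P) f))
      ≈⟨ sum5-cong φ (λ o → Qc-cong lP (AllPairs.tail uP) (edgeOp-WF o rf (core P) wfP)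
           (edgeOp-WF o rf c' wfP) (states o)) ⟩
    sum5 φ (λ o → Qc lP (edgeOp o c' f))
      ≈⟨ ≈-reflexive (cong (λ v → sum5 v (λ o → Qc lP (edgeOp o c' f))) (sym wf)) ⟩
    sum5 (w f) (λ o → Qc lP (edgeOp o c' f))
      ≈⟨ ≈-sym (Qc-pull (live P) {c'} (Proper.unique pP) i (Proper.gaps pP)) ⟩
    Qc (live P) c' ≈⟨ ≈-sym (Qₚ-Qc (withWt P w)) ⟩
    Qₚ (withWt P w) ∎
    where
    c' = reweight (core P) w
    lP = removeF f (live P)
    lH = removeF e (live H)
    uP = proj₁ (focus {P = P} pP i)
    wfP = proj₂ (focus {P = P} pP i)
    rf = Removal-here uP
    module red = Reduces (reduce H e s lH (proj₁ (focus {P = H} pH j)) (proj₂ (focus {P = H} pH j)))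
    r : Op → Carrier
    r o = Q (applyOp o H e) α β γ
    solves : ∀ o → k * sum5 red.φ (mat o) ≈ r o
    solves o = ≈-trans (red.system o) (≈-reflexive (Qc-def lH (edgeOp o (core H) e)))
    K : ∀ o → edgeCut o f rf ⊑ edgeCut o f rf
    K o = edgeCut-⊑ o f
    states : ∀ o → CoreEq (_∈ lP) (edgeOp o (core P) f) (edgeOp o c' f)
    states o = record
      { abs≅ = Surg-cong (abs-WF (core P) wfP) (abs-WF c' wfP) (K o) (K o)
          (≅-sym (reweight-≅ (core P) w)) (edgeOp-Surg o rf (core P) wfP) (edgeOp-Surg o rf c' wfP)
      ; wt≡ = λ {j} l → trans (edgeOp-wt o rf (core P) wfP j)
          (trans (sym (w≢ (λ { refl → Removal.absent rf l }))) (sym (edgeOp-wt o rf c' wfP j))) }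

  -- The recursion starts from the 2-sum of P with the first summand. There the later summands turn
  -- into weights, which are moved back to P before the first summand is absorbed. `emb` locates the
  -- original edges in the growing edge set.
  iterate : ∀ k (P : PAP Carrier) {m} (emb : Fin m → Fin (n P)) → Injective _≡_ _≡_ emb → Proper P →
    (H : Fin k → PAP Carrier) (f : Fin k → Fin m) (e : ∀ i → Fin (n (H i))) (s : Fin k → Bool)
    (φ : Fin k → Wt Carrier) → Injective _≡_ _≡_ f → (∀ i → emb (f i) ∈ live P) →
    (∀ i → Proper (H i)) → (∀ i → e i ∈ live (H i)) →
    (∀ i → IsUniqueSolution α β γ (rhs (H i) (e i) α β γ) (φ i)) →
    Qₚ (iter2Sum P emb (tabulate (λ i → record { H = H i ; f = f i ; e = e i ; s = s i })))
      ≈ Qₚ (withWt P (replaceW (λ i → emb (f i)) φ (wt (core P))))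
  iterate zero P emb emb-inj pP H f e s φ f-inj f∈ pH e∈ sol = ≈-refl
  iterate (suc k) P emb emb-inj pP H f e s φ f-inj f∈ pH e∈ sol = begin
    Qₚ (iter2Sum P' emb' (tabulate others))
      ≈⟨ iterate k P' emb' (λ p → emb-inj (Fin.↑ˡ-injective n₂ _ _ p))
           pP'
           (λ i → H (Fin.suc i)) f' (λ i → e (Fin.suc i)) (λ i → s (Fin.suc i)) φ'
           (λ p → Fin.suc-injective (f-inj p)) live'
           (λ i → pH (Fin.suc i)) (λ i → e∈ (Fin.suc i)) (λ i → sol (Fin.suc i)) ⟩
    Qₚ (withWt P' W') ≈⟨ Qₚ-Qc (withWt P' W') ⟩
    Qc (live P') (reweight (core P') W')
      ≈⟨ ≈-reflexive (cong₂ (λ l c → Qc l (reweight c W'))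
           (live-twoSum P f₀ H₀ e₀ s₀) (sym (sumCore-def P f₀ H₀ e₀ s₀))) ⟩
    Qc es (reweight (sumCore P f₀ H₀ e₀ s₀) W')
      ≈⟨ Qc-cong es (sumEdges-unique P f₀ H₀ e₀ s₀ pP (f∈ Fin.zero) (pH Fin.zero) (e∈ Fin.zero))
           (unweighted (sumCore-WF P f₀ H₀ e₀ s₀ pP (f∈ Fin.zero) (pH Fin.zero) (e∈ Fin.zero)))
           (sumCore-WF P₁ f₀ H₀ e₀ s₀ pP₁ (f∈ Fin.zero) (pH Fin.zero) (e∈ Fin.zero)) same ⟩
    Qc es (sumCore P₁ f₀ H₀ e₀ s₀)
      ≈⟨ twoSum-replace P₁ H₀ f₀ e₀ s₀ (φ Fin.zero) W pP₁ (f∈ Fin.zero) (pH Fin.zero) (e∈ Fin.zero)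
           (sol Fin.zero) hit miss ⟩
    Qₚ (withWt P₁ W) ∎
    where
    others : Fin k → Summand _
    others i = record { H = H (Fin.suc i) ; f = f (Fin.suc i) ; e = e (Fin.suc i) ; s = s (Fin.suc i) }
    H₀ = H Fin.zero
    n₂ = n H₀
    f₀ = emb (f Fin.zero)
    e₀ = e Fin.zero
    s₀ = s Fin.zero
    f' : Fin k → Fin _
    f' i = f (Fin.suc i)
    φ' : Fin k → Wt Carrier
    φ' i = φ (Fin.suc i)
    P' = twoSum P f₀ H₀ e₀ s₀
    emb' : Fin _ → Fin (n P')
    emb' i = emb i ↑ˡ n₂
    W₁ : Fin (n P) → Wt Carrier
    W₁ = replaceW (λ i → emb (f' i)) φ' (wt (core P))
    P₁ = withWt P W₁
    es = sumEdges P f₀ H₀ e₀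
    pP₁ : Proper P₁
    pP₁ = record { unique = Proper.unique pP ; gaps = Proper.gaps pP }
    pP' : Proper P'
    pP' = twoSum-Proper P f₀ H₀ e₀ s₀ pP (f∈ Fin.zero) (pH Fin.zero) (e∈ Fin.zero)
    W' : Fin (n P') → Wt Carrier
    W' = replaceW (λ i → emb' (f' i)) φ' (wt (core P'))
    W : Fin (n P) → Wt Carrier
    W = replaceW (λ i → emb (f i)) φ (wt (core P))
    unweighted : GapWF (_∈ es) (Core.gap (sumCore P f₀ H₀ e₀ s₀)) →
      GapWF (_∈ es) (Core.gap (reweight (sumCore P f₀ H₀ e₀ s₀) W'))
    unweighted wf = record { gap-L = GapWF.gap-L wf ; gap-inv = GapWF.gap-inv wf ; gap-≢ = GapWF.gap-≢ wf }
    f₀≢ : ∀ i → emb (f' i) ≢ f₀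
    f₀≢ i p with () ← f-inj (emb-inj p)
    live' : ∀ i → emb' (f' i) ∈ live P'
    live' i = subst (emb' (f' i) ∈_) (sym (live-twoSum P f₀ H₀ e₀ s₀))
      (∈-sumList⁺ (inˡ (∈-removeF⁺ f₀ (f∈ (Fin.suc i)) (f₀≢ i))))
    hit : W f₀ ≡ φ Fin.zero
    hit rewrite ⇒finEq {i = f₀} refl = refl
    miss : ∀ {j} → j ≢ f₀ → W j ≡ W₁ j
    miss {j} h with finEq f₀ j in p
    ... | true  = ⊥-elim (h (sym (finEq⇒ p)))
    ... | false = refl
    rf = Removal-removeF (f∈ Fin.zero)
    re = Removal-removeF (e∈ Fin.zero)
    weights : ∀ {j} → ((_∈ removeF f₀ (live P)) ⊕ (_∈ removeF e₀ (live H₀))) j →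
      W' j ≡ wt (core (union P₁ H₀)) j
    weights (inˡ {i} _) = trans
      (replaceW-map (_↑ˡ n₂) (Fin.↑ˡ-injective n₂ _ _) (λ i → emb (f' i)) φ' (wt (core P))
        (wt (core P')) (wt-inL P H₀) i)
      (sym (wt-inL P₁ H₀ i))
    weights (inʳ {i} _) = trans (replaceW-miss (λ i → emb' (f' i)) φ' (wt (core P')) (λ _ → ↑ˡ≢↑ʳ n₂ _ _))
      (trans (wt-inR P H₀ i) (sym (wt-inR P₁ H₀ i)))
    same : CoreEq (_∈ es) (reweight (sumCore P f₀ H₀ e₀ s₀) W') (sumCore P₁ f₀ H₀ e₀ s₀)
    same = CoreEq-map (∈-sumList⁻ (removeF f₀ (live P))) record
      { abs≅ = ≅-trans (reweight-≅ (sumCore P f₀ H₀ e₀ s₀) W')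
          (twoSum-reweight P H₀ W₁ (Proper.gaps pP) (Proper.gaps (pH Fin.zero)) s₀ rf re)
      ; wt≡ = λ {j} l → trans (weights l) (sym (sumCore-wt P₁ f₀ H₀ e₀ s₀ j)) }

theorem3p7 : ∀ {c ℓ} (R : CommutativeRing c ℓ) →
    let open CommutativeRing R in
    let open Poly R in
    (P : PAP Carrier) (k : ℕ) (H : Fin k → PAP Carrier)
    (f : Fin k → Fin (PAP.n P)) (e : (i : Fin k) → Fin (PAP.n (H i)))
    (s : Fin k → Bool) (α β γ : Carrier) (φ : Fin k → Wt Carrier) →
    Valid P → (∀ i → Valid (H i)) → Injective _≡_ _≡_ f →
    (∀ i → IsUniqueSolution α β γ (rhs (H i) (e i) α β γ) (φ i)) →
    Q (Pk P k H f e s) α β γ ≈ Q (withWt P (replaceW f φ (Core.wt (PAP.core P)))) α β γ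
theorem3p7 R P k H f e s α β γ φ vP vH f-inj sol = begin
  Q (Pk P k H f e s) α β γ
    -- As a `tabulate` the list of summands unfolds along k, which the recursion of `iterate`
    -- requires.
    ≈⟨ reflexive (cong (λ σ → Q (iter2Sum P (λ i → i) σ) α β γ)
         (map-tabulate (λ i → i) (λ i → record { H = H i ; f = f i ; e = e i ; s = s i }))) ⟩
  Q P[k] α β γ ≈⟨ reflexive (sym (Qₚ-def P[k])) ⟩
  Qₚ P[k]
    ≈⟨ iterate k P (λ i → i) (λ p → p) (Valid-Proper P vP) H f e s φ f-inj
         (λ i → Valid-live P vP (f i)) (λ i → Valid-Proper (H i) (vH i))
         (λ i → Valid-live (H i) (vH i) (e i)) sol ⟩
  Qₚ (withWt P w') ≈⟨ reflexive (Qₚ-def (withWt P w')) ⟩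
  Q (withWt P w') α β γ ∎
  where
  open CommutativeRing R using (reflexive; setoid)
  open Poly R
  open Substitution R α β γ
  open SetoidReasoning setoid
  P[k] = iter2Sum P (λ i → i) (tabulate (λ i → record { H = H i ; f = f i ; e = e i ; s = s i }))
  w' = replaceW f φ (Core.wt (PAP.core P))
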